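{- There exists an infinite family of metric spaces $\{(V_\ell,d_{V_\ell})\}$ and terminal sequences $\{\sigma_\ell\}$ (with $\sigma_\ell$ a sequence of points of $V_\ell$) such that every probabilistic online embedding of $\sigma_\ell$ into HSTs has expected distortion at least $$\Omega\left(\frac{\log k\cdot\log\Phi_\ell}{\log\log k}\right),$$ where $k=|\sigma_\ell|$ and $\Phi_\ell$ is the aspect ratio of $(V_\ell,d_{V_\ell})$; moreover $\Phi_\ell$ can be as large as $2^{k^{1-\delta}}$ for any fixed $\delta\in(0,1)$.
   Context: An online embedding of a sequence of points $x_1,\ldots,x_k$ of a metric space $(V,d_V)$ into a metric space $(M,d_M)$ is a sequence of maps $f_1,\ldots,f_k$ such that for each $i$: (1) $f_i$ is a non-contractive embedding of $\{x_1,\ldots,x_i\}$ into $M$; (2) $f_i$ extends $f_{i-1}$. Its distortion is the distortion of $f_k$. A probabilistic online embedding is a probability distribution over online embeddings; its expected distortion is $\max_{u\neq v}E[d_M(f_k(u),f_k(v))]/d_V(u,v)$. An HST ($\mu$-HST for some $\mu>1$) metric is the metric on the leaves of a rooted tree in which each node $v$ has a label $\Delta(v)\ge0$, with $\Delta(v)=0$ iff $v$ is a leaf, and $\Delta(v)\le\Delta(u)/\mu$ whenever $v$ is a child of $u$; the distance between two leaves is the label of their least common ancestor. The aspect ratio of a finite metric space is the ratio of its maximum to its minimum nonzero pairwise distance.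
   Formalization: The terminal sequence is chosen after the probabilistic online embedding, a distribution over rules whose maps f_i depend only on the points seen so far; for a sequence fixed in advance the claim fails, as an offline embedding into HSTs has expected distortion O(log k). -}

module Defs where

open import Algebra.Bundles using (CommutativeRing; Semiring)
import Algebra.Definitions.RawSemiring as RawSemiringDefinitions
open import Data.Fin.Base using (Fin)
open import Data.Fin.Properties using (_≟_)
open import Data.List.Base using (List; length; _∷ʳ_)
open import Data.List.Membership.Propositional using (_∈_)
open import Data.Nat.Base as ℕ using (ℕ; suc)
open import Data.Product.Base using (Σ-syntax; ∃-syntax; _×_; _,_)
open import Data.Unit.Base using (⊤)
open import Data.Vec.Functional using (Vector)
open import Function.Metric.Structures using (IsGeneralMetric)
open import Level using (0ℓ) renaming (suc to lsuc)
open import Relation.Binary.Core using (Rel)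
open import Relation.Binary.PropositionalEquality.Core using (_≡_; _≢_; refl)
open import Relation.Binary.Structures using (IsTotalOrder)
import Relation.Binary.Construct.NonStrictToStrict as NonStrictToStrict
open import Relation.Nullary.Decidable.Core using (yes; no)
open import Relation.Nullary.Negation.Core using (¬_)
open import Relation.Unary using (Pred; Satisfiable; U; ∁; ⋃; _≐_; _⊥_)

UpperBound : {A : Set} → Rel A 0ℓ → Pred A 0ℓ → A → Set
UpperBound _≤_ P b = ∀ {x} → P x → x ≤ b

record IsSup {A : Set} (_≤_ : Rel A 0ℓ) (P : Pred A 0ℓ) (s : A) : Set where
  field
    upper : UpperBound _≤_ P s
    least : ∀ {b} → UpperBound _≤_ P b → s ≤ b

-- A model of the real numbers.  `sup` and `_⁻¹` are total; nothing is assumed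
-- about `sup P` when P is empty or unbounded above, nor about the inverse of
-- zero.
record CompleteOrderedField : Set₁ where
  field
    commutativeRing : CommutativeRing 0ℓ 0ℓ

  open CommutativeRing commutativeRing public
    using (Carrier; _≈_; _+_; _*_; -_; _-_; 0#; 1#; semiring)

  infix  4 _≤_
  infix 10 _⁻¹
  field
    _≤_          : Rel Carrier 0ℓ
    isTotalOrder : IsTotalOrder _≈_ _≤_
    +-monoʳ-≤    : ∀ x {y z} → y ≤ z → x + y ≤ x + z
    *-nonNeg     : ∀ {x y} → 0# ≤ x → 0# ≤ y → 0# ≤ x * y
    0≉1          : ¬ (0# ≈ 1#)
    _⁻¹          : Carrier → Carrier
    *-inverseʳ   : ∀ {x} → ¬ (x ≈ 0#) → x * x ⁻¹ ≈ 1#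

  open NonStrictToStrict _≈_ _≤_ public using (_<_)

  field
    sup       : Pred Carrier 0ℓ → Carrier
    sup-isSup : ∀ {P} → Satisfiable P → ∃[ b ] UpperBound _≤_ P b →
                IsSup _≤_ P (sup P)

module Theory (ℝ : CompleteOrderedField) where

  open CompleteOrderedField ℝ public
  open RawSemiringDefinitions (Semiring.rawSemiring semiring) public
    using (_^_; sum) renaming (_×_ to _·_)

  ----------------------------------------------------------------------
  -- Real functions

  ι : ℕ → Carrier
  ι n = n · 1#

  infixl 7 _/_
  _/_ : Carrier → Carrier → Carrier
  x / y = x * y ⁻¹

  inf : Pred Carrier 0ℓ → Carrier
  inf P = - sup (λ r → P (- r))

  -- The real power x ^ y, for x ≥ 1 and y ≥ 0: the supremum of the rational
  -- powers x ^ (p / q) with p / q ≤ y.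
  infixr 8 _^ʳ_
  _^ʳ_ : Carrier → Carrier → Carrier
  x ^ʳ y = sup λ z → 0# ≤ z × ∃[ p ] ∃[ q ]
    0 ℕ.< q × ι p ≤ ι q * y × z ^ q ≤ x ^ p

  -- The binary logarithm of x ≥ 1: the supremum of the rationals p / q ≥ 0
  -- with 2 ^ (p / q) ≤ x.
  log₂ : Carrier → Carrier
  log₂ x = sup λ r → ∃[ p ] ∃[ q ] 0 ℕ.< q × ι q * r ≈ ι p × ι 2 ^ p ≤ x ^ q

  ----------------------------------------------------------------------
  -- Finite metric spaces

  record FiniteMetricSpace : Set where
    field
      size     : ℕ
      d        : Fin size → Fin size → Carrier
      isMetric : IsGeneralMetric _≡_ _≈_ _≤_ 0# _+_ d

    Point : Set
    Point = Fin size

    maxDistance minDistance aspectRatio : Carrier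
    maxDistance = sup λ r → Σ[ x ∈ Point ] Σ[ y ∈ Point ] x ≢ y × r ≈ d x y
    minDistance = inf λ r → Σ[ x ∈ Point ] Σ[ y ∈ Point ] x ≢ y × r ≈ d x y
    aspectRatio = maxDistance / minDistance

  ----------------------------------------------------------------------
  -- Hierarchically well-separated trees

  data Tree : Set where
    leaf : Tree
    node : (Δ : Carrier) {n : ℕ} (child : Fin (suc n) → Tree) → Tree

  label : Tree → Carrier
  label leaf       = 0#
  label (node Δ _) = Δ

  -- Labels of leaves are 0 by the definition of `label`.
  IsHST : Carrier → Tree → Set
  IsHST μ leaf           = ⊤
  IsHST μ (node Δ child) =
    0# < Δ × (∀ i → label (child i) ≤ Δ / μ × IsHST μ (child i))

  -- A leaf, as the path leading to it from the root.
  Leaf : Tree → Set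
  Leaf leaf               = ⊤
  Leaf (node _ {n} child) = Σ[ i ∈ Fin (suc n) ] Leaf (child i)

  -- The least common ancestor of two leaves, as the subtree rooted at it.
  lca : (t : Tree) → Leaf t → Leaf t → Tree
  lca leaf           _       _       = leaf
  lca (node Δ child) (i , p) (j , q) with i ≟ j
  ... | yes refl = lca (child i) p q
  ... | no  _    = node Δ child

  record HST : Set where
    field
      tree  : Tree
      μ     : Carrier
      1<μ   : 1# < μ
      isHST : IsHST μ tree

    HSTPoint : Set
    HSTPoint = Leaf tree

    dist : HSTPoint → HSTPoint → Carrier
    dist p q = label (lca tree p q)

  ----------------------------------------------------------------------
  -- Probability

  partialSum : (ℕ → Carrier) → ℕ → Carrier
  partialSum a ℕ.zero  = 0#
  partialSum a (suc n) = partialSum a n + a n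

  record ProbabilityMeasure (Ω : Set) : Set (lsuc (lsuc 0ℓ)) where
    field
      Measurable   : Pred Ω 0ℓ → Set₁
      measurable-≐ : ∀ {A B} → A ≐ B → Measurable A → Measurable B
      measurable-U : Measurable U
      measurable-∁ : ∀ {A} → Measurable A → Measurable (∁ A)
      measurable-⋃ : ∀ {A : ℕ → Pred Ω 0ℓ} →
        (∀ n → Measurable (A n)) → Measurable (⋃ ℕ A)

      -- Only the values on measurable events are meaningful.
      ℙ            : Pred Ω 0ℓ → Carrier
      ℙ-≐          : ∀ {A B} → Measurable A → A ≐ B → ℙ A ≈ ℙ B
      ℙ-nonNeg     : ∀ {A} → Measurable A → 0# ≤ ℙ A
      ℙ-U          : ℙ U ≈ 1#
      ℙ-⋃          : ∀ {A : ℕ → Pred Ω 0ℓ} → (∀ n → Measurable (A n)) →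
        (∀ {m n} → m ≢ n → A m ⊥ A n) →
        IsSup _≤_ (λ r → ∃[ n ] r ≈ partialSum (λ i → ℙ (A i)) n) (ℙ (⋃ ℕ A))

    -- X is a Borel random variable.
    RandomVariable : (Ω → Carrier) → Set₁
    RandomVariable X = ∀ r → Measurable (λ ω → r ≤ X ω)

    -- A nonnegative simple function, with values `coeff i` on the pairwise
    -- disjoint events `event i` and 0 elsewhere, lying below X ≥ 0.
    record SimpleBelow (X : Ω → Carrier) : Set₁ where
      field
        {n}        : ℕ
        coeff      : Vector Carrier n
        event      : Vector (Pred Ω 0ℓ) n
        nonNeg     : ∀ i → 0# ≤ coeff i
        measurable : ∀ i → Measurable (event i)
        disjoint   : ∀ {i j} → i ≢ j → event i ⊥ event j
        below      : ∀ i {ω} → event i ω → coeff i ≤ X ω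

      integral : Carrier
      integral = sum (λ i → coeff i * ℙ (event i))

    -- y ≤ 𝔼[X] for X ≥ 0, where the Lebesgue integral 𝔼[X] ∈ [0,∞] is the
    -- supremum of the integrals of the simple functions below X.
    _≤𝔼_ : Carrier → (Ω → Carrier) → Set₁
    y ≤𝔼 X = ∀ s → (∀ (φ : SimpleBelow X) → SimpleBelow.integral φ ≤ s) → y ≤ s

  ----------------------------------------------------------------------
  -- Online embeddings

  module _ (V : FiniteMetricSpace) (k : ℕ) where

    open FiniteMetricSpace V

    -- A deterministic online embedding, for terminal sequences of length at
    -- most k in V.  It is a rule, not a choice of maps for one sequence known
    -- in advance: when the terminals x₁,…,xᵢ have arrived, the map
    -- fᵢ = f (x₁ ∷ … ∷ xᵢ ∷ []) is determined by them alone.  Only the values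
    -- of fᵢ on {x₁,…,xᵢ} matter.
    record OnlineEmbedding : Set where
      field
        target         : HST
      open HST target
      field
        f              : List Point → Point → HSTPoint
        nonContractive : ∀ {σ u v} → length σ ℕ.≤ k → u ∈ σ → v ∈ σ →
                         d u v ≤ dist (f σ u) (f σ v)
        extends        : ∀ {σ x u} → length (σ ∷ʳ x) ℕ.≤ k → u ∈ σ →
                         f (σ ∷ʳ x) u ≡ f σ u

    embeddedDist : List Point → Point → Point → OnlineEmbedding → Carrier
    embeddedDist σ u v e = HST.dist target (f σ u) (f σ v)
      where open OnlineEmbedding e

    record ProbabilisticOnlineEmbedding : Set (lsuc (lsuc 0ℓ)) where
      field
        law        : ProbabilityMeasure OnlineEmbedding
      open ProbabilityMeasure law public
      field
        measurable : ∀ {σ u v} → length σ ℕ.≤ k → u ∈ σ → v ∈ σ →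
                     RandomVariable (embeddedDist σ u v)

    -- The expected distortion on σ, max over u ≠ v in σ of
    -- 𝔼[d_M(f(u),f(v))] / d_V(u,v), is at least D.
    ExpectedDistortionAtLeast :
      ProbabilisticOnlineEmbedding → List Point → Carrier → Set₁
    ExpectedDistortionAtLeast 𝓔 σ D =
      Σ[ u ∈ Point ] Σ[ v ∈ Point ] u ∈ σ × v ∈ σ × u ≢ v ×
      (D * d u v) ≤𝔼 embeddedDist σ u v
      where open ProbabilisticOnlineEmbedding 𝓔

{-# OPTIONS --safe #-}

-- The space is the Hamming cube on n ^ m coordinates, with aspect ratio
-- Φ = n ^ m, where n is a constant fraction of log k.  Two terminals that
-- differ in a block of n * L coordinates span a copy of {0,1}ⁿ scaled by L,
-- and an edge of that copy is again such a pair, with L in place of n * L.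
-- The adversary repeatedly reveals the whole copy and moves to the edge whose
-- expected embedded distance is largest.
--
-- Let Z be an ultrametric dominating the scaled Hamming metric, and average
-- it over the edges of a random monotone path from 0…0 to 1…1.  The path
-- crosses the cut {x : Z(0…0, x) < D}, D = Z(0…0, 1…1), which gives an edge
-- with Z ≥ D.  A cluster {Z < r * L} around a centre c has Hamming radius
-- below r, and the further endpoint x of an edge inside it has one of its
-- fewer than r coordinates that differ from c flipped; as x has at least
-- n / 4 equally likely continuations in either direction on the middle
-- levels, half of the steps there leave their cluster when r ≪ n.  So the
-- normalised expected distance grows by Ω(n) at each of the m scales, while
-- k ≈ m * 2 ^ n, and m * n is of order log k * log Φ / log log k.
--
-- Distances are rounded down to integers and capped at n ^ m: this keeps Z
-- an ultrametric dominating the Hamming metric, and makes its expectation a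
-- finite combination of probabilities.

module Submission where

open import Defs
open import Axiom.ExcludedMiddle using (ExcludedMiddle)
open import Algebra.Bundles using (CommutativeRing)
open import Data.Bool.Base using (Bool; true; false; if_then_else_)
open import Data.Fin.Base as Fin using (Fin; toℕ)
import Data.Fin.Properties as Finₚ
open import Data.List.Base as List using (List; []; _∷_; _++_; _∷ʳ_; length)
import Data.List.Properties as Listₚ
open import Data.List.Membership.Propositional using (_∈_; _∉_)
open import Data.List.Membership.Propositional.Properties using (∈-map⁺; ∈-++⁺ˡ; ∈-++⁺ʳ)
open import Data.List.Relation.Unary.All using ([]; _∷_)
open import Data.List.Relation.Unary.AllPairs using ([]; _∷_)
open import Data.List.Relation.Unary.Any as Any using (here; there)
import Data.List.Relation.Unary.Any.Properties as Anyₚ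
open import Data.List.Relation.Unary.Unique.Propositional using (Unique)
import Data.List.Relation.Unary.Unique.Propositional.Properties as Uniqueₚ
open import Data.Nat.Base as ℕ using (ℕ; zero; suc; pred; _!; _⊔_; _⊓_; _∸_; z≤n; s≤s)
import Data.Nat.Properties as ℕₚ
open import Data.Nat.Tactic.RingSolver using (solve-∀)
open import Data.Product.Base using (_,_; proj₁; proj₂; _×_; ∃-syntax; Σ-syntax)
open import Data.Sum.Base using (_⊎_; inj₁; inj₂; [_,_]′)
open import Data.Unit.Base using (tt)
open import Data.Vec.Base as Vec using (Vec; []; _∷_; lookup; replicate; _[_]≔_)
import Data.Vec.Properties as Vecₚ
open import Function.Base using (_∘_; id)
open import Level using (0ℓ; Lift; lift; lower) renaming (suc to lsuc)
open import Relation.Binary.Bundles using (Poset)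
open import Relation.Binary.PropositionalEquality.Core as ≡ using (_≡_; _≢_)
open import Relation.Binary.PropositionalEquality.Properties using (module ≡-Reasoning; isEquivalence)
open import Relation.Binary.Structures using (IsTotalOrder)
open import Relation.Nullary.Decidable.Core using (Dec; yes; no; map′)
open import Relation.Nullary.Negation.Core using (¬_; contradiction)
open import Relation.Unary using (Pred; U; ∁; ⋃; _≐_; _⊥_; _∩_; _∪_; ∅)

-- The gadget inequality holds for each deterministic embedding separately, with path weights that
-- do not depend on the embedding. It therefore survives averaging over the random embedding, and
-- one edge serves the whole distribution although clusters and cuts vary with the outcome.
-- Onlineness ensures that the distance of a revealed pair never changes, so the expectation known
-- for the old pair still holds once the copy has been revealed.
--
-- An edge has 1 / n of the Hamming length of the diagonal and a path has `n` edges, so the one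
-- crossing edge merely preserves the normalised distance; growth has to come from jumps of the
-- smaller height r * L. With n = 4 * q and r = q / 4, lower ends and upper ends each take the blame
-- for at most a quarter of the 2 * q middle steps that stay in a cluster, and `q` steps remain. For
-- n = 128 * g these yield r * L * q = 2 * n * g * L. One half of that covers the overlap with the
-- crossing edge; the other half, divided by n * L, is a gain of `g` per scale.

-- Finite sums of natural numbers.

module Sums where
  open ≡ using (refl; sym; trans; cong; cong₂)
  open import Data.Nat.Base using (_+_; _*_; _≤_; _<_)

  private variable
    A B : Set

  ∑ : List A → (A → ℕ) → ℕ
  ∑ []       f = 0
  ∑ (x ∷ xs) f = f x + ∑ xs f

  ∑-cong : ∀ (xs : List A) {f g} → (∀ x → f x ≡ g x) → ∑ xs f ≡ ∑ xs g
  ∑-cong []       eq = refl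
  ∑-cong (x ∷ xs) eq = cong₂ _+_ (eq x) (∑-cong xs eq)

  ∑-mono : ∀ (xs : List A) {f g} → (∀ x → f x ≤ g x) → ∑ xs f ≤ ∑ xs g
  ∑-mono []       le = z≤n
  ∑-mono (x ∷ xs) le = ℕₚ.+-mono-≤ (le x) (∑-mono xs le)

  ∑-zero : ∀ (xs : List A) → ∑ xs (λ _ → 0) ≡ 0
  ∑-zero []       = refl
  ∑-zero (x ∷ xs) = ∑-zero xs

  ∑-+ : ∀ (xs : List A) f g → ∑ xs (λ x → f x + g x) ≡ ∑ xs f + ∑ xs g
  ∑-+ []       f g = refl
  ∑-+ (x ∷ xs) f g = trans (cong (f x + g x +_) (∑-+ xs f g))
    (interchange (f x) (g x) (∑ xs f) (∑ xs g))
    where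
    interchange : ∀ a b c d → a + b + (c + d) ≡ a + c + (b + d)
    interchange = solve-∀

  ∑-*ˡ : ∀ (xs : List A) c f → ∑ xs (λ x → c * f x) ≡ c * ∑ xs f
  ∑-*ˡ []       c f = sym (ℕₚ.*-zeroʳ c)
  ∑-*ˡ (x ∷ xs) c f = trans (cong (c * f x +_) (∑-*ˡ xs c f))
    (sym (ℕₚ.*-distribˡ-+ c (f x) (∑ xs f)))

  ∑-*ʳ : ∀ (xs : List A) f c → ∑ xs (λ x → f x * c) ≡ ∑ xs f * c
  ∑-*ʳ xs f c = trans (∑-cong xs (λ x → ℕₚ.*-comm (f x) c))
    (trans (∑-*ˡ xs c f) (ℕₚ.*-comm c (∑ xs f)))

  ∑-++ : ∀ (xs ys : List A) f → ∑ (xs ++ ys) f ≡ ∑ xs f + ∑ ys f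
  ∑-++ []       ys f = refl
  ∑-++ (x ∷ xs) ys f = trans (cong (f x +_) (∑-++ xs ys f))
    (sym (ℕₚ.+-assoc (f x) (∑ xs f) (∑ ys f)))

  ∑-map : ∀ (g : B → A) xs f → ∑ (List.map g xs) f ≡ ∑ xs (f ∘ g)
  ∑-map g []       f = refl
  ∑-map g (x ∷ xs) f = cong (f (g x) +_) (∑-map g xs f)

  ∑-swap : ∀ (xs : List A) (ys : List B) (f : A → B → ℕ) →
    ∑ xs (λ x → ∑ ys (f x)) ≡ ∑ ys (λ y → ∑ xs (λ x → f x y))
  ∑-swap []       ys f = sym (∑-zero ys)
  ∑-swap (x ∷ xs) ys f = trans (cong (∑ ys (f x) +_) (∑-swap xs ys f))
    (sym (∑-+ ys (f x) (λ y → ∑ xs (λ x → f x y))))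

  ∑-allFin-suc : ∀ n f →
    ∑ (List.allFin (suc n)) f ≡ f Fin.zero + ∑ (List.allFin n) (f ∘ Fin.suc)
  ∑-allFin-suc n f = cong (f Fin.zero +_)
    (trans (cong (λ xs → ∑ xs f) (sym (Listₚ.map-tabulate {n = n} id Fin.suc)))
           (∑-map Fin.suc (List.allFin n) f))

-- The cube and the unit flow of its monotone paths.

module Cube where
  open ≡ using (refl; sym; trans; cong; cong₂)
  open import Data.Nat.Base using (_+_; _*_; _≤_; _<_)
  open Sums

  cube : ∀ n → List (Vec Bool n)
  cube zero    = [] ∷ []
  cube (suc n) = List.map (false ∷_) (cube n) ++ List.map (true ∷_) (cube n)

  ∈-cube : ∀ {n} (x : Vec Bool n) → x ∈ cube n
  ∈-cube []          = here refl
  ∈-cube (false ∷ x) = ∈-++⁺ˡ (∈-map⁺ (false ∷_) (∈-cube x))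
  ∈-cube (true  ∷ x) = ∈-++⁺ʳ (List.map (false ∷_) (cube _)) (∈-map⁺ (true ∷_) (∈-cube x))

  ∑-cube-suc : ∀ n f → ∑ (cube (suc n)) f ≡ ∑ (cube n) (f ∘ (false ∷_)) + ∑ (cube n) (f ∘ (true ∷_))
  ∑-cube-suc n f = trans (∑-++ (List.map (false ∷_) (cube n)) _ f)
    (cong₂ _+_ (∑-map (false ∷_) (cube n) f) (∑-map (true ∷_) (cube n) f))

  length-cube : ∀ n → List.length (cube n) ≡ 2 ℕ.^ n
  length-cube zero = refl
  length-cube (suc n) = begin
    List.length (List.map (false ∷_) (cube n) ++ List.map (true ∷_) (cube n))
      ≡⟨ Listₚ.length-++ (List.map (false ∷_) (cube n)) ⟩
    List.length (List.map (false ∷_) (cube n)) + List.length (List.map (true ∷_) (cube n))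
      ≡⟨ cong₂ _+_ (Listₚ.length-map _ (cube n)) (Listₚ.length-map _ (cube n)) ⟩
    List.length (cube n) + List.length (cube n)
      ≡⟨ cong₂ _+_ (length-cube n) (trans (length-cube n) (sym (ℕₚ.+-identityʳ _))) ⟩
    2 ℕ.^ suc n ∎
    where open ≡-Reasoning

  on off : Bool → ℕ
  on  b = if b then 1 else 0
  off b = if b then 0 else 1

  ones zeros : ∀ {n} → Vec Bool n → ℕ
  ones []       = 0
  ones (b ∷ x)  = on b + ones x
  zeros []      = 0
  zeros (b ∷ x) = off b + zeros x

  zeros+ones : ∀ {n} (x : Vec Bool n) → zeros x + ones x ≡ n
  zeros+ones []          = refl
  zeros+ones (false ∷ x) = cong suc (zeros+ones x)
  zeros+ones (true  ∷ x) = trans (ℕₚ.+-suc (zeros x) (ones x)) (cong suc (zeros+ones x))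

  ∑-on : ∀ {n} (x : Vec Bool n) → ∑ (List.allFin n) (λ i → on (lookup x i)) ≡ ones x
  ∑-on []      = refl
  ∑-on {suc n} (b ∷ x) = trans (∑-allFin-suc n (λ i → on (lookup (b ∷ x) i))) (cong (on b +_) (∑-on x))

  ∑-off : ∀ {n} (x : Vec Bool n) → ∑ (List.allFin n) (λ i → off (lookup x i)) ≡ zeros x
  ∑-off []      = refl
  ∑-off {suc n} (b ∷ x) = trans (∑-allFin-suc n (λ i → off (lookup (b ∷ x) i))) (cong (off b +_) (∑-off x))

  top bot : ∀ {n} → Vec Bool n
  top = replicate _ true
  bot = replicate _ false

  zeros-top : ∀ n → zeros (top {n}) ≡ 0
  zeros-top zero    = refl
  zeros-top (suc n) = zeros-top n

  ones-bot : ∀ n → ones (bot {n}) ≡ 0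
  ones-bot zero    = refl
  ones-bot (suc n) = ones-bot n

  ones-top : ∀ n → ones (top {n}) ≡ n
  ones-top n = trans (sym (cong (_+ ones (top {n})) (zeros-top n))) (zeros+ones top)

  ones-raise : ∀ {n} (x : Vec Bool n) i → lookup x i ≡ false → ones (x [ i ]≔ true) ≡ suc (ones x)
  ones-raise (false ∷ x) Fin.zero    eq = refl
  ones-raise (b     ∷ x) (Fin.suc i) eq =
    trans (cong (on b +_) (ones-raise x i eq)) (ℕₚ.+-suc (on b) (ones x))

  zeros-raise : ∀ {n} (x : Vec Bool n) i → lookup x i ≡ false → zeros x ≡ suc (zeros (x [ i ]≔ true))
  zeros-raise (false ∷ x) Fin.zero    eq = refl
  zeros-raise (b     ∷ x) (Fin.suc i) eq =
    trans (cong (off b +_) (zeros-raise x i eq)) (ℕₚ.+-suc (off b) _)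

  -- Raising coordinate `i` is a bijection between the two facets orthogonal to `i`, so the edges in
  -- direction `i` can be indexed by either end.
  ∑-raise : ∀ {n} i (G : Vec Bool n → ℕ) →
    ∑ (cube n) (λ x → off (lookup x i) * G (x [ i ]≔ true)) ≡ ∑ (cube n) (λ y → on (lookup y i) * G y)
  ∑-raise {suc n} Fin.zero G = begin
    ∑ (cube (suc n)) (λ x → off (lookup x Fin.zero) * G (x [ Fin.zero ]≔ true))
      ≡⟨ ∑-cube-suc n _ ⟩
    ∑ (cube n) (λ x → 1 * G (true ∷ x)) + ∑ (cube n) (λ _ → 0)
      ≡⟨ ℕₚ.+-comm (∑ (cube n) (λ x → 1 * G (true ∷ x))) _ ⟩
    ∑ (cube n) (λ _ → 0) + ∑ (cube n) (λ x → 1 * G (true ∷ x))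
      ≡⟨ ∑-cube-suc n _ ⟨
    ∑ (cube (suc n)) (λ y → on (lookup y Fin.zero) * G y) ∎
    where open ≡-Reasoning
  ∑-raise {suc n} (Fin.suc i) G = begin
    ∑ (cube (suc n)) (λ x → off (lookup x (Fin.suc i)) * G (x [ Fin.suc i ]≔ true))
      ≡⟨ ∑-cube-suc n _ ⟩
    _ ≡⟨ cong₂ _+_ (∑-raise i (G ∘ (false ∷_))) (∑-raise i (G ∘ (true ∷_))) ⟩
    _ ≡⟨ ∑-cube-suc n _ ⟨
    ∑ (cube (suc n)) (λ y → on (lookup y (Fin.suc i)) * G y) ∎
    where open ≡-Reasoning

  -- Indicators of the two extreme vertices, written as products over the coordinates so that sums
  -- over the cube collapse one coordinate at a time.
  isTop isBot : ∀ {n} → Vec Bool n → ℕ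
  isTop []      = 1
  isTop (b ∷ x) = on b * isTop x
  isBot []      = 1
  isBot (b ∷ x) = off b * isBot x

  ∑-isTop : ∀ {n} (G : Vec Bool n → ℕ) → ∑ (cube n) (λ x → isTop x * G x) ≡ G top
  ∑-isTop {zero}  G = trans (ℕₚ.+-identityʳ _) (ℕₚ.*-identityˡ _)
  ∑-isTop {suc n} G = begin
    ∑ (cube (suc n)) (λ x → isTop x * G x) ≡⟨ ∑-cube-suc n _ ⟩
    ∑ (cube n) (λ _ → 0) + ∑ (cube n) (λ x → (1 * isTop x) * G (true ∷ x))
      ≡⟨ cong₂ _+_ (∑-zero (cube n)) (∑-cong (cube n) λ x → cong (_* G (true ∷ x)) (ℕₚ.*-identityˡ (isTop x))) ⟩
    ∑ (cube n) (λ x → isTop x * G (true ∷ x)) ≡⟨ ∑-isTop (G ∘ (true ∷_)) ⟩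
    G top ∎
    where open ≡-Reasoning

  ∑-isBot : ∀ {n} (G : Vec Bool n → ℕ) → ∑ (cube n) (λ x → isBot x * G x) ≡ G bot
  ∑-isBot {zero}  G = trans (ℕₚ.+-identityʳ _) (ℕₚ.*-identityˡ _)
  ∑-isBot {suc n} G = begin
    ∑ (cube (suc n)) (λ x → isBot x * G x) ≡⟨ ∑-cube-suc n _ ⟩
    ∑ (cube n) (λ x → (1 * isBot x) * G (false ∷ x)) + ∑ (cube n) (λ _ → 0)
      ≡⟨ cong₂ _+_ (∑-cong (cube n) λ x → cong (_* G (false ∷ x)) (ℕₚ.*-identityˡ (isBot x))) (∑-zero (cube n)) ⟩
    ∑ (cube n) (λ x → isBot x * G (false ∷ x)) + 0 ≡⟨ ℕₚ.+-identityʳ _ ⟩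
    ∑ (cube n) (λ x → isBot x * G (false ∷ x)) ≡⟨ ∑-isBot (G ∘ (false ∷_)) ⟩
    G bot ∎
    where open ≡-Reasoning

  isTop≡ : ∀ {n} (x : Vec Bool n) → isTop x ≡ (if zeros x ℕ.≡ᵇ 0 then 1 else 0)
  isTop≡ []          = refl
  isTop≡ (false ∷ x) = refl
  isTop≡ (true  ∷ x) = trans (ℕₚ.*-identityˡ _) (isTop≡ x)

  isBot≡ : ∀ {n} (x : Vec Bool n) → isBot x ≡ (if ones x ℕ.≡ᵇ 0 then 1 else 0)
  isBot≡ []          = refl
  isBot≡ (true  ∷ x) = refl
  isBot≡ (false ∷ x) = trans (ℕₚ.*-identityˡ _) (isBot≡ x)

  -- Numbers of monotone paths through an upward edge at `x`, through a downward edge at `x`, and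
  -- through `x`: the coordinates set before and after can be ordered independently. At the extreme
  -- vertices `pred` yields a spurious 1, which is always multiplied by an empty number of edges.
  raiseWeight lowerWeight vertexWeight : ∀ {n} → Vec Bool n → ℕ
  raiseWeight  x = ones x ! * pred (zeros x) !
  lowerWeight  x = pred (ones x) ! * zeros x !
  vertexWeight x = ones x ! * zeros x !

  raiseWeight≡lowerWeight : ∀ {n} (x : Vec Bool n) i → lookup x i ≡ false →
    raiseWeight x ≡ lowerWeight (x [ i ]≔ true)
  raiseWeight≡lowerWeight x i eq
    rewrite ones-raise x i eq | zeros-raise x i eq = refl

  -- A path through `x` either continues along one of its `zeros x` upward edges or ends at `top`,
  -- where all n ! paths end.
  vertexWeight-raise : ∀ {n} (x : Vec Bool n) →
    vertexWeight x ≡ zeros x * raiseWeight x + isTop x * n !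
  vertexWeight-raise x = helper (zeros x) (ones x) (isTop x) _ (zeros+ones x) (isTop≡ x)
    where
    rearrange : ∀ a b z → a * (b + z * b) ≡ (a * b + z * (a * b)) + 0
    rearrange = solve-∀
    helper : ∀ z o t n → z + o ≡ n → t ≡ (if z ℕ.≡ᵇ 0 then 1 else 0) →
      o ! * z ! ≡ z * (o ! * pred z !) + t * n !
    helper zero    o t .o refl refl = ℕₚ.*-comm (o !) 1
    helper (suc z) o t n  eq   refl = rearrange (o !) (z !) z

  vertexWeight-lower : ∀ {n} (x : Vec Bool n) →
    vertexWeight x ≡ ones x * lowerWeight x + isBot x * n !
  vertexWeight-lower x = helper (ones x) (zeros x) (isBot x) _ (trans (ℕₚ.+-comm (ones x) (zeros x)) (zeros+ones x)) (isBot≡ x)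
    where
    rearrange : ∀ a b o → (b + o * b) * a ≡ (b * a + o * (b * a)) + 0
    rearrange = solve-∀
    helper : ∀ o z t n → o + z ≡ n → t ≡ (if o ℕ.≡ᵇ 0 then 1 else 0) →
      o ! * z ! ≡ o * (pred o ! * z !) + t * n !
    helper zero    z t .z refl refl = refl
    helper (suc o) z t n  eq   refl = rearrange (z !) (o !) o

  -- The weight of the edge from x up to x [ i ]≔ true is the number of
  -- monotone paths from bot to top through it, so these weights form a flow
  -- of value n !.
  E : ∀ {n} → (Vec Bool n → Fin n → ℕ) → ℕ
  E {n} F = ∑ (List.allFin n) λ i → ∑ (cube n) λ x → off (lookup x i) * (raiseWeight x * F x i)

  module _ {n : ℕ} where

    E-mono : ∀ {F G : Vec Bool n → Fin n → ℕ} →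
      (∀ x i → lookup x i ≡ false → F x i ≤ G x i) → E F ≤ E G
    E-mono {F} {G} le = ∑-mono (List.allFin n) λ i → ∑-mono (cube n) λ x → term x i _ refl
      where
      term : ∀ x i b → lookup x i ≡ b →
        off (lookup x i) * (raiseWeight x * F x i) ≤ off (lookup x i) * (raiseWeight x * G x i)
      term x i false eq = ℕₚ.*-monoʳ-≤ (off (lookup x i)) (ℕₚ.*-monoʳ-≤ (raiseWeight x) (le x i eq))
      term x i true  eq rewrite eq = z≤n

    E-cong : ∀ {F G : Vec Bool n → Fin n → ℕ} →
      (∀ x i → lookup x i ≡ false → F x i ≡ G x i) → E F ≡ E G
    E-cong eq = ℕₚ.≤-antisym (E-mono λ x i off → ℕₚ.≤-reflexive (eq x i off))
                             (E-mono λ x i off → ℕₚ.≤-reflexive (sym (eq x i off)))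

    E-+ : ∀ (F G : Vec Bool n → Fin n → ℕ) → E (λ x i → F x i + G x i) ≡ E F + E G
    E-+ F G = trans
      (∑-cong (List.allFin n) λ i → trans
        (∑-cong (cube n) λ x → distrib (off (lookup x i)) (raiseWeight x) (F x i) (G x i))
        (∑-+ (cube n) _ _))
      (∑-+ (List.allFin n) _ _)
      where
      distrib : ∀ a b c d → a * (b * (c + d)) ≡ a * (b * c) + a * (b * d)
      distrib = solve-∀

    E-*ˡ : ∀ c (F : Vec Bool n → Fin n → ℕ) → E (λ x i → c * F x i) ≡ c * E F
    E-*ˡ c F = trans
      (∑-cong (List.allFin n) λ i → trans
        (∑-cong (cube n) λ x → commute c (off (lookup x i)) (raiseWeight x) (F x i))
        (∑-*ˡ (cube n) c _))
      (∑-*ˡ (List.allFin n) c _)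
      where
      commute : ∀ c a b d → a * (b * (c * d)) ≡ c * (a * (b * d))
      commute = solve-∀

    E-lower-end : ∀ (F : Vec Bool n → Fin n → ℕ) → E F ≡
      ∑ (cube n) λ x → raiseWeight x * ∑ (List.allFin n) λ i → off (lookup x i) * F x i
    E-lower-end F = trans (∑-swap (List.allFin n) (cube n) _)
      (∑-cong (cube n) λ x → trans
        (∑-cong (List.allFin n) λ i → commute (off (lookup x i)) (raiseWeight x) (F x i))
        (∑-*ˡ (List.allFin n) (raiseWeight x) _))
      where
      commute : ∀ a b c → a * (b * c) ≡ b * (a * c)
      commute = solve-∀

    -- The path count of an edge is the same read from either end, so after `∑-raise` the sum can be
    -- grouped by upper ends.
    E-upper-end : ∀ (F : Vec Bool n → Fin n → ℕ) → E (λ x i → F (x [ i ]≔ true) i) ≡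
      ∑ (cube n) λ y → lowerWeight y * ∑ (List.allFin n) λ i → on (lookup y i) * F y i
    E-upper-end F = begin
      E (λ x i → F (x [ i ]≔ true) i)
        ≡⟨ (∑-cong (List.allFin n) λ i → ∑-cong (cube n) λ x → reweigh x i (lookup x i) refl) ⟩
      (∑ (List.allFin n) λ i → ∑ (cube n) λ x →
        off (lookup x i) * (lowerWeight (x [ i ]≔ true) * F (x [ i ]≔ true) i))
        ≡⟨ ∑-cong (List.allFin n) (λ i → ∑-raise i (λ y → lowerWeight y * F y i)) ⟩
      (∑ (List.allFin n) λ i → ∑ (cube n) λ y → on (lookup y i) * (lowerWeight y * F y i))
        ≡⟨ ∑-swap (List.allFin n) (cube n) _ ⟩
      (∑ (cube n) λ y → ∑ (List.allFin n) λ i → on (lookup y i) * (lowerWeight y * F y i))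
        ≡⟨ (∑-cong (cube n) λ y → trans
             (∑-cong (List.allFin n) λ i → commute (on (lookup y i)) (lowerWeight y) (F y i))
             (∑-*ˡ (List.allFin n) (lowerWeight y) _)) ⟩
      (∑ (cube n) λ y → lowerWeight y * ∑ (List.allFin n) λ i → on (lookup y i) * F y i) ∎
      where
      open ≡-Reasoning
      commute : ∀ a b c → a * (b * c) ≡ b * (a * c)
      commute = solve-∀
      reweigh : ∀ x i b → lookup x i ≡ b →
        off (lookup x i) * (raiseWeight x * F (x [ i ]≔ true) i) ≡
        off (lookup x i) * (lowerWeight (x [ i ]≔ true) * F (x [ i ]≔ true) i)
      reweigh x i false eq = cong (λ w → off (lookup x i) * (w * F (x [ i ]≔ true) i))
                                  (raiseWeight≡lowerWeight x i eq)
      reweigh x i true  eq rewrite eq = refl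

    E-lower : ∀ (h : Vec Bool n → ℕ) →
      E (λ x _ → h x) + n ! * h top ≡ ∑ (cube n) (λ x → vertexWeight x * h x)
    E-lower h = begin
      E (λ x _ → h x) + n ! * h top
        ≡⟨ cong₂ _+_ (E-lower-end λ x _ → h x) (sym (∑-isTop (λ x → n ! * h x))) ⟩
      ∑ (cube n) (λ x → raiseWeight x * ∑ (List.allFin n) (λ i → off (lookup x i) * h x))
        + ∑ (cube n) (λ x → isTop x * (n ! * h x))
        ≡⟨ ∑-+ (cube n) _ _ ⟨
      ∑ (cube n) (λ x → raiseWeight x * ∑ (List.allFin n) (λ i → off (lookup x i) * h x)
                        + isTop x * (n ! * h x))
        ≡⟨ (∑-cong (cube n) λ x → trans
             (cong (λ s → raiseWeight x * s + isTop x * (n ! * h x))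
               (trans (∑-*ʳ (List.allFin n) (λ i → off (lookup x i)) (h x)) (cong (_* h x) (∑-off x))))
             (trans (regroup (raiseWeight x) (zeros x) (h x) (isTop x) (n !))
                    (cong (_* h x) (sym (vertexWeight-raise x))))) ⟩
      ∑ (cube n) (λ x → vertexWeight x * h x) ∎
      where
      open ≡-Reasoning
      regroup : ∀ w z h t f → w * (z * h) + t * (f * h) ≡ (z * w + t * f) * h
      regroup = solve-∀

    E-upper : ∀ (h : Vec Bool n → ℕ) →
      E (λ x i → h (x [ i ]≔ true)) + n ! * h bot ≡ ∑ (cube n) (λ x → vertexWeight x * h x)
    E-upper h = begin
      E (λ x i → h (x [ i ]≔ true)) + n ! * h bot
        ≡⟨ cong₂ _+_ (E-upper-end λ x _ → h x) (sym (∑-isBot (λ x → n ! * h x))) ⟩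
      ∑ (cube n) (λ x → lowerWeight x * ∑ (List.allFin n) (λ i → on (lookup x i) * h x))
        + ∑ (cube n) (λ x → isBot x * (n ! * h x))
        ≡⟨ ∑-+ (cube n) _ _ ⟨
      ∑ (cube n) (λ x → lowerWeight x * ∑ (List.allFin n) (λ i → on (lookup x i) * h x)
                        + isBot x * (n ! * h x))
        ≡⟨ (∑-cong (cube n) λ x → trans
             (cong (λ s → lowerWeight x * s + isBot x * (n ! * h x))
               (trans (∑-*ʳ (List.allFin n) (λ i → on (lookup x i)) (h x)) (cong (_* h x) (∑-on x))))
             (trans (regroup (lowerWeight x) (ones x) (h x) (isBot x) (n !))
                    (cong (_* h x) (sym (vertexWeight-lower x))))) ⟩
      ∑ (cube n) (λ x → vertexWeight x * h x) ∎
      where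
      open ≡-Reasoning
      regroup : ∀ w z h t f → w * (z * h) + t * (f * h) ≡ (z * w + t * f) * h
      regroup = solve-∀

    -- Both sides sum `h` over all vertices of all n ! paths: every vertex of a path except `top` is
    -- left by an edge, and every one except `bot` is entered by one. This is telescoping along
    -- paths without enumerating them.
    E-flow : ∀ (h : Vec Bool n → ℕ) →
      E (λ x _ → h x) + n ! * h top ≡ E (λ x i → h (x [ i ]≔ true)) + n ! * h bot
    E-flow h = trans (E-lower h) (sym (E-upper h))

-- One scale: an ultrametric that dominates the scaled Hamming metric.

module Gadget where
  open ≡ using (refl; sym; trans; cong; cong₂; subst; subst₂)
  open import Data.Nat.Base using (_+_; _*_; _≤_; _<_)
  open Sums
  open Cube

  indicator : {P : Set} → Dec P → ℕ
  indicator (yes _) = 1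
  indicator (no _)  = 0

  differ : Bool → Bool → ℕ
  differ true  b = off b
  differ false b = on b

  vdist : {A : Set} → (A → A → ℕ) → ∀ {n} → Vec A n → Vec A n → ℕ
  vdist δ []       []       = 0
  vdist δ (x ∷ xs) (y ∷ ys) = δ x y + vdist δ xs ys

  hamming : ∀ {n} → Vec Bool n → Vec Bool n → ℕ
  hamming = vdist differ

  hamming≡∑ : ∀ {n} (x y : Vec Bool n) →
    ∑ (List.allFin n) (λ i → differ (lookup x i) (lookup y i)) ≡ hamming x y
  hamming≡∑ []      []      = refl
  hamming≡∑ {suc n} (a ∷ x) (b ∷ y) =
    trans (∑-allFin-suc n (λ i → differ (lookup (a ∷ x) i) (lookup (b ∷ y) i)))
          (cong (differ a b +_) (hamming≡∑ x y))

  hamming-bot-top : ∀ n → hamming (bot {n}) top ≡ n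
  hamming-bot-top zero    = refl
  hamming-bot-top (suc n) = cong suc (hamming-bot-top n)

  find : {A : Set} {P : A → Set} → A → (∀ x → Dec (P x)) → List A → A
  find z P? []       = z
  find z P? (x ∷ xs) with P? x
  ... | yes _ = x
  ... | no  _ = find z P? xs

  find-satisfies : ∀ {A : Set} {P : A → Set} z (P? : ∀ x → Dec (P x)) {xs x} →
    x ∈ xs → P x → P (find z P? xs)
  find-satisfies z P? {y ∷ xs} x∈ px with P? y
  find-satisfies z P? {y ∷ xs} x∈           px | yes py = py
  find-satisfies z P? {y ∷ xs} (here refl)  px | no ¬py = contradiction px ¬py
  find-satisfies z P? {y ∷ xs} (there x∈)   px | no ¬py = find-satisfies z P? x∈ px

  -- Both searches run through the same list, and a hit is guaranteed, so the differing defaults `z`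
  -- and `z′` are never returned. This makes the centre of a cluster independent of the member from
  -- which it is computed.
  find-cong : ∀ {A : Set} {P Q : A → Set} z z′ (P? : ∀ x → Dec (P x)) (Q? : ∀ x → Dec (Q x)) →
    (∀ x → P x → Q x) → (∀ x → Q x → P x) → ∀ {xs x} → x ∈ xs → P x →
    find z P? xs ≡ find z′ Q? xs
  find-cong z z′ P? Q? p⇒q q⇒p {x ∷ xs} x∈ px with P? x | Q? x
  ... | yes _ | yes _  = refl
  ... | yes p | no  ¬q = contradiction (p⇒q x p) ¬q
  ... | no ¬p | yes q  = contradiction (q⇒p x q) ¬p
  find-cong z z′ P? Q? p⇒q q⇒p (here refl) px | no ¬p | no _ = contradiction px ¬p
  find-cong z z′ P? Q? p⇒q q⇒p (there x∈)  px | no _  | no _ = find-cong z z′ P? Q? p⇒q q⇒p x∈ px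

  module _ {n : ℕ} (r q : ℕ) where

    -- Vertex by vertex: where `a x` is nonzero, at least `q` edges leave `x` in the direction
    -- selected by `s`, all with the same weight, while at most `r` coordinates are marked by `e`.
    -- `W` and `s` are kept abstract to treat upward and downward edges at once.
    charge : (W count : Vec Bool n → ℕ) (s : Bool → ℕ) → (∀ b → s b ≤ 1) →
      (∀ x → ∑ (List.allFin n) (λ i → s (lookup x i)) ≡ count x) →
      ∀ (a : Vec Bool n → ℕ) (e : Vec Bool n → Fin n → ℕ) →
      (∀ x → ∑ (List.allFin n) (e x) ≤ r) → (∀ x → q * a x ≤ count x * a x) →
      q * ∑ (cube n) (λ x → W x * ∑ (List.allFin n) (λ i → s (lookup x i) * (a x * e x i))) ≤
      r * ∑ (cube n) (λ x → W x * ∑ (List.allFin n) (λ i → s (lookup x i) * a x))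
    charge W count s s≤1 ∑-s a e e≤r qa≤ = begin
      q * ∑ (cube n) (λ x → W x * ∑ (List.allFin n) (λ i → s (lookup x i) * (a x * e x i)))
        ≡⟨ ∑-*ˡ (cube n) q _ ⟨
      ∑ (cube n) (λ x → q * (W x * ∑ (List.allFin n) (λ i → s (lookup x i) * (a x * e x i))))
        ≤⟨ ∑-mono (cube n) bound ⟩
      ∑ (cube n) (λ x → r * (W x * ∑ (List.allFin n) (λ i → s (lookup x i) * a x)))
        ≡⟨ ∑-*ˡ (cube n) r _ ⟩
      r * ∑ (cube n) (λ x → W x * ∑ (List.allFin n) (λ i → s (lookup x i) * a x)) ∎
      where
      open ℕₚ.≤-Reasoning
      arrange : ∀ q w a r → q * (w * (a * r)) ≡ r * (w * (q * a))
      arrange = solve-∀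
      bound : ∀ x → q * (W x * ∑ (List.allFin n) (λ i → s (lookup x i) * (a x * e x i)))
                  ≤ r * (W x * ∑ (List.allFin n) (λ i → s (lookup x i) * a x))
      bound x = begin
        q * (W x * ∑ (List.allFin n) (λ i → s (lookup x i) * (a x * e x i)))
          ≤⟨ ℕₚ.*-monoʳ-≤ q (ℕₚ.*-monoʳ-≤ (W x) (∑-mono (List.allFin n) λ i →
               ℕₚ.≤-trans (ℕₚ.*-monoˡ-≤ (a x * e x i) (s≤1 (lookup x i))) (ℕₚ.≤-reflexive (ℕₚ.*-identityˡ _)))) ⟩
        q * (W x * ∑ (List.allFin n) (λ i → a x * e x i))
          ≡⟨ cong (λ t → q * (W x * t)) (∑-*ˡ (List.allFin n) (a x) (e x)) ⟩
        q * (W x * (a x * ∑ (List.allFin n) (e x)))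
          ≤⟨ ℕₚ.*-monoʳ-≤ q (ℕₚ.*-monoʳ-≤ (W x) (ℕₚ.*-monoʳ-≤ (a x) (e≤r x))) ⟩
        q * (W x * (a x * r))
          ≡⟨ arrange q (W x) (a x) r ⟩
        r * (W x * (q * a x))
          ≤⟨ ℕₚ.*-monoʳ-≤ r (ℕₚ.*-monoʳ-≤ (W x) (qa≤ x)) ⟩
        r * (W x * (count x * a x))
          ≡⟨ cong (λ t → r * (W x * t))
               (trans (∑-*ʳ (List.allFin n) (λ i → s (lookup x i)) (a x)) (cong (_* a x) (∑-s x))) ⟨
        r * (W x * ∑ (List.allFin n) (λ i → s (lookup x i) * a x)) ∎

    E-charge-lower : ∀ (a : Vec Bool n → ℕ) (e : Vec Bool n → Fin n → ℕ) →
      (∀ x → ∑ (List.allFin n) (e x) ≤ r) → (∀ x → q * a x ≤ zeros x * a x) →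
      q * E (λ x i → a x * e x i) ≤ r * E (λ x _ → a x)
    E-charge-lower a e e≤r qa≤ = subst₂ (λ s t → q * s ≤ r * t)
      (sym (E-lower-end λ x i → a x * e x i)) (sym (E-lower-end λ x _ → a x))
      (charge raiseWeight zeros off (λ { true → z≤n ; false → ℕₚ.≤-refl }) ∑-off a e e≤r qa≤)

    E-charge-upper : ∀ (a : Vec Bool n → ℕ) (e : Vec Bool n → Fin n → ℕ) →
      (∀ x → ∑ (List.allFin n) (e x) ≤ r) → (∀ x → q * a x ≤ ones x * a x) →
      q * E (λ x i → a (x [ i ]≔ true) * e (x [ i ]≔ true) i) ≤ r * E (λ x i → a (x [ i ]≔ true))
    E-charge-upper a e e≤r qa≤ = subst₂ (λ s t → q * s ≤ r * t)
      (sym (E-upper-end λ x i → a x * e x i)) (sym (E-upper-end λ x _ → a x))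
      (charge lowerWeight ones on (λ { true → ℕₚ.≤-refl ; false → z≤n }) ∑-on a e e≤r qa≤)

  module MiddleLevels (q : ℕ) where

    -- Each step on the levels q ≤ j < 3 * q, and no other, gains height 1.
    height : ℕ → ℕ
    height j = (j ∸ q) ⊓ (2 * q)

    -- Indexed by the value that `mid` is to take, so that one match yields both the increment of
    -- `height` and the bounds on the level.
    data Position (j : ℕ) : ℕ → Set where
      middle : q ≤ j → j < 3 * q → height (suc j) ≡ suc (height j) → Position j 1
      outer  : height (suc j) ≡ height j → Position j 0

    position : ∀ j → ∃[ k ] Position j k
    position j with q ℕₚ.≤? j
    ... | no q≰j = 0 , outer (cong (_⊓ (2 * q))
            (trans (ℕₚ.m≤n⇒m∸n≡0 (ℕₚ.≰⇒> q≰j)) (sym (ℕₚ.m≤n⇒m∸n≡0 (ℕₚ.≰⇒≥ q≰j)))))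
    ... | yes q≤j with j ℕₚ.<? 3 * q
    ...   | yes j<3q = 1 , middle q≤j j<3q (trans (cong (_⊓ (2 * q)) eq)
              (trans (ℕₚ.m≤n⇒m⊓n≡m le) (cong suc (sym (ℕₚ.m≤n⇒m⊓n≡m (ℕₚ.<⇒≤ le))))))
      where
      eq : suc j ∸ q ≡ suc (j ∸ q)
      eq = ℕₚ.+-∸-assoc 1 q≤j
      le : j ∸ q < 2 * q
      le = subst (j ∸ q <_) (trans (cong (_∸ q) (ℕₚ.+-comm q (2 * q))) (ℕₚ.m+n∸n≡m (2 * q) q))
             (ℕₚ.∸-monoˡ-< j<3q q≤j)
    ...   | no j≮3q = 0 , outer (trans (ℕₚ.m≥n⇒m⊓n≡n (ℕₚ.≤-trans ge (ℕₚ.∸-monoˡ-≤ q (ℕₚ.n≤1+n j))))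
                                       (sym (ℕₚ.m≥n⇒m⊓n≡n ge)))
      where
      ge : 2 * q ≤ j ∸ q
      ge = subst (_≤ j ∸ q) (trans (cong (_∸ q) (ℕₚ.+-comm q (2 * q))) (ℕₚ.m+n∸n≡m (2 * q) q))
             (ℕₚ.∸-monoˡ-≤ q (ℕₚ.≮⇒≥ j≮3q))

    mid : ℕ → ℕ
    mid j = proj₁ (position j)

    height-suc : ∀ j → height (suc j) ≡ height j + mid j
    height-suc j with position j
    ... | .1 , middle _ _ eq = trans eq (ℕₚ.+-comm 1 (height j))
    ... | .0 , outer eq      = trans eq (sym (ℕₚ.+-identityʳ _))

    mid≤1 : ∀ j → mid j ≤ 1
    mid≤1 j with position j
    ... | .1 , middle _ _ _ = s≤s z≤n
    ... | .0 , outer _      = z≤n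

    mid-lower : ∀ j → q * mid j ≤ j * mid j
    mid-lower j with position j
    ... | .1 , middle q≤j _ _ = ℕₚ.*-monoˡ-≤ 1 q≤j
    ... | .0 , outer _        = ℕₚ.≤-reflexive (trans (ℕₚ.*-zeroʳ q) (sym (ℕₚ.*-zeroʳ j)))

    mid-upper : ∀ j k → 4 * q ≤ k + j → q * mid j ≤ k * mid j
    mid-upper j k 4q≤ with position j
    ... | .0 , outer _         = ℕₚ.≤-reflexive (trans (ℕₚ.*-zeroʳ q) (sym (ℕₚ.*-zeroʳ k)))
    ... | .1 , middle _ j<3q _ = ℕₚ.*-monoˡ-≤ 1
            (ℕₚ.+-cancelʳ-≤ (3 * q) q k (ℕₚ.≤-trans 4q≤ (ℕₚ.+-monoʳ-≤ k (ℕₚ.<⇒≤ j<3q))))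

  module _ {n : ℕ} (r q L : ℕ) (0<r : 0 < r) (0<L : 0 < L) (4q≤n : 4 * q ≤ n) (4r≤q : 4 * r ≤ q)
           (Z : Vec Bool n → Vec Bool n → ℕ)
           (Z-diag : ∀ x → Z x x ≡ 0) (Z-sym : ∀ x y → Z x y ≡ Z y x)
           (Z-ultra : ∀ x y z → Z x z ≤ Z x y ⊔ Z y z)
           (hamming≤Z : ∀ x y → L * hamming x y ≤ Z x y) where

    open MiddleLevels q

    private
      θ D : ℕ
      θ = r * L
      D = Z bot top

      0<θ : 0 < θ
      0<θ = ℕₚ.*-mono-< 0<r 0<L

      ultra< : ∀ {t} x y z → Z x y < t → Z y z < t → Z x z < t
      ultra< x y z xy yz = ℕₚ.≤-<-trans (Z-ultra x y z) (ℕₚ.⊔-lub xy yz)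

      centre : Vec Bool n → Vec Bool n
      centre x = find x (λ z → Z x z ℕₚ.<? θ) (cube n)

      near-centre : ∀ x → Z x (centre x) < θ
      near-centre x = find-satisfies x (λ z → Z x z ℕₚ.<? θ) (∈-cube x) (subst (_< θ) (sym (Z-diag x)) 0<θ)

      centre-cong : ∀ x y → Z x y < θ → centre x ≡ centre y
      centre-cong x y xy = find-cong x y _ _
        (λ z xz → ultra< y x z (subst (_< θ) (Z-sym x y) xy) xz)
        (λ z yz → ultra< x y z xy yz)
        (∈-cube x) (subst (_< θ) (sym (Z-diag x)) 0<θ)

      -- Of the two ends of an edge inside a cluster, exactly one differs from
      -- the common centre in the flipped coordinate.
      miss : Vec Bool n → Fin n → ℕ
      miss x i = differ (lookup x i) (lookup (centre x) i)

      miss≤r : ∀ x → ∑ (List.allFin n) (miss x) ≤ r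
      miss≤r x = subst (_≤ r) (sym (hamming≡∑ x (centre x)))
        (ℕₚ.<⇒≤ (ℕₚ.*-cancelˡ-< L _ _
          (ℕₚ.≤-<-trans (hamming≤Z x (centre x))
            (subst (Z x (centre x) <_) (ℕₚ.*-comm r L) (near-centre x)))))

      Mid Below Above : ℕ
      Mid   = E {n} (λ x _ → mid (ones x))
      Below = E {n} (λ x _ → height (ones x))
      Above = E {n} (λ x i → height (ones (x [ i ]≔ true)))

      2q≤n∸q : 2 * q ≤ n ∸ q
      2q≤n∸q = subst (_≤ n ∸ q) (trans (cong (_∸ q) (ℕₚ.+-comm q (2 * q))) (ℕₚ.m+n∸n≡m (2 * q) q))
        (ℕₚ.∸-monoˡ-≤ q (ℕₚ.≤-trans (ℕₚ.*-monoˡ-≤ q (ℕₚ.n≤1+n 3)) 4q≤n))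

      -- `mid` is the increment of `height`, which climbs from 0 at `bot` to 2 * q at `top` along
      -- each of the n ! paths.
      Mid≡ : Mid ≡ n ! * (2 * q)
      Mid≡ = ℕₚ.+-cancelˡ-≡ Below _ _ (begin
        Below + Mid
          ≡⟨ E-+ {n} (λ x _ → height (ones x)) (λ x _ → mid (ones x)) ⟨
        E {n} (λ x _ → height (ones x) + mid (ones x))
          ≡⟨ (E-cong {n} λ x i eq → trans (sym (height-suc (ones x))) (cong height (sym (ones-raise x i eq)))) ⟩
        Above
          ≡⟨ ℕₚ.+-identityʳ _ ⟨
        Above + 0
          ≡⟨ cong (Above +_) (ℕₚ.*-zeroʳ (n !)) ⟨
        Above + n ! * 0
          ≡⟨ cong (λ h → Above + n ! * h)
               (trans (cong height (ones-bot n)) (cong (_⊓ (2 * q)) (ℕₚ.0∸n≡0 q))) ⟨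
        Above + n ! * height (ones (bot {n}))
          ≡⟨ E-flow {n} (λ x → height (ones x)) ⟨
        Below + n ! * height (ones (top {n}))
          ≡⟨ cong (λ h → Below + n ! * h)
               (trans (cong height (ones-top n)) (ℕₚ.m≥n⇒m⊓n≡n 2q≤n∸q)) ⟩
        Below + n ! * (2 * q) ∎)
        where open ≡-Reasoning

      cut long : Vec Bool n → Fin n → ℕ
      cut  x i = mid (ones x) * indicator (θ ℕₚ.≤? Z x (x [ i ]≔ true))
      long x i = indicator (D ℕₚ.≤? Z x (x [ i ]≔ true))

      lookup-raise : ∀ {m} (x : Vec Bool m) i → lookup (x [ i ]≔ true) i ≡ true
      lookup-raise x i = Vecₚ.lookup∘updateAt i x

      -- The `pred` in the last term undoes the raise: the factor is the `mid` of the same step, but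
      -- expressed through its upper end, so that `E-charge-upper` applies to it.
      mid≤ : ∀ x i → lookup x i ≡ false → mid (ones x) ≤
        cut x i + (mid (ones x) * miss x i
                   + mid (pred (ones (x [ i ]≔ true))) * miss (x [ i ]≔ true) i)
      mid≤ x i eq rewrite ones-raise x i eq
        with θ ℕₚ.≤? Z x (x [ i ]≔ true)
      ... | yes _ = ℕₚ.≤-trans (ℕₚ.≤-reflexive (sym (ℕₚ.*-identityʳ _))) (ℕₚ.m≤m+n _ _)
      ... | no θ≰ rewrite ℕₚ.*-zeroʳ (mid (ones x))
                        | centre-cong x (x [ i ]≔ true) (ℕₚ.≰⇒> θ≰)
                        | lookup-raise x i | eq =
        ℕₚ.≤-reflexive (split (lookup (centre (x [ i ]≔ true)) i) (mid (ones x)))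
        where
        split : ∀ b m → m ≡ m * on b + m * off b
        split true  m = sym (trans (cong₂ _+_ (ℕₚ.*-identityʳ m) (ℕₚ.*-zeroʳ m)) (ℕₚ.+-identityʳ m))
        split false m = sym (cong₂ _+_ (ℕₚ.*-zeroʳ m) (ℕₚ.*-identityʳ m))

      0<q : 0 < q
      0<q = ℕₚ.<-≤-trans (ℕₚ.*-mono-< {0} {4} (s≤s z≤n) 0<r) 4r≤q

      lowerMiss upperMiss : Vec Bool n → Fin n → ℕ
      lowerMiss x i = mid (ones x) * miss x i
      upperMiss x i = mid (pred (ones (x [ i ]≔ true))) * miss (x [ i ]≔ true) i

      E-lowerMiss : q * E lowerMiss ≤ r * Mid
      E-lowerMiss = E-charge-lower r q (λ x → mid (ones x)) miss miss≤r λ x →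
        mid-upper (ones x) (zeros x) (ℕₚ.≤-trans 4q≤n (ℕₚ.≤-reflexive (sym (zeros+ones x))))

      E-upperMiss : q * E upperMiss ≤ r * Mid
      E-upperMiss = subst (λ m → q * E upperMiss ≤ r * m)
        (E-cong {n} λ x i eq → cong (mid ∘ pred) (ones-raise x i eq))
        (E-charge-upper r q (λ y → mid (pred (ones y))) miss miss≤r λ y →
          ℕₚ.≤-trans {j = pred (ones y) * mid (pred (ones y))} (mid-lower (pred (ones y)))
                     (ℕₚ.*-monoˡ-≤ (mid (pred (ones y))) (ℕₚ.pred[n]≤n {ones y})))

      -- The misses at lower and at upper ends use up at most r / q, hence a quarter, of `Mid` each.
      -- So half of `Mid`, that is n ! * q, is cut; multiplying by 2 * q keeps the computation in
      -- the naturals.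
      E-cut : n ! * q ≤ E cut
      E-cut = ℕₚ.*-cancelˡ-≤ 2 (ℕₚ.*-cancelˡ-≤ q ⦃ ℕ.>-nonZero 0<q ⦄ (ℕₚ.+-cancelʳ-≤ (q * Mid) _ _ (begin
        q * (2 * (n ! * q)) + q * Mid
          ≡⟨ cong (λ m → q * m + q * Mid) (trans (arrange (n !) q) (sym Mid≡)) ⟩
        q * Mid + q * Mid
          ≡⟨ double (q * Mid) ⟩
        2 * (q * Mid)
          ≤⟨ ℕₚ.*-monoʳ-≤ 2 (ℕₚ.*-monoʳ-≤ q Mid≤) ⟩
        2 * (q * (E cut + (E lowerMiss + E upperMiss)))
          ≡⟨ expand q (E cut) (E lowerMiss) (E upperMiss) ⟩
        q * (2 * E cut) + 2 * (q * E lowerMiss + q * E upperMiss)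
          ≤⟨ ℕₚ.+-monoʳ-≤ (q * (2 * E cut)) (ℕₚ.*-monoʳ-≤ 2 (ℕₚ.+-mono-≤ E-lowerMiss E-upperMiss)) ⟩
        q * (2 * E cut) + 2 * (r * Mid + r * Mid)
          ≡⟨ cong (q * (2 * E cut) +_) (quadruple r Mid) ⟩
        q * (2 * E cut) + (4 * r) * Mid
          ≤⟨ ℕₚ.+-monoʳ-≤ (q * (2 * E cut)) (ℕₚ.*-monoˡ-≤ Mid 4r≤q) ⟩
        q * (2 * E cut) + q * Mid ∎)))
        where
        open ℕₚ.≤-Reasoning
        arrange : ∀ f q → 2 * (f * q) ≡ f * (2 * q)
        arrange = solve-∀
        double : ∀ a → a + a ≡ 2 * a
        double = solve-∀
        expand : ∀ q a b c → 2 * (q * (a + (b + c))) ≡ q * (2 * a) + 2 * (q * b + q * c)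
        expand = solve-∀
        quadruple : ∀ r m → 2 * (r * m + r * m) ≡ (4 * r) * m
        quadruple = solve-∀
        Mid≤ : Mid ≤ E cut + (E lowerMiss + E upperMiss)
        Mid≤ = ℕₚ.≤-trans (E-mono mid≤)
          (ℕₚ.≤-reflexive (trans (E-+ cut (λ x i → lowerMiss x i + upperMiss x i))
            (cong (E cut +_) (E-+ lowerMiss upperMiss))))

      θ≤D : θ ≤ D
      θ≤D = begin
        r * L                  ≡⟨ ℕₚ.*-comm r L ⟩
        L * r                  ≤⟨ ℕₚ.*-monoʳ-≤ L (ℕₚ.≤-trans (ℕₚ.m≤m+n r _) (ℕₚ.≤-trans 4r≤q (ℕₚ.≤-trans (ℕₚ.m≤m+n q _) 4q≤n))) ⟩
        L * n                  ≡⟨ cong (L *_) (hamming-bot-top n) ⟨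
        L * hamming (bot {n}) top  ≤⟨ hamming≤Z bot top ⟩
        D ∎
        where open ℕₚ.≤-Reasoning

      side : Vec Bool n → ℕ
      side x = indicator (Z bot x ℕₚ.<? D)

      side-bot : side bot ≡ 1
      side-bot with Z bot bot ℕₚ.<? D
      ... | yes _ = refl
      ... | no ¬p = contradiction (subst (_< D) (sym (Z-diag bot)) (ℕₚ.<-≤-trans 0<θ θ≤D)) ¬p

      side-top : side top ≡ 0
      side-top with Z bot top ℕₚ.<? D
      ... | yes p = contradiction p (ℕₚ.<-irrefl refl)
      ... | no  _ = refl

      side≤ : ∀ x i → side x ≤ long x i + side (x [ i ]≔ true)
      side≤ x i with Z bot x ℕₚ.<? D | D ℕₚ.≤? Z x (x [ i ]≔ true) | Z bot (x [ i ]≔ true) ℕₚ.<? D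
      ... | no _  | _      | _      = z≤n
      ... | yes _ | yes _  | _      = s≤s z≤n
      ... | yes _ | no _   | yes _  = s≤s z≤n
      ... | yes p | no D≰  | no ¬p  = contradiction (ultra< bot x (x [ i ]≔ true) p (ℕₚ.≰⇒> D≰)) ¬p

      -- `side` falls from 1 to 0 along each path, and by `side≤` each fall is paid for by a long
      -- edge; `E-flow` sums this over the n ! paths.
      E-long : n ! ≤ E long
      E-long = ℕₚ.+-cancelˡ-≤ (E {n} (λ x i → side (x [ i ]≔ true))) _ _ (begin
        E {n} (λ x i → side (x [ i ]≔ true)) + n !
          ≡⟨ cong (E {n} (λ x i → side (x [ i ]≔ true)) +_) (trans (sym (ℕₚ.*-identityʳ (n !))) (cong (n ! *_) (sym side-bot))) ⟩
        E {n} (λ x i → side (x [ i ]≔ true)) + n ! * side bot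
          ≡⟨ E-flow side ⟨
        E {n} (λ x _ → side x) + n ! * side top
          ≡⟨ cong (λ s → E {n} (λ x _ → side x) + n ! * s) side-top ⟩
        E {n} (λ x _ → side x) + n ! * 0
          ≡⟨ cong (E {n} (λ x _ → side x) +_) (ℕₚ.*-zeroʳ (n !)) ⟩
        E {n} (λ x _ → side x) + 0
          ≡⟨ ℕₚ.+-identityʳ _ ⟩
        E {n} (λ x _ → side x)
          ≤⟨ E-mono {n} (λ x i _ → side≤ x i) ⟩
        E {n} (λ x i → long x i + side (x [ i ]≔ true))
          ≡⟨ E-+ long (λ x i → side (x [ i ]≔ true)) ⟩
        E long + E {n} (λ x i → side (x [ i ]≔ true))
          ≡⟨ ℕₚ.+-comm (E long) _ ⟩
        E {n} (λ x i → side (x [ i ]≔ true)) + E long ∎)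
        where open ℕₚ.≤-Reasoning

      -- A layer-cake bound with the two thresholds θ ≤ D. The upper layer contributes only its
      -- thickness D ∸ θ, because a long edge can be counted by `cut` as well.
      levels≤Z : ∀ x i → θ * cut x i + (D ∸ θ) * long x i ≤ Z x (x [ i ]≔ true)
      levels≤Z x i with θ ℕₚ.≤? Z x (x [ i ]≔ true) | D ℕₚ.≤? Z x (x [ i ]≔ true)
      ... | yes θ≤ | no _ = begin
        θ * (mid (ones x) * 1) + (D ∸ θ) * 0
          ≤⟨ ℕₚ.+-mono-≤ (ℕₚ.*-monoʳ-≤ θ (ℕₚ.*-monoˡ-≤ 1 (mid≤1 (ones x)))) (ℕₚ.≤-reflexive (ℕₚ.*-zeroʳ (D ∸ θ))) ⟩
        θ * 1 + 0 ≡⟨ trans (ℕₚ.+-identityʳ _) (ℕₚ.*-identityʳ θ) ⟩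
        θ ≤⟨ θ≤ ⟩
        Z x (x [ i ]≔ true) ∎
        where open ℕₚ.≤-Reasoning
      ... | yes θ≤ | yes D≤ = begin
        θ * (mid (ones x) * 1) + (D ∸ θ) * 1
          ≤⟨ ℕₚ.+-mono-≤ (ℕₚ.*-monoʳ-≤ θ (ℕₚ.*-monoˡ-≤ 1 (mid≤1 (ones x)))) (ℕₚ.≤-reflexive (ℕₚ.*-identityʳ (D ∸ θ))) ⟩
        θ * 1 + (D ∸ θ) ≡⟨ cong (_+ (D ∸ θ)) (ℕₚ.*-identityʳ θ) ⟩
        θ + (D ∸ θ) ≡⟨ ℕₚ.m+[n∸m]≡n θ≤D ⟩
        D ≤⟨ D≤ ⟩
        Z x (x [ i ]≔ true) ∎
        where open ℕₚ.≤-Reasoning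
      ... | no θ≰ | yes D≤ = contradiction (ℕₚ.≤-trans θ≤D D≤) θ≰
      ... | no _  | no _ = ℕₚ.≤-trans (ℕₚ.≤-reflexive
              (cong₂ _+_ (trans (cong (θ *_) (ℕₚ.*-zeroʳ (mid (ones x)))) (ℕₚ.*-zeroʳ θ)) (ℕₚ.*-zeroʳ (D ∸ θ)))) z≤n

    E-gadget : n ! * (Z bot top ∸ r * L + r * L * q) ≤ E (λ x i → Z x (x [ i ]≔ true))
    E-gadget = begin
      n ! * (D ∸ θ + θ * q)
        ≡⟨ arrange (n !) (D ∸ θ) θ q ⟩
      θ * (n ! * q) + (D ∸ θ) * n !
        ≤⟨ ℕₚ.+-mono-≤ (ℕₚ.*-monoʳ-≤ θ E-cut) (ℕₚ.*-monoʳ-≤ (D ∸ θ) E-long) ⟩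
      θ * E cut + (D ∸ θ) * E long
        ≡⟨ cong₂ _+_ (E-*ˡ θ cut) (E-*ˡ (D ∸ θ) long) ⟨
      E (λ x i → θ * cut x i) + E (λ x i → (D ∸ θ) * long x i)
        ≡⟨ E-+ (λ x i → θ * cut x i) (λ x i → (D ∸ θ) * long x i) ⟨
      E (λ x i → θ * cut x i + (D ∸ θ) * long x i)
        ≤⟨ E-mono (λ x i _ → levels≤Z x i) ⟩
      E (λ x i → Z x (x [ i ]≔ true)) ∎
      where
      open ℕₚ.≤-Reasoning
      arrange : ∀ f k t q → f * (k + t * q) ≡ t * (f * q) + k * f
      arrange = solve-∀

  edges : ∀ n → List (Fin n × Vec Bool n)
  edges n = List.cartesianProduct (List.allFin n) (cube n)

  ∑-cartesianProduct : ∀ {A B : Set} (xs : List A) (ys : List B) f →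
    ∑ (List.cartesianProduct xs ys) f ≡ ∑ xs (λ x → ∑ ys (λ y → f (x , y)))
  ∑-cartesianProduct []       ys f = refl
  ∑-cartesianProduct (x ∷ xs) ys f = trans (∑-++ (List.map (x ,_) ys) _ f)
    (cong₂ _+_ (∑-map (x ,_) ys f) (∑-cartesianProduct xs ys f))

  module _ {n : ℕ} where

    -- Each edge is listed twice in `edges`, once for each value of coordinate `i` in `x`; the
    -- factor `off` annihilates the second copy.
    weight : Fin n × Vec Bool n → ℕ
    weight (i , x) = off (lookup x i) * raiseWeight x

    lowerEnd upperEnd : Fin n × Vec Bool n → Vec Bool n
    lowerEnd (i , x) = x [ i ]≔ false
    upperEnd (i , x) = x [ i ]≔ true

    ∑-edges : ∀ (F : Vec Bool n → Vec Bool n → ℕ) →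
      ∑ (edges n) (λ e → weight e * F (lowerEnd e) (upperEnd e)) ≡ E (λ x i → F x (x [ i ]≔ true))
    ∑-edges F = trans (∑-cartesianProduct (List.allFin n) (cube n) _)
      (∑-cong (List.allFin n) λ i → ∑-cong (cube n) λ x → term x i (lookup x i) refl)
      where
      term : ∀ x i b → lookup x i ≡ b →
        (off (lookup x i) * raiseWeight x) * F (x [ i ]≔ false) (x [ i ]≔ true) ≡
        off (lookup x i) * (raiseWeight x * F x (x [ i ]≔ true))
      term x i true  eq rewrite eq = refl
      term x i false eq = trans (ℕₚ.*-assoc (off (lookup x i)) _ _)
        (cong (λ y → off (lookup x i) * (raiseWeight x * F y (x [ i ]≔ true)))
          (trans (cong (x [ i ]≔_) (sym eq)) (Vecₚ.[]≔-lookup x i)))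

    -- Each of the n ! paths has `n` edges, as telescoping the level `ones` along it shows.
    ∑-weight : ∑ (edges n) weight ≡ n ! * n
    ∑-weight = begin
      ∑ (edges n) weight
        ≡⟨ ∑-cong (edges n) (λ e → ℕₚ.*-identityʳ (weight e)) ⟨
      ∑ (edges n) (λ e → weight e * 1)
        ≡⟨ ∑-edges (λ _ _ → 1) ⟩
      E {n} (λ _ _ → 1)
        ≡⟨ ℕₚ.+-cancelˡ-≡ (E {n} (λ x _ → ones x)) _ _ total ⟩
      n ! * n ∎
      where
      open ≡-Reasoning
      total : E {n} (λ x _ → ones x) + E {n} (λ _ _ → 1) ≡ E {n} (λ x _ → ones x) + n ! * n
      total = begin
        E {n} (λ x _ → ones x) + E {n} (λ _ _ → 1)
          ≡⟨ E-+ {n} (λ x _ → ones x) (λ _ _ → 1) ⟨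
        E {n} (λ x _ → ones x + 1)
          ≡⟨ (E-cong {n} λ x i eq → trans (ℕₚ.+-comm (ones x) 1) (sym (ones-raise x i eq))) ⟩
        E {n} (λ x i → ones (x [ i ]≔ true))
          ≡⟨ trans (cong (E {n} (λ x i → ones (x [ i ]≔ true)) +_)
               (trans (cong (n ! *_) (ones-bot n)) (ℕₚ.*-zeroʳ (n !)))) (ℕₚ.+-identityʳ _) ⟨
        E {n} (λ x i → ones (x [ i ]≔ true)) + n ! * ones (bot {n})
          ≡⟨ E-flow {n} ones ⟨
        E {n} (λ x _ → ones x) + n ! * ones (top {n})
          ≡⟨ cong (λ k → E {n} (λ x _ → ones x) + n ! * k) (ones-top n) ⟩
        E {n} (λ x _ → ones x) + n ! * n ∎

  -- Instance r = 8 * g, q = 32 * g of `E-gadget`. With θ = 8 * g * L, the net gain θ * (32 * g) - θ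
  -- is at least θ * (16 * g) = n * (g * L).
  gadget : ∀ g L → 0 < g → 0 < L → let n = 128 * g in
    (Z : Vec Bool n → Vec Bool n → ℕ) →
    (∀ x → Z x x ≡ 0) → (∀ x y → Z x y ≡ Z y x) → (∀ x y z → Z x z ≤ Z x y ⊔ Z y z) →
    (∀ x y → L * hamming x y ≤ Z x y) →
    n ! * (Z bot top + n * (g * L)) ≤ ∑ (edges n) (λ e → weight e * Z (lowerEnd e) (upperEnd e))
  gadget g L 0<g 0<L Z Z-diag Z-sym Z-ultra hamming≤Z = begin
    n ! * (Z bot top + n * (g * L))
      ≤⟨ ℕₚ.*-monoʳ-≤ (n !) gain ⟩
    n ! * (Z bot top ∸ θ + θ * (32 * g))
      ≤⟨ E-gadget (8 * g) (32 * g) L (ℕₚ.*-mono-< {0} {8} (s≤s z≤n) 0<g) 0<L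
           (ℕₚ.≤-reflexive (four-32 g)) (ℕₚ.≤-reflexive (four-8 g)) Z Z-diag Z-sym Z-ultra hamming≤Z ⟩
    E (λ x i → Z x (x [ i ]≔ true))
      ≡⟨ ∑-edges Z ⟨
    ∑ (edges n) (λ e → weight e * Z (lowerEnd e) (upperEnd e)) ∎
    where
    open ℕₚ.≤-Reasoning
    n θ : ℕ
    n = 128 * g
    θ = 8 * g * L
    four-32 : ∀ g → 4 * (32 * g) ≡ 128 * g
    four-32 = solve-∀
    four-8 : ∀ g → 4 * (8 * g) ≡ 32 * g
    four-8 = solve-∀
    arrange₁ : ∀ d t g L → (t + d) + 128 * g * (g * L) ≡ d + (t + 8 * g * L * (16 * g))
    arrange₁ = solve-∀
    arrange₂ : ∀ t g → t * 1 + t * (16 * g) ≡ t * (1 + 16 * g)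
    arrange₂ = solve-∀
    1+16g≤32g : 1 + 16 * g ≤ 32 * g
    1+16g≤32g = ℕₚ.≤-trans (ℕₚ.+-monoˡ-≤ (16 * g) (ℕₚ.*-mono-≤ {1} {16} (s≤s z≤n) 0<g))
      (ℕₚ.≤-reflexive (sym (ℕₚ.*-distribʳ-+ g 16 16)))
    gain : Z bot top + n * (g * L) ≤ Z bot top ∸ θ + θ * (32 * g)
    gain = begin
      Z bot top + n * (g * L)
        ≤⟨ ℕₚ.+-monoˡ-≤ (n * (g * L)) (ℕₚ.m≤n+m∸n (Z bot top) θ) ⟩
      (θ + (Z bot top ∸ θ)) + 128 * g * (g * L)
        ≡⟨ arrange₁ (Z bot top ∸ θ) θ g L ⟩
      Z bot top ∸ θ + (θ + θ * (16 * g))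
        ≡⟨ cong (λ s → Z bot top ∸ θ + (s + θ * (16 * g))) (ℕₚ.*-identityʳ θ) ⟨
      Z bot top ∸ θ + (θ * 1 + θ * (16 * g))
        ≡⟨ cong (Z bot top ∸ θ +_) (arrange₂ θ g) ⟩
      Z bot top ∸ θ + θ * (1 + 16 * g)
        ≤⟨ ℕₚ.+-monoʳ-≤ (Z bot top ∸ θ) (ℕₚ.*-monoʳ-≤ θ 1+16g≤32g) ⟩
      Z bot top ∸ θ + θ * (32 * g) ∎

-- The ambient Hamming cube and its self-similarity.

module Ambient where
  open ≡ using (refl; sym; trans; cong; cong₂)
  open import Data.Nat.Base using (_+_; _*_; _≤_; _<_; _^_)
  open Cube
  open Gadget

  module _ {A : Set} {δ : A → A → ℕ} where

    vdist-diag : (∀ x → δ x x ≡ 0) → ∀ {n} (xs : Vec A n) → vdist δ xs xs ≡ 0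
    vdist-diag δ0 []       = refl
    vdist-diag δ0 (x ∷ xs) = cong₂ _+_ (δ0 x) (vdist-diag δ0 xs)

    vdist-sym : (∀ x y → δ x y ≡ δ y x) → ∀ {n} (xs ys : Vec A n) → vdist δ xs ys ≡ vdist δ ys xs
    vdist-sym δs []       []       = refl
    vdist-sym δs (x ∷ xs) (y ∷ ys) = cong₂ _+_ (δs x y) (vdist-sym δs xs ys)

    vdist-triangle : (∀ x y z → δ x z ≤ δ x y + δ y z) → ∀ {n} (xs ys zs : Vec A n) →
      vdist δ xs zs ≤ vdist δ xs ys + vdist δ ys zs
    vdist-triangle δt []       []       []       = z≤n
    vdist-triangle δt (x ∷ xs) (y ∷ ys) (z ∷ zs) = ℕₚ.≤-trans
      (ℕₚ.+-mono-≤ (δt x y z) (vdist-triangle δt xs ys zs))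
      (ℕₚ.≤-reflexive (interchange (δ x y) (δ y z) (vdist δ xs ys) (vdist δ ys zs)))
      where
      interchange : ∀ a b c d → a + b + (c + d) ≡ a + c + (b + d)
      interchange = solve-∀

    vdist≡0 : (∀ x y → δ x y ≡ 0 → x ≡ y) → ∀ {n} (xs ys : Vec A n) → vdist δ xs ys ≡ 0 → xs ≡ ys
    vdist≡0 δ0 []       []       eq = refl
    vdist≡0 δ0 (x ∷ xs) (y ∷ ys) eq =
      cong₂ _∷_ (δ0 x y (ℕₚ.m+n≡0⇒m≡0 (δ x y) eq)) (vdist≡0 δ0 xs ys (ℕₚ.m+n≡0⇒n≡0 (δ x y) eq))

    vdist-≤ : ∀ {b} → (∀ x y → δ x y ≤ b) → ∀ {n} (xs ys : Vec A n) → vdist δ xs ys ≤ n * b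
    vdist-≤ δb []       []       = z≤n
    vdist-≤ δb (x ∷ xs) (y ∷ ys) = ℕₚ.+-mono-≤ (δb x y) (vdist-≤ δb xs ys)

    vdist-update : (∀ x → δ x x ≡ 0) → ∀ {n} (xs : Vec A n) i y z →
      vdist δ (xs [ i ]≔ y) (xs [ i ]≔ z) ≡ δ y z
    vdist-update δ0 (x ∷ xs) Fin.zero    y z =
      trans (cong (δ y z +_) (vdist-diag δ0 xs)) (ℕₚ.+-identityʳ _)
    vdist-update δ0 (x ∷ xs) (Fin.suc i) y z = cong₂ _+_ (δ0 x) (vdist-update δ0 xs i y z)

    vdist-replicate : ∀ n x y → vdist δ (replicate n x) (replicate n y) ≡ n * δ x y
    vdist-replicate zero    x y = refl
    vdist-replicate (suc n) x y = cong (δ x y +_) (vdist-replicate n x y)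

  differ-diag : ∀ b → differ b b ≡ 0
  differ-diag true  = refl
  differ-diag false = refl

  differ-sym : ∀ a b → differ a b ≡ differ b a
  differ-sym true  true  = refl
  differ-sym true  false = refl
  differ-sym false true  = refl
  differ-sym false false = refl

  differ-triangle : ∀ a b c → differ a c ≤ differ a b + differ b c
  differ-triangle true  true  c     = ℕₚ.≤-refl
  differ-triangle false false c     = ℕₚ.≤-refl
  differ-triangle true  false true  = z≤n
  differ-triangle true  false false = ℕₚ.≤-refl
  differ-triangle false true  false = z≤n
  differ-triangle false true  true  = ℕₚ.≤-refl

  differ≡0 : ∀ a b → differ a b ≡ 0 → a ≡ b
  differ≡0 true  true  _ = refl
  differ≡0 false false _ = refl

  differ≤1 : ∀ a b → differ a b ≤ 1
  differ≤1 true  true  = z≤n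
  differ≤1 true  false = ℕₚ.≤-refl
  differ≤1 false true  = ℕₚ.≤-refl
  differ≤1 false false = z≤n

  module _ (n : ℕ) where

    -- The n ^ h coordinates of a point of the Hamming cube, grouped into
    -- nested blocks.
    Word : ℕ → Set
    Word zero    = Bool
    Word (suc h) = Vec (Word h) n

    ham : ∀ h → Word h → Word h → ℕ
    ham zero    = differ
    ham (suc h) = vdist (ham h)

    ham-diag : ∀ h x → ham h x x ≡ 0
    ham-diag zero    = differ-diag
    ham-diag (suc h) = vdist-diag (ham-diag h)

    ham-sym : ∀ h x y → ham h x y ≡ ham h y x
    ham-sym zero    = differ-sym
    ham-sym (suc h) = vdist-sym (ham-sym h)

    ham-triangle : ∀ h x y z → ham h x z ≤ ham h x y + ham h y z
    ham-triangle zero    = differ-triangle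
    ham-triangle (suc h) = vdist-triangle (ham-triangle h)

    ham≡0 : ∀ h x y → ham h x y ≡ 0 → x ≡ y
    ham≡0 zero    = differ≡0
    ham≡0 (suc h) = vdist≡0 (ham≡0 h)

    ham-≤ : ∀ h x y → ham h x y ≤ n ^ h
    ham-≤ zero    = differ≤1
    ham-≤ (suc h) = vdist-≤ (ham-≤ h)

    const : ∀ h → Bool → Word h
    const zero    b = b
    const (suc h) b = replicate n (const h b)

    ham-const : ∀ h a b → ham h (const h a) (const h b) ≡ n ^ h * differ a b
    ham-const zero    a b = sym (ℕₚ.+-identityʳ _)
    ham-const (suc h) a b = trans (vdist-replicate n _ _)
      (trans (cong (n *_) (ham-const h a b)) (sym (ℕₚ.*-assoc n (n ^ h) _)))

    blocks : ∀ h → Vec Bool n → Word (suc h)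
    blocks h = Vec.map (const h)

    ham-blocks : ∀ h x y → ham (suc h) (blocks h x) (blocks h y) ≡ n ^ h * hamming x y
    ham-blocks h = go
      where
      go : ∀ {k} (x y : Vec Bool k) →
        vdist (ham h) (Vec.map (const h) x) (Vec.map (const h) y) ≡ n ^ h * hamming x y
      go []      []      = sym (ℕₚ.*-zeroʳ (n ^ h))
      go (a ∷ x) (b ∷ y) = trans (cong₂ _+_ (ham-const h a b) (go x y))
        (sym (ℕₚ.*-distribˡ-+ (n ^ h) (differ a b) (hamming x y)))

    blocks-replicate : ∀ h b → blocks h (replicate n b) ≡ const (suc h) b
    blocks-replicate h b = Vecₚ.map-replicate (const h) b n

    -- The descent by one scale: all blocks but the `i`-th are frozen at the values of `x`. Words of
    -- height `h` are thereby embedded isometrically, and the two constant words land on the ends of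
    -- the chosen edge.
    insert : ∀ h → Fin n × Vec Bool n → Word h → Word (suc h)
    insert h (i , x) z = blocks h x [ i ]≔ z

    ham-insert : ∀ h e y z → ham (suc h) (insert h e y) (insert h e z) ≡ ham h y z
    ham-insert h (i , x) = vdist-update (ham-diag h) (blocks h x) i

    insert-lowerEnd : ∀ h e → insert h e (const h false) ≡ blocks h (lowerEnd e)
    insert-lowerEnd h (i , x) = sym (Vecₚ.map-[]≔ (const h) x i)

    insert-upperEnd : ∀ h e → insert h e (const h true) ≡ blocks h (upperEnd e)
    insert-upperEnd h (i , x) = sym (Vecₚ.map-[]≔ (const h) x i)

    size : ℕ → ℕ
    size zero    = 2
    size (suc h) = size h ^ n

    size≡ : ∀ h → size h ≡ 2 ^ (n ^ h)
    size≡ zero    = refl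
    size≡ (suc h) = trans (cong (_^ n) (size≡ h))
      (trans (ℕₚ.^-*-assoc 2 (n ^ h) n) (cong (2 ^_) (ℕₚ.*-comm (n ^ h) n)))

    encode : ∀ h → Word h → Fin (size h)
    encode zero    false = Fin.zero
    encode zero    true  = Fin.suc Fin.zero
    encode (suc h) v     = Fin.funToFin (λ i → encode h (lookup v i))

    decode : ∀ h → Fin (size h) → Word h
    decode zero    Fin.zero    = false
    decode zero    (Fin.suc _) = true
    decode (suc h) c           = Vec.tabulate (λ i → decode h (Fin.finToFun c i))

    decode-encode : ∀ h x → decode h (encode h x) ≡ x
    decode-encode zero    false = refl
    decode-encode zero    true  = refl
    decode-encode (suc h) v     = trans
      (Vecₚ.tabulate-cong λ i → trans
        (cong (decode h) (Finₚ.finToFun-funToFin (λ i → encode h (lookup v i)) i))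
        (decode-encode h (lookup v i)))
      (Vecₚ.tabulate∘lookup v)

    encode-decode : ∀ h c → encode h (decode h c) ≡ c
    encode-decode zero    Fin.zero           = refl
    encode-decode zero    (Fin.suc Fin.zero) = refl
    encode-decode (suc h) c                  = trans
      (funToFin-cong {n} λ i → trans
        (cong (encode h) (Vecₚ.lookup∘tabulate (λ i → decode h (Fin.finToFun c i)) i)) (encode-decode h (Fin.finToFun c i)))
      (Finₚ.funToFin-finToFin {n} {size h} c)
      where
      funToFin-cong : ∀ {m k} {f g : Fin m → Fin k} → (∀ i → f i ≡ g i) →
        Fin.funToFin f ≡ Fin.funToFin g
      funToFin-cong {zero}  eq = refl
      funToFin-cong {suc m} eq = cong₂ Fin.combine (eq Fin.zero) (funToFin-cong (eq ∘ Fin.suc))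

-- Terminal sequences without repetitions and their extensions.

module Sequences where
  open ≡ using (refl; sym; trans; cong; subst)
  open import Data.Nat.Base using (_+_; _*_; _≤_; _<_; _^_)

  infix 4 _⊑_
  _⊑_ : {A : Set} → List A → List A → Set
  σ ⊑ σ′ = ∃[ τ ] σ′ ≡ σ ++ τ

  ⊑-refl : ∀ {A : Set} {σ : List A} → σ ⊑ σ
  ⊑-refl {σ = σ} = [] , sym (Listₚ.++-identityʳ σ)

  ⊑-trans : ∀ {A : Set} {σ σ′ σ″ : List A} → σ ⊑ σ′ → σ′ ⊑ σ″ → σ ⊑ σ″
  ⊑-trans {σ = σ} (τ , refl) (τ′ , refl) = τ ++ τ′ , Listₚ.++-assoc σ τ τ′

  ⊑-∈ : ∀ {A : Set} {σ σ′ : List A} {x} → σ ⊑ σ′ → x ∈ σ → x ∈ σ′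
  ⊑-∈ (_ , refl) = ∈-++⁺ˡ

  ⊑-length : ∀ {A : Set} {σ σ′ : List A} → σ ⊑ σ′ → length σ ≤ length σ′
  ⊑-length {σ = σ} (τ , refl) =
    subst (length σ ≤_) (sym (Listₚ.length-++ σ)) (ℕₚ.m≤m+n _ _)

  length-∷ʳ : ∀ {A : Set} (σ : List A) x → length (σ ∷ʳ x) ≡ suc (length σ)
  length-∷ʳ σ x = trans (Listₚ.length-++ σ) (ℕₚ.+-comm (length σ) 1)

  module _ {N : ℕ} where
    open import Data.List.Membership.DecPropositional (Finₚ._≟_ {N}) using (_∈?_)

    Unique-∷ʳ : ∀ {σ : List (Fin N)} {x} → Unique σ → x ∉ σ → Unique (σ ∷ʳ x)
    Unique-∷ʳ uniq x∉ = Uniqueₚ.++⁺ uniq ([] ∷ []) λ { (x∈ , here refl) → x∉ x∈ }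

    -- Points of `G` may have been revealed before, as the diagonal of a new copy always has been;
    -- only the others are appended, so that terminals stay distinct.
    absorb : ∀ (G : List (Fin N)) σ → Unique σ → ∃[ σ′ ] σ ⊑ σ′ × Unique σ′ ×
      (∀ {x} → x ∈ G → x ∈ σ′) × length σ′ ≤ length σ + length G
    absorb []      σ uniq = σ , ⊑-refl , uniq , (λ ()) , ℕₚ.m≤m+n _ _
    absorb (x ∷ G) σ uniq with x ∈? σ
    ... | yes x∈ = let σ′ , ext , uniq′ , sub , len = absorb G σ uniq in
            σ′ , ext , uniq′ , (λ { (here refl) → ⊑-∈ ext x∈ ; (there y∈) → sub y∈ }) ,
            ℕₚ.≤-trans len (ℕₚ.+-monoʳ-≤ (length σ) (ℕₚ.n≤1+n _))
    ... | no x∉ = let σ′ , ext , uniq′ , sub , len = absorb G (σ ∷ʳ x) (Unique-∷ʳ uniq x∉) in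
            σ′ , ⊑-trans (x ∷ [] , refl) ext , uniq′ ,
            (λ { (here refl) → ⊑-∈ ext (∈-++⁺ʳ σ (here refl)) ; (there y∈) → sub y∈ }) ,
            ℕₚ.≤-trans len (ℕₚ.≤-reflexive (trans (cong (_+ length G) (length-∷ʳ σ x)) (sym (ℕₚ.+-suc _ _))))

    -- Pigeonhole: if every point occurred, the position of its occurrence would be an injection of
    -- the points into the shorter list.
    fresh : ∀ (σ : List (Fin N)) → length σ < N → ∃[ x ] x ∉ σ
    fresh σ len = Finₚ.¬∀⟶∃¬ N (_∈ σ) (_∈? σ) λ all →
      ℕₚ.<⇒≱ len (Finₚ.injective⇒≤ {f = λ x → Any.index (all x)} λ {x} {y} eq →
        trans (Anyₚ.lookup-index (all x))
          (trans (cong (List.lookup σ) eq) (sym (Anyₚ.lookup-index (all y)))))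

    -- The adversary may stop early, whereas the theorem asks for exactly `k` terminals; the filler
    -- points come last and leave the earlier distances alone.
    pad : ∀ {k} d σ → Unique σ → length σ + d ≡ k → k ≤ N →
      ∃[ σ′ ] σ ⊑ σ′ × Unique σ′ × length σ′ ≡ k
    pad zero    σ uniq len k≤N = σ , ⊑-refl , uniq , trans (sym (ℕₚ.+-identityʳ _)) len
    pad (suc d) σ uniq len k≤N =
      let x , x∉ = fresh σ (ℕₚ.<-≤-trans (ℕₚ.m<m+n (length σ) (s≤s z≤n)) (ℕₚ.≤-trans (ℕₚ.≤-reflexive len) k≤N))
          σ′ , ext , uniq′ , len′ = pad d (σ ∷ʳ x) (Unique-∷ʳ uniq x∉)
            (trans (cong (_+ d) (length-∷ʳ σ x)) (trans (sym (ℕₚ.+-suc _ d)) len)) k≤N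
      in σ′ , ⊑-trans (x ∷ [] , refl) ext , uniq′ , len′

-- Order, inverses, suprema and finite sums of real numbers.

module OrderedField (em : ExcludedMiddle (lsuc 0ℓ)) (ℝ : CompleteOrderedField) where
  open Theory ℝ public
  open CommutativeRing commutativeRing public using
    ( setoid; refl; sym; trans; reflexive; +-cong; +-congˡ; +-congʳ; *-cong; *-congˡ; *-congʳ
    ; +-assoc; +-comm; *-assoc; *-comm; +-identityˡ; +-identityʳ; *-identityˡ; *-identityʳ
    ; distribˡ; distribʳ; zeroˡ; zeroʳ; -‿inverseˡ; -‿inverseʳ; -‿cong; ring; commutativeSemiring; +-monoid
    ; +-group)
  open IsTotalOrder isTotalOrder public using (total; isPartialOrder; antisym)
    renaming (refl to ≤-refl; reflexive to ≤-reflexive; trans to ≤-trans; ≤-respˡ-≈ to ≤-respˡ; ≤-respʳ-≈ to ≤-respʳ)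
  open import Algebra.Properties.Semiring.Mult semiring public using (×1-homo-*)
  open import Algebra.Properties.Monoid.Mult +-monoid public using (×-homo-+; ×-congˡ)
  open import Algebra.Properties.Semiring.Exp semiring public using (^-congˡ)
  open import Algebra.Properties.Group +-group public using ()
    renaming (⁻¹-involutive to -‿involutive; ε⁻¹≈ε to -0≈0)
  open import Algebra.Properties.Ring ring public using (-‿distribˡ-*)
  open import Algebra.Solver.Ring.NaturalCoefficients.Default commutativeSemiring public
    using (solve; _:=_; _:+_; _:*_; con)

  poset : Poset 0ℓ 0ℓ 0ℓ
  poset = record { isPartialOrder = isPartialOrder }

  module ≤-Reasoning where
    open import Relation.Binary.Reasoning.PartialOrder poset public

  decide : {P : Set} → Dec P
  decide {P} = map′ lower lift (em {Lift (lsuc 0ℓ) P})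

  ≰⇒≥ : ∀ {x y} → ¬ (x ≤ y) → y ≤ x
  ≰⇒≥ {x} {y} x≰y = [ (λ x≤y → contradiction x≤y x≰y) , id ]′ (total x y)

  ≰⇒> : ∀ {x y} → ¬ (x ≤ y) → y < x
  ≰⇒> x≰y = ≰⇒≥ x≰y , λ y≈x → x≰y (≤-reflexive (sym y≈x))

  <⇒≱ : ∀ {x y} → x < y → ¬ (y ≤ x)
  <⇒≱ (x≤y , x≉y) y≤x = x≉y (antisym x≤y y≤x)

  +-monoˡ-≤ : ∀ x {y z} → y ≤ z → y + x ≤ z + x
  +-monoˡ-≤ x y≤z = ≤-respˡ (+-comm x _) (≤-respʳ (+-comm x _) (+-monoʳ-≤ x y≤z))

  +-mono-≤ : ∀ {w x y z} → w ≤ x → y ≤ z → w + y ≤ x + z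
  +-mono-≤ w≤x y≤z = ≤-trans (+-monoˡ-≤ _ w≤x) (+-monoʳ-≤ _ y≤z)

  -x+[x+y]≈y : ∀ x y → - x + (x + y) ≈ y
  -x+[x+y]≈y x y = trans (sym (+-assoc _ _ _)) (trans (+-congʳ (-‿inverseˡ x)) (+-identityˡ y))

  +-cancelˡ-≤ : ∀ x {y z} → x + y ≤ x + z → y ≤ z
  +-cancelˡ-≤ x le = ≤-respˡ (-x+[x+y]≈y x _) (≤-respʳ (-x+[x+y]≈y x _) (+-monoʳ-≤ (- x) le))

  +-cancelʳ-≤ : ∀ x {y z} → y + x ≤ z + x → y ≤ z
  +-cancelʳ-≤ x le = +-cancelˡ-≤ x (≤-respˡ (+-comm _ x) (≤-respʳ (+-comm _ x) le))

  x≤x+y : ∀ x {y} → 0# ≤ y → x ≤ x + y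
  x≤x+y x 0≤y = ≤-respˡ (+-identityʳ x) (+-monoʳ-≤ x 0≤y)

  x≤y⇒0≤y-x : ∀ {x y} → x ≤ y → 0# ≤ y - x
  x≤y⇒0≤y-x {x} x≤y = ≤-respˡ (-‿inverseʳ x) (+-monoˡ-≤ (- x) x≤y)

  y-x+x≈y : ∀ y x → y - x + x ≈ y
  y-x+x≈y y x = trans (+-assoc y (- x) x) (trans (+-congˡ (-‿inverseˡ x)) (+-identityʳ y))

  neg-mono-≤ : ∀ {x y} → x ≤ y → - y ≤ - x
  neg-mono-≤ {x} {y} x≤y = +-cancelˡ-≤ y (≤-respˡ (sym (-‿inverseʳ y)) (x≤y⇒0≤y-x x≤y))

  neg-cancel-≤ : ∀ {x y} → - y ≤ - x → x ≤ y
  neg-cancel-≤ le = ≤-respˡ (-‿involutive _) (≤-respʳ (-‿involutive _) (neg-mono-≤ le))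

  *-monoˡ-≤ : ∀ {c x y} → 0# ≤ c → x ≤ y → c * x ≤ c * y
  *-monoˡ-≤ {c} {x} {y} 0≤c x≤y = begin
    c * x                  ≈⟨ +-identityˡ _ ⟨
    0# + c * x             ≤⟨ +-monoˡ-≤ (c * x) (*-nonNeg 0≤c (x≤y⇒0≤y-x x≤y)) ⟩
    c * (y - x) + c * x    ≈⟨ distribˡ c (y - x) x ⟨
    c * (y - x + x)        ≈⟨ *-congˡ (y-x+x≈y y x) ⟩
    c * y ∎
    where open ≤-Reasoning

  *-monoʳ-≤ : ∀ {c x y} → 0# ≤ c → x ≤ y → x * c ≤ y * c
  *-monoʳ-≤ 0≤c x≤y = ≤-respˡ (*-comm _ _) (≤-respʳ (*-comm _ _) (*-monoˡ-≤ 0≤c x≤y))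

  *-mono-≤ : ∀ {a b c d} → 0# ≤ a → 0# ≤ d → a ≤ b → c ≤ d → a * c ≤ b * d
  *-mono-≤ 0≤a 0≤d a≤b c≤d = ≤-trans (*-monoˡ-≤ 0≤a c≤d) (*-monoʳ-≤ 0≤d a≤b)

  0≤1 : 0# ≤ 1#
  0≤1 with total 0# 1#
  ... | inj₁ le = le
  ... | inj₂ ge = ≤-respʳ squared (*-nonNeg 0≤-1 0≤-1)
    where
    0≤-1 : 0# ≤ - 1#
    0≤-1 = ≤-respˡ -0≈0 (neg-mono-≤ ge)
    squared : - 1# * - 1# ≈ 1#
    squared = trans (sym (-‿distribˡ-* 1# (- 1#))) (trans (-‿cong (*-identityˡ (- 1#))) (-‿involutive 1#))

  0<1 : 0# < 1#
  0<1 = 0≤1 , 0≉1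

  1≰0 : ¬ (1# ≤ 0#)
  1≰0 = <⇒≱ 0<1

  0≤ι : ∀ n → 0# ≤ ι n
  0≤ι zero    = ≤-refl
  0≤ι (suc n) = ≤-trans (0≤ι n) (≤-respˡ (+-identityˡ (ι n)) (+-monoˡ-≤ (ι n) 0≤1))

  ι-+ : ∀ m n → ι (m ℕ.+ n) ≈ ι m + ι n
  ι-+ = ×-homo-+ 1#

  ι-* : ∀ m n → ι (m ℕ.* n) ≈ ι m * ι n
  ι-* = ×1-homo-*

  ι-1 : ι 1 ≈ 1#
  ι-1 = +-identityʳ 1#

  ι-^ : ∀ m n → ι (m ℕ.^ n) ≈ ι m ^ n
  ι-^ m zero    = ι-1
  ι-^ m (suc n) = trans (ι-* m (m ℕ.^ n)) (*-congˡ (ι-^ m n))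

  ι-mono : ∀ {m n} → m ℕ.≤ n → ι m ≤ ι n
  ι-mono {n = n} z≤n = 0≤ι n
  ι-mono (s≤s m≤n)   = +-monoʳ-≤ 1# (ι-mono m≤n)

  ι-cancel-≤ : ∀ {m n} → ι m ≤ ι n → m ℕ.≤ n
  ι-cancel-≤ {zero}          le = z≤n
  ι-cancel-≤ {suc m} {zero}  le =
    contradiction (≤-trans (≤-respʳ refl (x≤x+y 1# (0≤ι m))) le) 1≰0
  ι-cancel-≤ {suc m} {suc n} le = s≤s (ι-cancel-≤ (+-cancelˡ-≤ 1# le))

  ι-pos : ∀ {n} → 0 ℕ.< n → 0# < ι n
  ι-pos {n} 0<n = 0≤ι n , λ 0≈ιn → ℕₚ.<⇒≱ 0<n (ι-cancel-≤ (≤-reflexive (sym 0≈ιn)))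

  *-cancelˡ-≤ : ∀ {c x y} → 0# < c → c * x ≤ c * y → x ≤ y
  *-cancelˡ-≤ {c} {x} {y} (0≤c , 0≉c) le = begin
    x                ≈⟨ unscale x ⟨
    c ⁻¹ * (c * x)   ≤⟨ *-monoˡ-≤ 0≤c⁻¹ le ⟩
    c ⁻¹ * (c * y)   ≈⟨ unscale y ⟩
    y ∎
    where
    open ≤-Reasoning
    c⁻¹c : c ⁻¹ * c ≈ 1#
    c⁻¹c = trans (*-comm _ _) (*-inverseʳ (0≉c ∘ sym))
    unscale : ∀ z → c ⁻¹ * (c * z) ≈ z
    unscale z = trans (sym (*-assoc _ _ _)) (trans (*-congʳ c⁻¹c) (*-identityˡ z))
    0≤c⁻¹ : 0# ≤ c ⁻¹
    0≤c⁻¹ with total 0# (c ⁻¹)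
    ... | inj₁ p = p
    ... | inj₂ p = contradiction
            (≤-respˡ (trans (*-comm _ _) c⁻¹c) (≤-respʳ (zeroʳ c) (*-monoˡ-≤ 0≤c p))) 1≰0

  *-cancelʳ-≤ : ∀ {c x y} → 0# < c → x * c ≤ y * c → x ≤ y
  *-cancelʳ-≤ 0<c le = *-cancelˡ-≤ 0<c (≤-respˡ (*-comm _ _) (≤-respʳ (*-comm _ _) le))

  *-pos : ∀ {x y} → 0# < x → 0# < y → 0# < x * y
  *-pos {x} {y} 0<x 0<y = *-nonNeg (proj₁ 0<x) (proj₁ 0<y) , λ 0≈xy →
    <⇒≱ 0<y (*-cancelˡ-≤ 0<x (≤-reflexive (trans (sym 0≈xy) (sym (zeroʳ x)))))

  inverseʳ : ∀ {x} → 0# < x → x * x ⁻¹ ≈ 1#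
  inverseʳ (_ , 0≉x) = *-inverseʳ (0≉x ∘ sym)

  ⁻¹-pos : ∀ {x} → 0# < x → 0# < x ⁻¹
  ⁻¹-pos {x} 0<x = 0≤x⁻¹ , λ 0≈x⁻¹ → 0≉1 (trans (sym (zeroʳ x)) (trans (*-congˡ 0≈x⁻¹) (inverseʳ 0<x)))
    where
    0≤x⁻¹ : 0# ≤ x ⁻¹
    0≤x⁻¹ = *-cancelˡ-≤ 0<x (≤-respˡ (sym (zeroʳ x)) (≤-respʳ (sym (inverseʳ 0<x)) 0≤1))

  /-≤ : ∀ {x y z} → 0# < y → x ≤ z * y → x / y ≤ z
  /-≤ {x} {y} {z} 0<y x≤zy = begin
    x * y ⁻¹        ≤⟨ *-monoʳ-≤ (proj₁ (⁻¹-pos 0<y)) x≤zy ⟩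
    z * y * y ⁻¹    ≈⟨ trans (*-assoc z y _) (trans (*-congˡ (inverseʳ 0<y)) (*-identityʳ z)) ⟩
    z ∎
    where open ≤-Reasoning

  ⁻¹-cong : ∀ {x y} → 0# < x → x ≈ y → x ⁻¹ ≈ y ⁻¹
  ⁻¹-cong {x} {y} 0<x x≈y = begin
    x ⁻¹               ≈⟨ *-identityʳ _ ⟨
    x ⁻¹ * 1#          ≈⟨ *-congˡ (inverseʳ 0<y) ⟨
    x ⁻¹ * (y * y ⁻¹)  ≈⟨ *-assoc _ _ _ ⟨
    x ⁻¹ * y * y ⁻¹    ≈⟨ *-congʳ (trans (*-comm _ _) (trans (*-congʳ (sym x≈y)) (inverseʳ 0<x))) ⟩
    1# * y ⁻¹          ≈⟨ *-identityˡ _ ⟩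
    y ⁻¹ ∎
    where
    open import Relation.Binary.Reasoning.Setoid setoid
    0<y : 0# < y
    0<y = ≤-respʳ x≈y (proj₁ 0<x) , λ 0≈y → proj₂ 0<x (trans 0≈y (sym x≈y))

  ^-nonNeg : ∀ {x} → 0# ≤ x → ∀ n → 0# ≤ x ^ n
  ^-nonNeg 0≤x zero    = 0≤1
  ^-nonNeg 0≤x (suc n) = *-nonNeg 0≤x (^-nonNeg 0≤x n)

  ^-mono-≤ : ∀ {x y} → 0# ≤ x → x ≤ y → ∀ n → x ^ n ≤ y ^ n
  ^-mono-≤ 0≤x x≤y zero    = ≤-refl
  ^-mono-≤ 0≤x x≤y (suc n) =
    *-mono-≤ 0≤x (^-nonNeg (≤-trans 0≤x x≤y) n) x≤y (^-mono-≤ 0≤x x≤y n)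

  ^-cancel-≤ : ∀ {x y} n → 0 ℕ.< n → 0# ≤ y → x ^ n ≤ y ^ n → x ≤ y
  ^-cancel-≤ {x} {y} (suc n) _ 0≤y le with decide {x ≤ y}
  ... | yes x≤y = x≤y
  -- Here y ≤ x, so x * x ^ n ≤ y * y ^ n ≤ y * x ^ n, and the positive x ^ n cancels.
  ... | no  x≰y = *-cancelʳ-≤ (^-pos n)
          (≤-trans le (*-monoˡ-≤ 0≤y (^-mono-≤ 0≤y (≰⇒≥ x≰y) n)))
    where
    0<x : 0# < x
    0<x = ≤-trans 0≤y (≰⇒≥ x≰y) , λ 0≈x → x≰y (≤-respˡ 0≈x 0≤y)
    ^-pos : ∀ n → 0# < x ^ n
    ^-pos zero    = 0<1
    ^-pos (suc n) = *-pos 0<x (^-pos n)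

  IsSup-unique : ∀ {P s t} → IsSup _≤_ P s → IsSup _≤_ P t → s ≈ t
  IsSup-unique S T = antisym (IsSup.least S (IsSup.upper T)) (IsSup.least T (IsSup.upper S))

  max⇒IsSup : ∀ {P : Carrier → Set} {s} → P s → UpperBound _≤_ P s → IsSup _≤_ P s
  max⇒IsSup Ps ub = record { upper = ub ; least = λ bound → bound Ps }

  sup≈max : ∀ {P : Carrier → Set} {s} → P s → UpperBound _≤_ P s → sup P ≈ s
  sup≈max Ps ub = IsSup-unique (sup-isSup (_ , Ps) (_ , ub)) (max⇒IsSup Ps ub)

  -- Otherwise the multiples of `δ` are bounded by 1 and have a supremum `s`; since each multiple
  -- has a successor, s - δ is an upper bound too, which is absurd.
  archimedean : ∀ {δ} → 0# < δ → ∃[ a ] 1# ≤ ι a * δ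
  archimedean {δ} 0<δ with decide {∃[ a ] 1# ≤ ι a * δ}
  ... | yes found = found
  ... | no  none  = contradiction (+-cancelˡ-≤ s (≤-respʳ (sym (+-identityʳ s)) s+δ≤s)) (<⇒≱ 0<δ)
    where
    P : Carrier → Set
    P r = ∃[ a ] r ≈ ι a * δ
    bound : UpperBound _≤_ P 1#
    bound (a , r≈) = ≤-respˡ (sym r≈) (≰⇒≥ λ le → none (a , le))
    s : Carrier
    s = sup P
    isSup : IsSup _≤_ P s
    isSup = sup-isSup (0# , 0 , sym (zeroˡ δ)) (1# , bound)
    s≤s-δ : s ≤ s - δ
    s≤s-δ = IsSup.least isSup λ { {r} (a , r≈) → +-cancelʳ-≤ δ (begin
      r + δ            ≈⟨ +-cong r≈ (sym (*-identityˡ δ)) ⟩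
      ι a * δ + 1# * δ ≈⟨ distribʳ δ (ι a) 1# ⟨
      (ι a + 1#) * δ   ≈⟨ *-congʳ (+-comm (ι a) 1#) ⟩
      ι (suc a) * δ    ≤⟨ IsSup.upper isSup (suc a , refl) ⟩
      s                ≈⟨ y-x+x≈y s δ ⟨
      s - δ + δ ∎) }
      where open ≤-Reasoning
    s+δ≤s : s + δ ≤ s
    s+δ≤s = ≤-respʳ (y-x+x≈y s δ) (+-monoˡ-≤ δ s≤s-δ)

  ∑ʳ : {A : Set} → List A → (A → Carrier) → Carrier
  ∑ʳ []       f = 0#
  ∑ʳ (x ∷ xs) f = f x + ∑ʳ xs f

  module _ {A : Set} where

    ∑ʳ-cong : ∀ (xs : List A) {f g} → (∀ x → f x ≈ g x) → ∑ʳ xs f ≈ ∑ʳ xs g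
    ∑ʳ-cong []       eq = refl
    ∑ʳ-cong (x ∷ xs) eq = +-cong (eq x) (∑ʳ-cong xs eq)

    ∑ʳ-*ˡ : ∀ (xs : List A) c f → ∑ʳ xs (λ x → c * f x) ≈ c * ∑ʳ xs f
    ∑ʳ-*ˡ []       c f = sym (zeroʳ c)
    ∑ʳ-*ˡ (x ∷ xs) c f = trans (+-congˡ (∑ʳ-*ˡ xs c f)) (sym (distribˡ c _ _))

    ∑ʳ-++ : ∀ (xs ys : List A) f → ∑ʳ (xs ++ ys) f ≈ ∑ʳ xs f + ∑ʳ ys f
    ∑ʳ-++ []       ys f = sym (+-identityˡ _)
    ∑ʳ-++ (x ∷ xs) ys f = trans (+-congˡ (∑ʳ-++ xs ys f)) (sym (+-assoc _ _ _))

    ∑ʳ-map : ∀ {B : Set} (g : B → A) xs f → ∑ʳ (List.map g xs) f ≈ ∑ʳ xs (f ∘ g)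
    ∑ʳ-map g []       f = refl
    ∑ʳ-map g (x ∷ xs) f = +-congˡ (∑ʳ-map g xs f)

    ∑ʳ-mono-∈ : ∀ (xs : List A) {f g} → (∀ {x} → x ∈ xs → f x ≤ g x) → ∑ʳ xs f ≤ ∑ʳ xs g
    ∑ʳ-mono-∈ []       le = ≤-refl
    ∑ʳ-mono-∈ (x ∷ xs) le = +-mono-≤ (le (here ≡.refl)) (∑ʳ-mono-∈ xs (le ∘ there))

    ι-∑ : ∀ (xs : List A) (f : A → ℕ) → ι (Sums.∑ xs f) ≈ ∑ʳ xs (ι ∘ f)
    ι-∑ []       f = refl
    ι-∑ (x ∷ xs) f = trans (ι-+ (f x) _) (+-congˡ (ι-∑ xs f))

  ∑ʳ-cartesianProduct : ∀ {A B : Set} (xs : List A) (ys : List B) f →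
    ∑ʳ (List.cartesianProduct xs ys) f ≈ ∑ʳ xs (λ x → ∑ʳ ys (λ y → f (x , y)))
  ∑ʳ-cartesianProduct []       ys f = refl
  ∑ʳ-cartesianProduct (x ∷ xs) ys f = trans (∑ʳ-++ (List.map (x ,_) ys) _ f)
    (+-cong (∑ʳ-map (x ,_) ys f) (∑ʳ-cartesianProduct xs ys f))

  argmax : ∀ {A : Set} (f : A → Carrier) x xs → ∃[ m ] m ∈ (x ∷ xs) × (∀ {y} → y ∈ (x ∷ xs) → f y ≤ f m)
  argmax f x [] = x , here ≡.refl , λ { (here ≡.refl) → ≤-refl }
  argmax f x (z ∷ xs) with argmax f z xs
  ... | m , m∈ , max with total (f x) (f m)
  ...   | inj₁ x≤m = m , there m∈ , λ { (here ≡.refl) → x≤m ; (there y∈) → max y∈ }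
  ...   | inj₂ m≤x = x , here ≡.refl , λ { (here ≡.refl) → ≤-refl ; (there y∈) → ≤-trans (max y∈) m≤x }

  weighted-average : ∀ {A : Set} (xs : List A) (w : A → ℕ) (f : A → Carrier) t →
    0 ℕ.< Sums.∑ xs w → ι (Sums.∑ xs w) * t ≤ ∑ʳ xs (λ x → ι (w x) * f x) →
    ∃[ x ] x ∈ xs × t ≤ f x
  weighted-average (x ∷ xs) w f t pos le =
    let m , m∈ , max = argmax f x xs in
    m , m∈ , *-cancelˡ-≤ (ι-pos pos) (begin
      ι (Sums.∑ (x ∷ xs) w) * t
        ≤⟨ le ⟩
      ∑ʳ (x ∷ xs) (λ y → ι (w y) * f y)
        ≤⟨ ∑ʳ-mono-∈ (x ∷ xs) (λ {y} y∈ → *-monoˡ-≤ (0≤ι (w y)) (max y∈)) ⟩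
      ∑ʳ (x ∷ xs) (λ y → ι (w y) * f m)
        ≈⟨ ∑ʳ-cong (x ∷ xs) (λ y → *-comm (ι (w y)) (f m)) ⟩
      ∑ʳ (x ∷ xs) (λ y → f m * ι (w y))
        ≈⟨ ∑ʳ-*ˡ (x ∷ xs) (f m) (ι ∘ w) ⟩
      f m * ∑ʳ (x ∷ xs) (ι ∘ w)
        ≈⟨ *-comm _ _ ⟩
      ∑ʳ (x ∷ xs) (ι ∘ w) * f m
        ≈⟨ *-congʳ (sym (ι-∑ (x ∷ xs) w)) ⟩
      ι (Sums.∑ (x ∷ xs) w) * f m ∎)
    where open ≤-Reasoning

-- HST distances as ultrametrics, and their integer truncation.

module Ultrametric (em : ExcludedMiddle (lsuc 0ℓ)) (ℝ : CompleteOrderedField) where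
  open OrderedField em ℝ
  open Sums
  open Gadget using (indicator)

  lca-diag : ∀ t p → label (lca t p p) ≡ 0#
  lca-diag leaf           p       = ≡.refl
  lca-diag (node Δ child) (i , p) with i Finₚ.≟ i
  ... | yes ≡.refl = lca-diag (child i) p
  ... | no  i≢i    = contradiction ≡.refl i≢i

  lca-sym : ∀ t p q → label (lca t p q) ≡ label (lca t q p)
  lca-sym leaf           p       q       = ≡.refl
  lca-sym (node Δ child) (i , p) (j , q) with i Finₚ.≟ j | j Finₚ.≟ i
  ... | yes ≡.refl | yes ≡.refl = lca-sym (child i) p q
  ... | no  _      | no  _      = ≡.refl
  ... | yes ≡.refl | no  i≢i    = contradiction ≡.refl i≢i
  ... | no  i≢i    | yes ≡.refl = contradiction ≡.refl i≢i

  module _ {μ : Carrier} (1<μ : 1# < μ) where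

    /μ-≤ : ∀ {x} → 0# ≤ x → x / μ ≤ x
    /μ-≤ {x} 0≤x = /-≤ 0<μ (≤-respˡ (*-identityʳ x) (*-monoˡ-≤ 0≤x (proj₁ 1<μ)))
      where
      0<μ : 0# < μ
      0<μ = ≤-trans 0≤1 (proj₁ 1<μ) , λ 0≈μ → <⇒≱ 1<μ (≤-respˡ 0≈μ 0≤1)

    child≤ : ∀ {Δ n} {child : Fin (suc n) → Tree} → IsHST μ (node Δ child) →
      ∀ i → label (child i) ≤ Δ
    child≤ (0<Δ , h) i = ≤-trans (proj₁ (h i)) (/μ-≤ (proj₁ 0<Δ))

    lca-≤ : ∀ t → IsHST μ t → ∀ p q → label (lca t p q) ≤ label t
    lca-≤ leaf           h p       q       = ≤-refl
    lca-≤ (node Δ child) h (i , p) (j , q) with i Finₚ.≟ j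
    ... | yes ≡.refl = ≤-trans (lca-≤ (child i) (proj₂ (proj₂ h i)) p q) (child≤ h i)
    ... | no  _      = ≤-refl

    -- If `p` and `r` part at this node, then `q` parts here from one of them, at the same label; if
    -- they share a child that `q` avoids, their label is bounded by `child≤`. The disjunction
    -- passes through the truncation by monotonicity alone.
    lca-ultra : ∀ t → IsHST μ t → ∀ p q r →
      label (lca t p r) ≤ label (lca t p q) ⊎ label (lca t p r) ≤ label (lca t q r)
    lca-ultra leaf           h p       q       r       = inj₁ ≤-refl
    lca-ultra (node Δ child) h (i , p) (j , q) (k , r) with i Finₚ.≟ k | i Finₚ.≟ j | j Finₚ.≟ k
    ... | yes ≡.refl | yes ≡.refl | yes ≡.refl = lca-ultra (child i) (proj₂ (proj₂ h i)) p q r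
    ... | yes ≡.refl | yes ≡.refl | no  i≢i    = contradiction ≡.refl i≢i
    ... | yes ≡.refl | no  _      | _          =
          inj₁ (≤-trans (lca-≤ (child i) (proj₂ (proj₂ h i)) p r) (child≤ h i))
    ... | no  _      | no  _      | _          = inj₁ ≤-refl
    ... | no  _      | yes ≡.refl | no  _      = inj₂ ≤-refl
    ... | no  i≢k    | yes ≡.refl | yes ≡.refl = contradiction ≡.refl i≢k

  module _ (H : HST) where
    open HST H

    dist-diag : ∀ p → dist p p ≡ 0#
    dist-diag = lca-diag tree

    dist-sym : ∀ p q → dist p q ≡ dist q p
    dist-sym = lca-sym tree

    dist-ultra : ∀ p q r → dist p r ≤ dist p q ⊎ dist p r ≤ dist q r
    dist-ultra = lca-ultra 1<μ tree isHST

  -- ⌊ x ⌋ capped at M, for x ≥ 0.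
  module Truncation (M : ℕ) where

    floor : Carrier → ℕ
    floor x = ∑ (List.allFin M) λ i → indicator (decide {ι (suc (toℕ i)) ≤ x})

    floor-mono : ∀ {x y} → x ≤ y → floor x ℕ.≤ floor y
    floor-mono {x} {y} x≤y = ∑-mono (List.allFin M) λ i → step (decide {ι (suc (toℕ i)) ≤ x}) decide
      where
      step : ∀ {z} (d : Dec (z ≤ x)) (e : Dec (z ≤ y)) → indicator d ℕ.≤ indicator e
      step (no _)  _       = z≤n
      step (yes _) (yes _) = ℕₚ.≤-refl
      step (yes p) (no ¬q) = contradiction (≤-trans p x≤y) ¬q

    floor-zero : floor 0# ≡ 0
    floor-zero = ≡.trans (∑-cong (List.allFin M) λ i → none i decide) (∑-zero (List.allFin M))
      where
      none : ∀ i (d : Dec (ι (suc (toℕ {M} i)) ≤ 0#)) → indicator d ≡ 0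
      none i (no _)  = ≡.refl
      none i (yes p) with () ← ι-cancel-≤ {suc (toℕ i)} {0} p

    floor-ultra : ∀ {x y z} → x ≤ y ⊎ x ≤ z → floor x ℕ.≤ floor y ⊔ floor z
    floor-ultra (inj₁ x≤y) = ℕₚ.≤-trans (floor-mono x≤y) (ℕₚ.m≤m⊔n _ _)
    floor-ultra (inj₂ x≤z) = ℕₚ.≤-trans (floor-mono x≤z) (ℕₚ.m≤n⊔m _ _)

    floor-≥ : ∀ {h x} → h ℕ.≤ M → ι h ≤ x → h ℕ.≤ floor x
    floor-≥ {h} {x} h≤M ιh≤x = count M h (λ t → ι (suc t) ≤ x) (λ t → decide) h≤M
      λ t t<h → ≤-trans (ι-mono t<h) ιh≤x
      where
      count : ∀ M h (P : ℕ → Set) (P? : ∀ t → Dec (P t)) → h ℕ.≤ M → (∀ t → t ℕ.< h → P t) →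
        h ℕ.≤ ∑ (List.allFin M) (λ i → indicator (P? (toℕ i)))
      count M       zero    P P? h≤M       all = z≤n
      count (suc M) (suc h) P P? (s≤s h≤M) all
        rewrite ∑-allFin-suc M (λ i → indicator (P? (toℕ i))) with P? 0
      ... | yes _ = s≤s (count M h (P ∘ suc) (P? ∘ suc) h≤M (λ t t<h → all (suc t) (s≤s t<h)))
      ... | no ¬p = contradiction (all 0 (s≤s z≤n)) ¬p

-- Finite additivity and the integration of pointwise inequalities.

module Probability (em : ExcludedMiddle (lsuc 0ℓ)) (ℝ : CompleteOrderedField) where
  open OrderedField em ℝ
  open Sums
  open Gadget using (indicator)

  module _ {Ω : Set} (law : ProbabilityMeasure Ω) where
    open ProbabilityMeasure law

    private
      Event : Set₁
      Event = Pred Ω 0ℓ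

      pair : Event → Event → ℕ → Event
      pair A B 0 = A
      pair A B 1 = B
      pair A B _ = ∅

    measurable-∅ : Measurable ∅
    measurable-∅ = measurable-≐ ((λ ¬u → ¬u tt) , λ ()) (measurable-∁ measurable-U)

    private
      measurable-pair : ∀ {A B} → Measurable A → Measurable B → ∀ n → Measurable (pair A B n)
      measurable-pair mA mB 0             = mA
      measurable-pair mA mB 1             = mB
      measurable-pair mA mB (suc (suc n)) = measurable-∅

      ⋃-pair : ∀ {A B} → ⋃ ℕ (pair A B) ≐ (A ∪ B)
      ⋃-pair = (λ { (0 , a) → inj₁ a ; (1 , b) → inj₂ b }) ,
               (λ { (inj₁ a) → 0 , a ; (inj₂ b) → 1 , b })

    measurable-∪ : ∀ {A B : Event} → Measurable A → Measurable B → Measurable (A ∪ B)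
    measurable-∪ mA mB = measurable-≐ ⋃-pair (measurable-⋃ (measurable-pair mA mB))

    measurable-∩ : ∀ {A B : Event} → Measurable A → Measurable B → Measurable (A ∩ B)
    measurable-∩ {A} {B} mA mB = measurable-≐
      ((λ {ω} n → dne (λ ¬a → n (inj₁ ¬a)) , dne (λ ¬b → n (inj₂ ¬b))) ,
       (λ { (a , b) (inj₁ ¬a) → ¬a a ; (a , b) (inj₂ ¬b) → ¬b b }))
      (measurable-∁ (measurable-∪ (measurable-∁ mA) (measurable-∁ mB)))
      where
      dne : ∀ {P : Set} → ¬ ¬ P → P
      dne {P} ¬¬p with decide {P}
      ... | yes p = p
      ... | no ¬p = contradiction ¬p ¬¬p

    -- The constant sequence of empty events is pairwise disjoint with empty union, so its partial
    -- sum of two terms is at most ℙ ∅.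
    ℙ-∅ : ℙ ∅ ≈ 0#
    ℙ-∅ = antisym (+-cancelˡ-≤ (ℙ ∅) (≤-respʳ (sym (+-identityʳ _)) double)) (ℙ-nonNeg measurable-∅)
      where
      double : ℙ ∅ + ℙ ∅ ≤ ℙ ∅
      double = ≤-respˡ (+-congʳ (+-identityˡ _)) (≤-respʳ
        (ℙ-≐ (measurable-⋃ (λ _ → measurable-∅)) ((λ ()) , λ ()))
        (IsSup.upper (ℙ-⋃ {A = λ _ → ∅} (λ _ → measurable-∅) (λ _ ())) (2 , refl)))

    ℙ-∪ : ∀ {A B : Event} → Measurable A → Measurable B → A ⊥ B → ℙ (A ∪ B) ≈ ℙ A + ℙ B
    ℙ-∪ {A} {B} mA mB A⊥B = trans
      (sym (ℙ-≐ (measurable-⋃ (measurable-pair mA mB)) ⋃-pair))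
      (IsSup-unique (ℙ-⋃ (measurable-pair mA mB) disjoint) (max⇒IsSup (2 , attained) bound))
      where
      disjoint : ∀ {m n} → m ≢ n → pair A B m ⊥ pair A B n
      disjoint {0}           {0}           m≢n _       = m≢n ≡.refl
      disjoint {0}           {1}           _   (a , b) = A⊥B (a , b)
      disjoint {1}           {0}           _   (b , a) = A⊥B (a , b)
      disjoint {1}           {1}           m≢n _       = m≢n ≡.refl
      disjoint {0}           {suc (suc n)} _   (_ , ())
      disjoint {1}           {suc (suc n)} _   (_ , ())
      disjoint {suc (suc m)} {n}           _   (() , _)
      attained : ℙ A + ℙ B ≈ 0# + ℙ A + ℙ B
      attained = +-congʳ (sym (+-identityˡ _))
      partial : ∀ n → partialSum (λ i → ℙ (pair A B i)) n ≤ ℙ A + ℙ B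
      partial 0 = ≤-trans (ℙ-nonNeg mA) (x≤x+y (ℙ A) (ℙ-nonNeg mB))
      partial 1 = ≤-respˡ (sym (+-identityˡ _)) (x≤x+y (ℙ A) (ℙ-nonNeg mB))
      partial 2 = ≤-reflexive (sym attained)
      partial (suc (suc (suc n))) =
        ≤-respˡ (sym (trans (+-congˡ ℙ-∅) (+-identityʳ _))) (partial (suc (suc n)))
      bound : UpperBound _≤_ (λ r → ∃[ n ] r ≈ partialSum (λ i → ℙ (pair A B i)) n) (ℙ A + ℙ B)
      bound (n , r≈) = ≤-respˡ (sym r≈) (partial n)

    ℙ-split : ∀ {E A : Event} → Measurable E → Measurable A → ℙ E ≈ ℙ (E ∩ A) + ℙ (E ∩ ∁ A)
    ℙ-split {E} {A} mE mA = trans (ℙ-≐ mE (split , merge))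
      (ℙ-∪ (measurable-∩ mE mA) (measurable-∩ mE (measurable-∁ mA)) λ ((_ , a) , (_ , ¬a)) → ¬a a)
      where
      split : ∀ {ω} → E ω → ((E ∩ A) ∪ (E ∩ ∁ A)) ω
      split {ω} e with decide {A ω}
      ... | yes a = inj₁ (e , a)
      ... | no ¬a = inj₂ (e , ¬a)
      merge : ∀ {ω} → ((E ∩ A) ∪ (E ∩ ∁ A)) ω → E ω
      merge (inj₁ (e , _)) = e
      merge (inj₂ (e , _)) = e

    module _ {I J : Set} (v : I → ℕ) (A : I → Event) (w : J → ℕ) (B : J → Event)
             (mA : ∀ i → Measurable (A i)) (mB : ∀ j → Measurable (B j)) where

      Dominated : Event → ℕ → List I → ℕ → List J → Set
      Dominated E c is d js = ∀ ω → E ω →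
        c ℕ.+ ∑ is (λ i → v i ℕ.* indicator (decide {A i ω})) ℕ.≤
        d ℕ.+ ∑ js (λ j → w j ℕ.* indicator (decide {B j ω}))

      private
        counted : ∀ c a s → c ℕ.+ (a ℕ.* 1 ℕ.+ s) ≡ (c ℕ.+ a) ℕ.+ s
        counted c a s = ≡.trans (≡.cong (λ k → c ℕ.+ (k ℕ.+ s)) (ℕₚ.*-identityʳ a)) (≡.sym (ℕₚ.+-assoc c a s))

        dropped : ∀ c a s → c ℕ.+ (a ℕ.* 0 ℕ.+ s) ≡ c ℕ.+ s
        dropped c a s = ≡.cong (λ k → c ℕ.+ (k ℕ.+ s)) (ℕₚ.*-zeroʳ a)

        -- Splitting E along the first event of a list moves its coefficient
        -- into the constant term on one half and drops it on the other.
        split-term : ∀ {E F : Event} → Measurable E → Measurable F → ∀ c a s s₁ s₂ →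
          s ≈ s₁ + s₂ →
          (ι (c ℕ.+ a) * ℙ (E ∩ F) + s₁) + (ι c * ℙ (E ∩ ∁ F) + s₂) ≈
          ι c * ℙ E + (ι a * ℙ (E ∩ F) + s)
        split-term {E} {F} mE mF c a s s₁ s₂ s≈ = begin
          (ι (c ℕ.+ a) * ℙ (E ∩ F) + s₁) + (ι c * ℙ (E ∩ ∁ F) + s₂)
            ≈⟨ +-congʳ (+-congʳ (*-congʳ (ι-+ c a))) ⟩
          ((ι c + ι a) * ℙ (E ∩ F) + s₁) + (ι c * ℙ (E ∩ ∁ F) + s₂)
            ≈⟨ solve 6 (λ c a p q s₁ s₂ → ((c :+ a) :* p :+ s₁) :+ (c :* q :+ s₂) :=
                          c :* (p :+ q) :+ (a :* p :+ (s₁ :+ s₂))) refl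
                 (ι c) (ι a) (ℙ (E ∩ F)) (ℙ (E ∩ ∁ F)) s₁ s₂ ⟩
          ι c * (ℙ (E ∩ F) + ℙ (E ∩ ∁ F)) + (ι a * ℙ (E ∩ F) + (s₁ + s₂))
            ≈⟨ +-cong (*-congˡ (ℙ-split mE mF)) (+-congˡ s≈) ⟨
          ι c * ℙ E + (ι a * ℙ (E ∩ F) + s) ∎
          where open import Relation.Binary.Reasoning.Setoid setoid

        ∑ʳ-split : ∀ {K : Set} (ks : List K) (u : K → ℕ) (C : K → Event) (mC : ∀ k → Measurable (C k))
          {E F : Event} → Measurable E → Measurable F →
          ∑ʳ ks (λ k → ι (u k) * ℙ (E ∩ C k)) ≈
          ∑ʳ ks (λ k → ι (u k) * ℙ ((E ∩ F) ∩ C k)) + ∑ʳ ks (λ k → ι (u k) * ℙ ((E ∩ ∁ F) ∩ C k))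
        ∑ʳ-split []       u C mC         mE mF = sym (+-identityˡ 0#)
        ∑ʳ-split (k ∷ ks) u C mC {E} {F} mE mF = begin
          ι (u k) * ℙ (E ∩ C k) + ∑ʳ ks (λ k → ι (u k) * ℙ (E ∩ C k))
            ≈⟨ +-cong (*-congˡ (trans (ℙ-split mE∩C mF) (+-cong
                 (ℙ-≐ (measurable-∩ mE∩C mF) ((λ ((e , c) , f) → (e , f) , c) , (λ ((e , f) , c) → (e , c) , f)))
                 (ℙ-≐ (measurable-∩ mE∩C (measurable-∁ mF)) ((λ ((e , c) , f) → (e , f) , c) , (λ ((e , f) , c) → (e , c) , f))))))
                 (∑ʳ-split ks u C mC mE mF) ⟩
          ι (u k) * (ℙ ((E ∩ F) ∩ C k) + ℙ ((E ∩ ∁ F) ∩ C k)) + (s₁ + s₂)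
            ≈⟨ solve 5 (λ u p q s₁ s₂ → u :* (p :+ q) :+ (s₁ :+ s₂) := (u :* p :+ s₁) :+ (u :* q :+ s₂))
                 refl (ι (u k)) (ℙ ((E ∩ F) ∩ C k)) (ℙ ((E ∩ ∁ F) ∩ C k)) s₁ s₂ ⟩
          (ι (u k) * ℙ ((E ∩ F) ∩ C k) + s₁) + (ι (u k) * ℙ ((E ∩ ∁ F) ∩ C k) + s₂) ∎
          where
          open import Relation.Binary.Reasoning.Setoid setoid
          mE∩C : Measurable (E ∩ C k)
          mE∩C = measurable-∩ mE (mC k)
          s₁ s₂ : Carrier
          s₁ = ∑ʳ ks (λ k → ι (u k) * ℙ ((E ∩ F) ∩ C k))
          s₂ = ∑ʳ ks (λ k → ι (u k) * ℙ ((E ∩ ∁ F) ∩ C k))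

      -- Indicator combinations ordered pointwise have ordered integrals. `E` is split along one
      -- event after another, and `c` and `d` collect the coefficients of the events known to hold
      -- on the current piece. Once both lists are exhausted, either a point of the piece witnesses
      -- c ≤ d, or the piece is empty and has probability 0.
      Dominated⇒≤ : ∀ is js {E : Event} → Measurable E → ∀ c d → Dominated E c is d js →
        ι c * ℙ E + ∑ʳ is (λ i → ι (v i) * ℙ (E ∩ A i)) ≤
        ι d * ℙ E + ∑ʳ js (λ j → ι (w j) * ℙ (E ∩ B j))
      Dominated⇒≤ [] [] {E} mE c d dom = +-monoˡ-≤ 0# bound
        where
        bound : ι c * ℙ E ≤ ι d * ℙ E
        bound with decide {∃[ ω ] E ω}
        ... | yes (ω , e) = *-monoʳ-≤ (ℙ-nonNeg mE) (ι-mono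
                (≡.subst₂ ℕ._≤_ (ℕₚ.+-identityʳ c) (ℕₚ.+-identityʳ d) (dom ω e)))
        ... | no none = ≤-reflexive (trans (null c) (sym (null d)))
          where
          null : ∀ c → ι c * ℙ E ≈ 0#
          null c = trans (*-congˡ (trans (ℙ-≐ mE ((λ {ω} e → none (ω , e)) , λ ())) ℙ-∅)) (zeroʳ _)
      Dominated⇒≤ [] (j ∷ js) {E} mE c d dom = begin
        ι c * ℙ E + 0#
          ≈⟨ trans (+-identityʳ _) (trans (*-congˡ (ℙ-split mE (mB j))) (trans (distribˡ _ _ _)
               (+-cong (sym (+-identityʳ _)) (sym (+-identityʳ _))))) ⟩
        (ι c * ℙ (E ∩ B j) + 0#) + (ι c * ℙ (E ∩ ∁ (B j)) + 0#)
          ≤⟨ +-mono-≤ (Dominated⇒≤ [] js (measurable-∩ mE (mB j)) c (d ℕ.+ w j) inside)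
                      (Dominated⇒≤ [] js (measurable-∩ mE (measurable-∁ (mB j))) c d outside) ⟩
        _ ≈⟨ split-term mE (mB j) d (w j) _ _ _ (∑ʳ-split js w B mB mE (mB j)) ⟩
        ι d * ℙ E + (ι (w j) * ℙ (E ∩ B j) + ∑ʳ js (λ j → ι (w j) * ℙ (E ∩ B j))) ∎
        where
        open ≤-Reasoning
        inside : Dominated (E ∩ B j) c [] (d ℕ.+ w j) js
        inside ω (e , b) with dom ω e
        ... | le with decide {B j ω}
        ...   | yes _ = ℕₚ.≤-trans le (ℕₚ.≤-reflexive (counted d (w j) _))
        ...   | no ¬b = contradiction b ¬b
        outside : Dominated (E ∩ ∁ (B j)) c [] d js
        outside ω (e , ¬b) with dom ω e
        ... | le with decide {B j ω}
        ...   | yes b = contradiction b ¬b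
        ...   | no _  = ℕₚ.≤-trans le (ℕₚ.≤-reflexive (dropped d (w j) _))
      Dominated⇒≤ (i ∷ is) js {E} mE c d dom = begin
        ι c * ℙ E + (ι (v i) * ℙ (E ∩ A i) + ∑ʳ is (λ i → ι (v i) * ℙ (E ∩ A i)))
          ≈⟨ split-term mE (mA i) c (v i) _ _ _ (∑ʳ-split is v A mA mE (mA i)) ⟨
        _ ≤⟨ +-mono-≤ (Dominated⇒≤ is js (measurable-∩ mE (mA i)) (c ℕ.+ v i) d inside)
                      (Dominated⇒≤ is js (measurable-∩ mE (measurable-∁ (mA i))) c d outside) ⟩
        (ι d * ℙ (E ∩ A i) + s₁) + (ι d * ℙ (E ∩ ∁ (A i)) + s₂)
          ≈⟨ solve 5 (λ d p q s₁ s₂ → (d :* p :+ s₁) :+ (d :* q :+ s₂) := d :* (p :+ q) :+ (s₁ :+ s₂))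
               refl (ι d) (ℙ (E ∩ A i)) (ℙ (E ∩ ∁ (A i))) s₁ s₂ ⟩
        ι d * (ℙ (E ∩ A i) + ℙ (E ∩ ∁ (A i))) + (s₁ + s₂)
          ≈⟨ +-cong (*-congˡ (ℙ-split mE (mA i))) (∑ʳ-split js w B mB mE (mA i)) ⟨
        ι d * ℙ E + ∑ʳ js (λ j → ι (w j) * ℙ (E ∩ B j)) ∎
        where
        open ≤-Reasoning
        s₁ s₂ : Carrier
        s₁ = ∑ʳ js (λ j → ι (w j) * ℙ ((E ∩ A i) ∩ B j))
        s₂ = ∑ʳ js (λ j → ι (w j) * ℙ ((E ∩ ∁ (A i)) ∩ B j))
        inside : Dominated (E ∩ A i) (c ℕ.+ v i) is d js
        inside ω (e , a) with dom ω e
        ... | le with decide {A i ω}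
        ...   | yes _ = ℕₚ.≤-trans (ℕₚ.≤-reflexive (≡.sym (counted c (v i) _))) le
        ...   | no ¬a = contradiction a ¬a
        outside : Dominated (E ∩ ∁ (A i)) c is d js
        outside ω (e , ¬a) with dom ω e
        ... | le with decide {A i ω}
        ...   | yes a = contradiction a ¬a
        ...   | no _  = ℕₚ.≤-trans (ℕₚ.≤-reflexive (≡.sym (dropped c (v i) _))) le

-- Truncated expectations and the Lebesgue integral.

module Expectation (em : ExcludedMiddle (lsuc 0ℓ)) (ℝ : CompleteOrderedField) where
  open OrderedField em ℝ
  open Sums
  open Gadget using (indicator)
  open Ultrametric em ℝ using (module Truncation)
  open Probability em ℝ

  module _ {Ω : Set} (law : ProbabilityMeasure Ω) where
    open ProbabilityMeasure law

    -- The expectation of Truncation.floor M ∘ X, by its tail formula.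
    mean : ℕ → (Ω → Carrier) → Carrier
    mean M X = ∑ʳ (List.allFin M) λ i → ℙ (λ ω → ι (suc (toℕ i)) ≤ X ω)

    mean-cong : ∀ M {X Y : Ω → Carrier} → RandomVariable X → (∀ ω → X ω ≡ Y ω) → mean M X ≈ mean M Y
    mean-cong M mX eq = ∑ʳ-cong (List.allFin M) λ i → ℙ-≐ (mX _)
      ((λ {ω} → ≡.subst (ι (suc (toℕ i)) ≤_) (eq ω)) , (λ {ω} → ≡.subst (ι (suc (toℕ i)) ≤_) (≡.sym (eq ω))))

    ι≤mean : ∀ M {X : Ω → Carrier} → (∀ ω → ι M ≤ X ω) → ι M ≤ mean M X
    ι≤mean M {X} le = ≤-reflexive (trans (sym (count M)) (∑ʳ-cong (List.allFin M) λ i →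
      trans (sym ℙ-U) (ℙ-≐ measurable-U
        ((λ {ω} _ → ≤-trans (ι-mono (Finₚ.toℕ<n i)) (le ω)) , (λ _ → tt)))))
      where
      count : ∀ n → ∑ʳ (List.allFin n) (λ _ → 1#) ≈ ι n
      count zero    = refl
      count (suc n) = +-congˡ (trans
        (reflexive (≡.cong (λ xs → ∑ʳ xs (λ _ → 1#)) (≡.sym (Listₚ.map-tabulate {n = n} id Fin.suc))))
        (trans (∑ʳ-map Fin.suc (List.allFin n) (λ _ → 1#)) (count n)))

    -- `floor` is a sum of indicators of tail events, so the pointwise hypothesis is an instance of
    -- `Dominated` on the whole space, with `c` as the initial constant.
    mean-dominated : ∀ M {K : Set} (ks : List K) (w : K → ℕ) (X : K → Ω → Carrier) (Y : Ω → Carrier) a c →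
      (∀ k → RandomVariable (X k)) → RandomVariable Y →
      (∀ ω → a ℕ.* Truncation.floor M (Y ω) ℕ.+ c ℕ.≤ ∑ ks (λ k → w k ℕ.* Truncation.floor M (X k ω))) →
      ι a * mean M Y + ι c ≤ ∑ʳ ks (λ k → ι (w k) * mean M (X k))
    mean-dominated M {K} ks w X Y a c mX mY dom = begin
      ι a * mean M Y + ι c
        ≈⟨ +-comm _ _ ⟩
      ι c + ι a * mean M Y
        ≈⟨ +-cong (sym (trans (*-congˡ ℙ-U) (*-identityʳ _)))
             (trans (sym (∑ʳ-*ˡ (List.allFin M) (ι a) _))
                    (∑ʳ-cong (List.allFin M) λ i → *-congˡ (sym (ℙ-U∩ (mY _))))) ⟩
      ι c * ℙ U + ∑ʳ (List.allFin M) (λ i → ι a * ℙ (U ∩ B i))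
        ≤⟨ Dominated⇒≤ law (λ _ → a) B (w ∘ proj₁) A (λ i → mY _) (λ { (k , i) → mX k _ })
             (List.allFin M) pairs measurable-U c 0 dominated ⟩
      0# * ℙ U + ∑ʳ pairs (λ p → ι (w (proj₁ p)) * ℙ (U ∩ A p))
        ≈⟨ trans (+-congʳ (zeroˡ _)) (+-identityˡ _) ⟩
      ∑ʳ pairs (λ p → ι (w (proj₁ p)) * ℙ (U ∩ A p))
        ≈⟨ ∑ʳ-cartesianProduct ks (List.allFin M) _ ⟩
      ∑ʳ ks (λ k → ∑ʳ (List.allFin M) (λ i → ι (w k) * ℙ (U ∩ A (k , i))))
        ≈⟨ (∑ʳ-cong ks λ k → trans
             (∑ʳ-cong (List.allFin M) λ i → *-congˡ (ℙ-U∩ (mX k _)))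
             (∑ʳ-*ˡ (List.allFin M) (ι (w k)) _)) ⟩
      ∑ʳ ks (λ k → ι (w k) * mean M (X k)) ∎
      where
      open ≤-Reasoning
      pairs : List (K × Fin M)
      pairs = List.cartesianProduct ks (List.allFin M)
      A : K × Fin M → Pred Ω 0ℓ
      A (k , i) ω = ι (suc (toℕ i)) ≤ X k ω
      B : Fin M → Pred Ω 0ℓ
      B i ω = ι (suc (toℕ i)) ≤ Y ω
      ℙ-U∩ : ∀ {A} → Measurable A → ℙ (U ∩ A) ≈ ℙ A
      ℙ-U∩ mA = sym (ℙ-≐ mA ((λ a → tt , a) , proj₂))
      dominated : Dominated law (λ _ → a) B (w ∘ proj₁) A (λ i → mY _) (λ { (k , i) → mX k _ })
        U c (List.allFin M) 0 pairs
      dominated ω _ = ℕₚ.≤-trans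
        (ℕₚ.≤-reflexive (≡.trans (≡.cong (c ℕ.+_) (∑-*ˡ (List.allFin M) a _)) (ℕₚ.+-comm c _)))
        (ℕₚ.≤-trans (dom ω) (ℕₚ.≤-reflexive (≡.sym (≡.trans
          (Gadget.∑-cartesianProduct ks (List.allFin M) _)
          (∑-cong ks λ k → ∑-*ˡ (List.allFin M) (w k) _)))))

    -- The simple function below X that takes the value i + 1 where
    -- i + 1 ≤ X < i + 2 for i + 1 < M, and the value M where M ≤ X.
    ≤mean⇒≤𝔼 : ∀ M {X : Ω → Carrier} {y} → RandomVariable X → y ≤ mean M X → y ≤𝔼 X
    ≤mean⇒≤𝔼 M {X} {y} mX y≤ s bound = ≤-trans y≤ (≤-respˡ integral≈ (bound φ))
      where
      B : ℕ → Pred Ω 0ℓ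
      -- The condition t < M makes `B M` empty: the last layer then absorbs all values from `M` on,
      -- and the boundary term in `abel` vanishes.
      B t ω = t ℕ.< M × ι (suc t) ≤ X ω
      mB : ∀ t → Measurable (B t)
      mB t with t ℕₚ.<? M
      ... | yes t<M = measurable-≐ ((λ x → t<M , x) , proj₂) (mX (ι (suc t)))
      ... | no  t≮M = measurable-≐ ((λ ()) , λ (t<M , _) → contradiction t<M t≮M) (measurable-∅ law)
      B-antitone : ∀ {s t ω} → s ℕ.≤ t → B t ω → B s ω
      B-antitone s≤t (t<M , le) = ℕₚ.≤-<-trans s≤t t<M , ≤-trans (ι-mono (s≤s s≤t)) le
      layer : ℕ → Pred Ω 0ℓ
      layer t = B t ∩ ∁ (B (suc t))
      m-layer : ∀ t → Measurable (layer t)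
      m-layer t = measurable-∩ law (mB t) (measurable-∁ (mB (suc t)))
      layers-disjoint : ∀ {s t} → s ≢ t → layer s ⊥ layer t
      layers-disjoint {s} {t} s≢t ((b , ¬b) , (b′ , ¬b′)) with ℕₚ.≤-total s t
      ... | inj₁ s≤t = ¬b (B-antitone (ℕₚ.≤∧≢⇒< s≤t s≢t) b′)
      ... | inj₂ t≤s = ¬b′ (B-antitone (ℕₚ.≤∧≢⇒< t≤s (s≢t ∘ ≡.sym)) b)
      φ : SimpleBelow X
      φ = record
        { n          = M
        ; coeff      = λ i → ι (suc (toℕ i))
        ; event      = λ i → layer (toℕ i)
        ; nonNeg     = λ i → 0≤ι (suc (toℕ i))
        ; measurable = λ i → m-layer (toℕ i)
        ; disjoint   = λ i≢j → layers-disjoint (i≢j ∘ Finₚ.toℕ-injective)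
        ; below      = λ i ((_ , le) , _) → le
        }
      layer≈ : ∀ t → ℙ (B t) ≈ ℙ (B (suc t)) + ℙ (layer t)
      layer≈ t = trans (ℙ-split law (mB t) (mB (suc t))) (+-congʳ (ℙ-≐
        (measurable-∩ law (mB t) (mB (suc t)))
        (proj₂ , (λ b → B-antitone (ℕₚ.n≤1+n t) b , b))))
      term : ℕ → Carrier
      term t = ι (suc t) * ℙ (layer t)
      offset : ∀ s m → ∑ʳ (List.allFin (suc m)) (λ i → ℙ (B (s ℕ.+ toℕ i))) ≈
        ℙ (B s) + ∑ʳ (List.allFin m) (λ i → ℙ (B (suc s ℕ.+ toℕ i)))
      offset s m = +-cong (reflexive (≡.cong (ℙ ∘ B) (ℕₚ.+-identityʳ s)))
        (trans (reflexive (≡.cong (λ xs → ∑ʳ xs (λ i → ℙ (B (s ℕ.+ toℕ i))))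
                  (≡.sym (Listₚ.map-tabulate {n = m} id Fin.suc))))
        (trans (∑ʳ-map Fin.suc (List.allFin m) _)
          (∑ʳ-cong (List.allFin m) λ i → reflexive (≡.cong (ℙ ∘ B) (ℕₚ.+-suc s (toℕ i))))))
      sum-cong : ∀ {m} {f g : Fin m → Carrier} → (∀ i → f i ≈ g i) → sum f ≈ sum g
      sum-cong {zero}  eq = refl
      sum-cong {suc m} eq = +-cong (eq Fin.zero) (sum-cong (eq ∘ Fin.suc))
      -- Summation by parts over the layers from `s` to s + m; the start varies because the
      -- induction peels off the lowest layer.
      abel : ∀ m s → sum {m} (λ i → term (s ℕ.+ toℕ i)) + ι (s ℕ.+ m) * ℙ (B (s ℕ.+ m)) ≈
        ι s * ℙ (B s) + ∑ʳ (List.allFin m) (λ i → ℙ (B (s ℕ.+ toℕ i)))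
      abel zero s rewrite ℕₚ.+-identityʳ s = +-comm _ _
      abel (suc m) s = begin
        sum {suc m} (λ i → term (s ℕ.+ toℕ i)) + ι (s ℕ.+ suc m) * ℙ (B (s ℕ.+ suc m))
          ≈⟨ +-cong (+-cong (reflexive (≡.cong term (ℕₚ.+-identityʳ s)))
               (sum-cong {m} λ i → reflexive (≡.cong term (ℕₚ.+-suc s (toℕ i)))))
               (reflexive (≡.cong (λ t → ι t * ℙ (B t)) (ℕₚ.+-suc s m))) ⟩
        (term s + sum {m} (λ i → term (suc s ℕ.+ toℕ i))) + ι (suc s ℕ.+ m) * ℙ (B (suc s ℕ.+ m))
          ≈⟨ trans (+-assoc _ _ _) (+-congˡ (abel m (suc s))) ⟩
        (1# + ι s) * ℙ (layer s) + ((1# + ι s) * ℙ (B (suc s)) + rest)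
          ≈⟨ solve 4 (λ t p q r → (con 1 :+ t) :* p :+ ((con 1 :+ t) :* q :+ r) :=
                         t :* (q :+ p) :+ ((q :+ p) :+ r)) refl (ι s) (ℙ (layer s)) (ℙ (B (suc s))) rest ⟩
        ι s * (ℙ (B (suc s)) + ℙ (layer s)) + ((ℙ (B (suc s)) + ℙ (layer s)) + rest)
          ≈⟨ +-cong (*-congˡ (sym (layer≈ s))) (+-congʳ (sym (layer≈ s))) ⟩
        ι s * ℙ (B s) + (ℙ (B s) + rest)
          ≈⟨ +-congˡ (offset s m) ⟨
        ι s * ℙ (B s) + ∑ʳ (List.allFin (suc m)) (λ i → ℙ (B (s ℕ.+ toℕ i))) ∎
        where
        open import Relation.Binary.Reasoning.Setoid setoid
        rest : Carrier
        rest = ∑ʳ (List.allFin m) (λ i → ℙ (B (suc s ℕ.+ toℕ i)))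
      ℙB[M]≈0 : ℙ (B M) ≈ 0#
      ℙB[M]≈0 = trans (ℙ-≐ (mB M) ((λ (M<M , _) → ℕₚ.<-irrefl ≡.refl M<M) , λ ())) (ℙ-∅ law)
      integral≈ : SimpleBelow.integral φ ≈ mean M X
      integral≈ = begin
        sum {M} (λ i → term (toℕ i))
          ≈⟨ trans (+-congˡ (trans (*-congˡ ℙB[M]≈0) (zeroʳ _))) (+-identityʳ _) ⟨
        sum {M} (λ i → term (toℕ i)) + ι M * ℙ (B M)
          ≈⟨ abel M 0 ⟩
        0# * ℙ (B 0) + ∑ʳ (List.allFin M) (λ i → ℙ (B (toℕ i)))
          ≈⟨ trans (+-congʳ (zeroˡ _)) (+-identityˡ _) ⟩
        ∑ʳ (List.allFin M) (λ i → ℙ (B (toℕ i)))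
          ≈⟨ (∑ʳ-cong (List.allFin M) λ i → ℙ-≐ (mB (toℕ i)) (proj₂ , λ le → Finₚ.toℕ<n i , le)) ⟩
        mean M X ∎
        where open import Relation.Binary.Reasoning.Setoid setoid

-- The adversary: descent through the scales of the Hamming cube.

module Adversary (em : ExcludedMiddle (lsuc 0ℓ)) (ℝ : CompleteOrderedField) where
  open OrderedField em ℝ
  open Sums
  open Cube
  open Gadget
  open Ambient
  open Sequences
  open Ultrametric em ℝ
  open Expectation em ℝ

  hammingSpace : ℕ → ℕ → FiniteMetricSpace
  hammingSpace n m = record
    { size     = size n m
    ; d        = λ p q → ι (ham n m (decode n m p) (decode n m q))
    ; isMetric = record
      { isSemiMetric = record
        { isQuasiSemiMetric = record
          { isPreMetric = record
            { isProtoMetric = record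
              { isPartialOrder  = isPartialOrder
              ; ≈-isEquivalence = isEquivalence
              ; cong            = λ { ≡.refl ≡.refl → refl }
              ; nonNegative     = λ {p} {q} → 0≤ι (ham n m (decode n m p) (decode n m q))
              }
            ; ≈⇒0 = λ { {p} ≡.refl → ×-congˡ (ham-diag n m (decode n m p)) }
            }
          ; 0⇒≈ = λ {p} {q} d≈0 → ≡.trans (≡.sym (encode-decode n m p)) (≡.trans
              (≡.cong (encode n m) (ham≡0 n m _ _ (ℕₚ.n≤0⇒n≡0 (ι-cancel-≤ (≤-reflexive d≈0)))))
              (encode-decode n m q))
          }
        ; sym = λ p q → ×-congˡ (ham-sym n m (decode n m p) (decode n m q))
        }
      ; triangle = λ p q r → ≤-trans
          (ι-mono (ham-triangle n m (decode n m p) (decode n m q) (decode n m r)))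
          (≤-reflexive (ι-+ (ham n m (decode n m p) (decode n m q)) _))
      }
    }

  module _ (g m k : ℕ) (0<g : 0 ℕ.< g) where

    private
      n M : ℕ
      n = 128 ℕ.* g
      M = n ℕ.^ m

      V : FiniteMetricSpace
      V = hammingSpace n m

      Pt : Set
      Pt = Fin (size n m)

      δ : Pt → Pt → ℕ
      δ p q = ham n m (decode n m p) (decode n m q)

      0<n : 0 ℕ.< n
      0<n = ℕₚ.*-mono-< {0} {128} (s≤s z≤n) 0<g

    f-extends : ∀ (e : OnlineEmbedding V k) {σ σ′ u} → σ ⊑ σ′ → length σ′ ℕ.≤ k → u ∈ σ →
      OnlineEmbedding.f e σ′ u ≡ OnlineEmbedding.f e σ u
    f-extends e {σ} (τ , ≡.refl) len u∈ = go τ σ len u∈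
      where
      open OnlineEmbedding e
      go : ∀ τ σ {u} → length (σ ++ τ) ℕ.≤ k → u ∈ σ → f (σ ++ τ) u ≡ f σ u
      go []      σ len u∈ = ≡.cong (λ ρ → f ρ _) (Listₚ.++-identityʳ σ)
      go (x ∷ τ) σ len u∈ rewrite ≡.sym (Listₚ.++-assoc σ (x ∷ []) τ) = ≡.trans
        (go τ (σ ∷ʳ x) len (∈-++⁺ˡ u∈))
        (extends (ℕₚ.≤-trans (⊑-length {σ = σ ∷ʳ x} (τ , ≡.refl)) len) u∈)

    module _ (𝓔 : ProbabilisticOnlineEmbedding V k) where
      open ProbabilisticOnlineEmbedding 𝓔
      open Truncation M

      𝔼 : List Pt → Pt → Pt → Carrier
      𝔼 σ u v = mean law M (embeddedDist V k σ u v)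

      𝔼-extends : ∀ {σ σ′ u v} → σ ⊑ σ′ → length σ′ ℕ.≤ k → u ∈ σ → v ∈ σ → 𝔼 σ u v ≈ 𝔼 σ′ u v
      𝔼-extends ext len u∈ v∈ = mean-cong law M
        (measurable (ℕₚ.≤-trans (⊑-length ext) len) u∈ v∈)
        λ e → ≡.sym (≡.cong₂ (HST.dist (OnlineEmbedding.target e))
                (f-extends e ext len u∈) (f-extends e ext len v∈))

      -- The invariant: `ψ` places the current block isometrically, and `y` bounds from below the
      -- expected distance of its diagonal divided by the Hamming length n ^ h. Each scale adds `g`
      -- to `y` and costs at most 2 ^ n terminals. At height 0 the pair has distance 1, so its
      -- expected distance is a distortion.
      attack : ∀ h (ψ : Word n h → Pt) → (∀ x y → δ (ψ x) (ψ y) ≡ ham n h x y) →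
        ∀ σ y → Unique σ → ψ (const n h false) ∈ σ → ψ (const n h true) ∈ σ →
        length σ ℕ.+ h ℕ.* 2 ℕ.^ n ℕ.≤ k →
        ι (n ℕ.^ h ℕ.* y) ≤ 𝔼 σ (ψ (const n h false)) (ψ (const n h true)) →
        ∃[ σ′ ] ∃[ u ] ∃[ v ] Unique σ′ × length σ′ ℕ.≤ k × u ∈ σ′ × v ∈ σ′ × δ u v ≡ 1 ×
          ι (y ℕ.+ h ℕ.* g) ≤ 𝔼 σ′ u v
      attack zero ψ iso σ y uniq s∈ t∈ len le =
        σ , ψ false , ψ true , uniq , ≡.subst (ℕ._≤ k) (ℕₚ.+-identityʳ _) len , s∈ , t∈ , iso false true ,
        ≤-respˡ (×-congˡ (≡.trans (ℕₚ.+-identityʳ y) (≡.sym (ℕₚ.+-identityʳ y)))) le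
      attack (suc h) ψ iso σ y uniq s∈ t∈ len le = step (absorb revealed σ uniq)
        where
        L : ℕ
        L = n ℕ.^ h

        corner : Vec Bool n → Pt
        corner x = ψ (blocks n h x)

        revealed : List Pt
        revealed = List.map corner (cube n)

        length-revealed : length revealed ≡ 2 ℕ.^ n
        length-revealed = ≡.trans (Listₚ.length-map corner (cube n)) (length-cube n)

        δ-corner : ∀ x y → δ (corner x) (corner y) ≡ L ℕ.* hamming x y
        δ-corner x y = ≡.trans (iso _ _) (ham-blocks n h x y)

        corner-replicate : ∀ b → corner (Vec.replicate n b) ≡ ψ (const n (suc h) b)
        corner-replicate b = ≡.cong ψ (blocks-replicate n h b)

        step : ∃[ σ′ ] σ ⊑ σ′ × Unique σ′ × (∀ {x} → x ∈ revealed → x ∈ σ′) ×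
                 length σ′ ℕ.≤ length σ ℕ.+ length revealed →
          ∃[ σ′ ] ∃[ u ] ∃[ v ] Unique σ′ × length σ′ ℕ.≤ k × u ∈ σ′ × v ∈ σ′ × δ u v ≡ 1 ×
            ι (y ℕ.+ suc h ℕ.* g) ≤ 𝔼 σ′ u v
        step (σ′ , ext , uniq′ , sub , len₀) =
          -- The choice compares expectations only, so the edge depends on the distribution but not
          -- on the realised embedding.
          let e , _ , gained = weighted-average (edges n) weight
                (λ e → 𝔼 σ′ (corner (lowerEnd e)) (corner (upperEnd e))) (ι (L ℕ.* (y ℕ.+ g)))
                0<∑weight average
              σ″ , u , v , uniq″ , len″ , u∈ , v∈ , δ≡1 , final = attack h (ψ ∘ insert n h e)
                (λ x y → ≡.trans (iso _ _) (ham-insert n h e x y)) σ′ (y ℕ.+ g) uniq′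
                (≡.subst (_∈ σ′) (lower≡ e) (corner∈ _)) (≡.subst (_∈ σ′) (upper≡ e) (corner∈ _))
                len‴ (≤-respʳ (reflexive (≡.cong₂ (𝔼 σ′) (lower≡ e) (upper≡ e))) gained)
          in σ″ , u , v , uniq″ , len″ , u∈ , v∈ , δ≡1 ,
             ≤-respˡ (×-congˡ (ℕₚ.+-assoc y g (h ℕ.* g))) final
          where
          lower≡ : ∀ e → corner (lowerEnd e) ≡ ψ (insert n h e (const n h false))
          lower≡ e = ≡.cong ψ (≡.sym (insert-lowerEnd n h e))

          upper≡ : ∀ e → corner (upperEnd e) ≡ ψ (insert n h e (const n h true))
          upper≡ e = ≡.cong ψ (≡.sym (insert-upperEnd n h e))

          corner∈ : ∀ x → corner x ∈ σ′
          corner∈ x = sub (∈-map⁺ corner (∈-cube x))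

          len‴ : length σ′ ℕ.+ h ℕ.* 2 ℕ.^ n ℕ.≤ k
          len‴ = ℕₚ.≤-trans (ℕₚ.+-monoˡ-≤ (h ℕ.* 2 ℕ.^ n) len₀) (ℕₚ.≤-trans (ℕₚ.≤-reflexive
            (≡.trans (≡.cong (λ l → length σ ℕ.+ l ℕ.+ h ℕ.* 2 ℕ.^ n) length-revealed)
                     (ℕₚ.+-assoc (length σ) _ _))) len)

          len′ : length σ′ ℕ.≤ k
          len′ = ℕₚ.≤-trans (ℕₚ.m≤m+n _ _) len‴

          rv : ∀ x y → RandomVariable (embeddedDist V k σ′ (corner x) (corner y))
          rv x y = measurable len′ (corner∈ x) (corner∈ y)

          module _ (e : OnlineEmbedding V k) where
            open OnlineEmbedding e

            Z : Vec Bool n → Vec Bool n → ℕ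
            Z x y = floor (embeddedDist V k σ′ (corner x) (corner y) e)

            L*hamming≤Z : ∀ x y → L ℕ.* hamming x y ℕ.≤ Z x y
            -- The cap `M` is the diameter of the whole cube, so truncation cannot spoil the
            -- domination of the Hamming metric.
            L*hamming≤Z x y = floor-≥
              (≡.subst (ℕ._≤ M) (δ-corner x y) (ham-≤ n m _ _))
              (≤-respˡ (×-congˡ (δ-corner x y)) (nonContractive len′ (corner∈ x) (corner∈ y)))

            pointwise : n ! ℕ.* Z bot top ℕ.+ n ! ℕ.* (n ℕ.* (g ℕ.* L)) ℕ.≤
              ∑ (edges n) (λ e → weight e ℕ.* Z (lowerEnd e) (upperEnd e))
            pointwise = ℕₚ.≤-trans
              (ℕₚ.≤-reflexive (≡.sym (ℕₚ.*-distribˡ-+ (n !) (Z bot top) (n ℕ.* (g ℕ.* L)))))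
              (gadget g L 0<g (ℕₚ.m^n>0 n ⦃ ℕ.>-nonZero 0<n ⦄ h) Z
                (λ x → ≡.trans (≡.cong floor (dist-diag target _)) floor-zero)
                (λ x y → ≡.cong floor (dist-sym target _ _))
                (λ x y z → floor-ultra (dist-ultra target _ _ _))
                L*hamming≤Z)

          0<∑weight : 0 ℕ.< ∑ (edges n) weight
          0<∑weight = ≡.subst (0 ℕ.<_) (≡.sym (∑-weight {n})) (ℕₚ.*-mono-< (ℕₚ.1≤n! n) 0<n)

          -- The total weight n ! * n turns L * y into n ! times the bound n * L * y already known
          -- for the diagonal, and L * g into exactly the gain of `gadget`.
          average : ι (∑ (edges n) weight) * ι (L ℕ.* (y ℕ.+ g)) ≤
            ∑ʳ (edges n) (λ e → ι (weight e) * 𝔼 σ′ (corner (lowerEnd e)) (corner (upperEnd e)))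
          average = begin
            ι (∑ (edges n) weight) * ι (L ℕ.* (y ℕ.+ g))
              ≈⟨ *-congʳ (×-congˡ (∑-weight {n})) ⟩
            ι (n ! ℕ.* n) * ι (L ℕ.* (y ℕ.+ g))
              ≈⟨ ι-* (n ! ℕ.* n) (L ℕ.* (y ℕ.+ g)) ⟨
            ι (n ! ℕ.* n ℕ.* (L ℕ.* (y ℕ.+ g)))
              ≈⟨ ×-congˡ (arrange (n !) n L y g) ⟩
            ι (n ! ℕ.* (n ℕ.* L ℕ.* y) ℕ.+ n ! ℕ.* (n ℕ.* (g ℕ.* L)))
              ≈⟨ trans (ι-+ (n ! ℕ.* (n ℕ.* L ℕ.* y)) _) (+-congʳ (ι-* (n !) (n ℕ.* L ℕ.* y))) ⟩
            ι (n !) * ι (n ℕ.* L ℕ.* y) + ι (n ! ℕ.* (n ℕ.* (g ℕ.* L)))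
              ≤⟨ +-monoˡ-≤ _ (*-monoˡ-≤ (0≤ι (n !)) le) ⟩
            ι (n !) * 𝔼 σ (ψ (const n (suc h) false)) (ψ (const n (suc h) true))
              + ι (n ! ℕ.* (n ℕ.* (g ℕ.* L)))
              ≈⟨ +-congʳ (*-congˡ (trans (𝔼-extends ext len′ s∈ t∈)
                   (reflexive (≡.cong₂ (𝔼 σ′) (≡.sym (corner-replicate false)) (≡.sym (corner-replicate true)))))) ⟩
            ι (n !) * 𝔼 σ′ (corner bot) (corner top) + ι (n ! ℕ.* (n ℕ.* (g ℕ.* L)))
              ≤⟨ mean-dominated law M (edges n) weight
                   (λ e → embeddedDist V k σ′ (corner (lowerEnd e)) (corner (upperEnd e)))
                   (embeddedDist V k σ′ (corner bot) (corner top))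
                   (n !) (n ! ℕ.* (n ℕ.* (g ℕ.* L)))
                   (λ e → rv _ _) (rv _ _) pointwise ⟩
            ∑ʳ (edges n) (λ e → ι (weight e) * 𝔼 σ′ (corner (lowerEnd e)) (corner (upperEnd e))) ∎
            where
            open ≤-Reasoning
            arrange : ∀ f n L y g → f ℕ.* n ℕ.* (L ℕ.* (y ℕ.+ g)) ≡
              f ℕ.* (n ℕ.* L ℕ.* y) ℕ.+ f ℕ.* (n ℕ.* (g ℕ.* L))
            arrange = solve-∀

      lower-bound : 2 ℕ.+ m ℕ.* 2 ℕ.^ n ℕ.≤ k → k ℕ.≤ size n m →
        Σ[ σ ∈ List Pt ] length σ ≡ k × Unique σ ×
          (∀ {D} → D ≤ ι (m ℕ.* g) → ExpectedDistortionAtLeast V k 𝓔 σ D)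
      lower-bound budget k≤size = conclude (attack m (encode n m)
          (λ x y → ≡.cong₂ (ham n m) (decode-encode n m x) (decode-encode n m y))
          -- The antipodal pair starts with y = 1: non-contraction alone keeps its truncated mean at
          -- `M` or above.
          (s ∷ t ∷ []) 1 ((s≢t ∷ []) ∷ [] ∷ []) (here ≡.refl) (there (here ≡.refl)) budget
          (≤-respˡ (×-congˡ (≡.sym (ℕₚ.*-identityʳ M)))
            (ι≤mean law M λ e → ≤-respˡ (×-congˡ δ-st) (OnlineEmbedding.nonContractive e
              (ℕₚ.≤-trans (ℕₚ.m≤m+n 2 _) budget) (here ≡.refl) (there (here ≡.refl))))))
        where
        s t : Pt
        s = encode n m (const n m false)
        t = encode n m (const n m true)
        δ-st : δ s t ≡ M
        δ-st = ≡.trans (≡.cong₂ (ham n m) (decode-encode n m _) (decode-encode n m _))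
          (≡.trans (ham-const n m false true) (ℕₚ.*-identityʳ M))
        δ-diag : ∀ p → δ p p ≡ 0
        δ-diag p = ham-diag n m (decode n m p)
        s≢t : s ≢ t
        s≢t s≡t = ℕₚ.<⇒≢ (ℕₚ.m^n>0 n ⦃ ℕ.>-nonZero 0<n ⦄ m)
          (≡.trans (≡.sym (δ-diag s)) (≡.trans (≡.cong (δ s) s≡t) δ-st))
        conclude : (∃[ σ ] ∃[ u ] ∃[ v ] Unique σ × length σ ℕ.≤ k × u ∈ σ × v ∈ σ × δ u v ≡ 1 ×
            ι (1 ℕ.+ m ℕ.* g) ≤ 𝔼 σ u v) →
          Σ[ σ ∈ List Pt ] length σ ≡ k × Unique σ ×
            (∀ {D} → D ≤ ι (m ℕ.* g) → ExpectedDistortionAtLeast V k 𝓔 σ D)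
        conclude (σ , u , v , uniq , len , u∈ , v∈ , δ≡1 , le) =
          let σ′ , ext , uniq′ , len′ = pad (k ℕ.∸ length σ) σ uniq (ℕₚ.m+[n∸m]≡n len) k≤size
              len″ = ℕₚ.≤-reflexive len′ in
          σ′ , len′ , uniq′ , λ {D} D≤ →
            u , v , ⊑-∈ ext u∈ , ⊑-∈ ext v∈ , u≢v ,
            ≤mean⇒≤𝔼 law M (measurable len″ (⊑-∈ ext u∈) (⊑-∈ ext v∈)) (begin
              D * ι (δ u v)          ≈⟨ *-congˡ (trans (×-congˡ δ≡1) ι-1) ⟩
              D * 1#                 ≈⟨ *-identityʳ D ⟩
              D                      ≤⟨ D≤ ⟩
              ι (m ℕ.* g)            ≤⟨ ι-mono (ℕₚ.n≤1+n (m ℕ.* g)) ⟩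
              ι (1 ℕ.+ m ℕ.* g)      ≤⟨ le ⟩
              𝔼 σ u v                ≈⟨ 𝔼-extends ext len″ u∈ v∈ ⟩
              𝔼 σ′ u v ∎)
          where
          open ≤-Reasoning
          u≢v : u ≢ v
          u≢v u≡v with () ← ≡.trans (≡.sym δ≡1) (≡.trans (≡.cong (δ u) (≡.sym u≡v)) (δ-diag u))

-- Logarithms, real powers and the aspect ratio of the cube.

module Analysis (em : ExcludedMiddle (lsuc 0ℓ)) (ℝ : CompleteOrderedField) where
  open OrderedField em ℝ
  open Ambient
  open Cube using (bot)
  open Adversary em ℝ

  2^-cancel-≤ : ∀ {p q} → 2 ℕ.^ p ℕ.≤ 2 ℕ.^ q → p ℕ.≤ q
  2^-cancel-≤ le = ℕₚ.≮⇒≥ λ q<p → ℕₚ.<⇒≱ (ℕₚ.^-monoʳ-< 2 (s≤s (s≤s z≤n)) q<p) le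

  -- The supremum is attained by the fraction p / 1; for any other admissible p′ / q, comparing
  -- powers of two gives p′ ≤ p * q.
  log₂-2^ : ∀ {x} p → x ≈ ι (2 ℕ.^ p) → log₂ x ≈ ι p
  log₂-2^ {x} p x≈ = sup≈max
    (p , 1 , s≤s z≤n , trans (*-congʳ ι-1) (*-identityˡ _) ,
      ≤-reflexive (trans (sym (ι-^ 2 p)) (trans (sym x≈) (sym (*-identityʳ x)))))
    λ { {r} (p′ , q , 0<q , qr≈p′ , le) → *-cancelˡ-≤ (ι-pos 0<q) (begin
      ι q * r       ≈⟨ qr≈p′ ⟩
      ι p′          ≤⟨ ι-mono (2^-cancel-≤ {p′} {p ℕ.* q} (ι-cancel-≤ {2 ℕ.^ p′} {2 ℕ.^ (p ℕ.* q)} (begin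
        ι (2 ℕ.^ p′)            ≈⟨ ι-^ 2 p′ ⟩
        ι 2 ^ p′                ≤⟨ le ⟩
        x ^ q                   ≈⟨ ^-congˡ q x≈ ⟩
        ι (2 ℕ.^ p) ^ q         ≈⟨ ι-^ (2 ℕ.^ p) q ⟨
        ι ((2 ℕ.^ p) ℕ.^ q)     ≈⟨ ×-congˡ (ℕₚ.^-*-assoc 2 p q) ⟩
        ι (2 ℕ.^ (p ℕ.* q)) ∎))) ⟩
      ι (p ℕ.* q)   ≈⟨ ×-congˡ (ℕₚ.*-comm p q) ⟩
      ι (q ℕ.* p)   ≈⟨ ι-* q p ⟩
      ι q * ι p ∎) }
    where open ≤-Reasoning

  -- Real powers occur only on the smaller side of `Φ-large`, so upper bounds on rational powers
  -- suffice. Nonnegativity is recorded because the inner power there is the exponent of the outer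
  -- one.
  ^ʳ-bounds : ∀ {x y B} → 0# ≤ y → 0# ≤ B →
    (∀ p q → 0 ℕ.< q → ι p ≤ ι q * y → x ^ p ≤ B ^ q) → 0# ≤ x ^ʳ y × x ^ʳ y ≤ B
  ^ʳ-bounds {x} {y} {B} 0≤y 0≤B le = IsSup.upper isSup zero∈ , IsSup.least isSup bound
    where
    P : Carrier → Set
    P z = 0# ≤ z × ∃[ p ] ∃[ q ] 0 ℕ.< q × ι p ≤ ι q * y × z ^ q ≤ x ^ p
    zero∈ : P 0#
    zero∈ = ≤-refl , 0 , 1 , s≤s z≤n , *-nonNeg (0≤ι 1) 0≤y , ≤-respˡ (sym (zeroˡ 1#)) 0≤1
    bound : UpperBound _≤_ P B
    bound (_ , p , q , 0<q , p≤qy , z^q≤) = ^-cancel-≤ q 0<q 0≤B (≤-trans z^q≤ (le p q 0<q p≤qy))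
    isSup : IsSup _≤_ P (x ^ʳ y)
    isSup = sup-isSup (0# , zero∈) (B , bound)

  module _ (n m : ℕ) (i : Fin n) where
    open FiniteMetricSpace (hammingSpace n m)

    private
      M : ℕ
      M = n ℕ.^ m

      0<n : ∀ {n} → Fin n → 0 ℕ.< n
      0<n {suc _} _ = s≤s z≤n

      d-encode : ∀ x y {k} → ham n m x y ≡ k → d (encode n m x) (encode n m y) ≈ ι k
      d-encode x y eq = ×-congˡ (≡.trans (≡.cong₂ (ham n m) (decode-encode n m x) (decode-encode n m y)) eq)

      d>0⇒≢ : ∀ {x y k} → 0 ℕ.< k → d x y ≈ ι k → x ≢ y
      d>0⇒≢ {x} 0<k d≈ ≡.refl = ℕₚ.<⇒≱ 0<k (ι-cancel-≤ {_} {0} (≤-reflexive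
        (trans (sym d≈) (×-congˡ (ham-diag n m (decode n m x))))))

      -- Following the `i`-th block at every level leads to a single coordinate; the two words
      -- differ there only and realise the minimum distance.
      unit : ∀ h → Bool → Word n h
      unit zero    b = b
      unit (suc h) b = insert n h (i , bot) (unit h b)

      ham-unit : ∀ h → ham n h (unit h false) (unit h true) ≡ 1
      ham-unit zero    = ≡.refl
      ham-unit (suc h) = ≡.trans (ham-insert n h (i , bot) _ _) (ham-unit h)

    maxDistance≈ : maxDistance ≈ ι M
    maxDistance≈ = sup≈max
      (_ , _ , d>0⇒≢ (ℕₚ.m^n>0 n ⦃ ℕ.>-nonZero (0<n i) ⦄ m) far , sym far)
      λ { (x , y , _ , r≈) → ≤-respˡ (sym r≈) (ι-mono (ham-≤ n m (decode n m x) (decode n m y))) }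
      where
      far : d (encode n m (const n m false)) (encode n m (const n m true)) ≈ ι M
      far = d-encode _ _ (≡.trans (ham-const n m false true) (ℕₚ.*-identityʳ M))

    minDistance≈ : minDistance ≈ 1#
    minDistance≈ = trans (-‿cong (sup≈max
      (_ , _ , d>0⇒≢ {k = 1} (s≤s z≤n) near , trans (-‿involutive 1#) (trans (sym ι-1) (sym near)))
      λ { {r} (x , y , x≢y , -r≈) → neg-cancel-≤ (≤-respˡ (sym (-‿involutive 1#)) (≤-respʳ (sym -r≈)
            (≤-respˡ ι-1 (ι-mono (separated x y x≢y))))) }))
      (-‿involutive 1#)
      where
      near : d (encode n m (unit m false)) (encode n m (unit m true)) ≈ ι 1
      near = d-encode _ _ (ham-unit m)
      separated : ∀ x y → x ≢ y → 1 ℕ.≤ ham n m (decode n m x) (decode n m y)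
      separated x y x≢y = ℕₚ.n≢0⇒n>0 λ eq → x≢y (≡.trans (≡.sym (encode-decode n m x))
        (≡.trans (≡.cong (encode n m) (ham≡0 n m _ _ eq)) (encode-decode n m y)))

    aspectRatio≈ : aspectRatio ≈ ι M
    aspectRatio≈ = trans (*-cong maxDistance≈ (trans
      (sym (⁻¹-cong 0<1 (sym minDistance≈))) (trans (sym (*-identityˡ _)) (inverseʳ 0<1)))) (*-identityʳ _)

-- Choice of the parameters as powers of two.

module Parameters (b₀ : ℕ) where
  open import Data.Nat.Base using (_+_; _*_; _^_; _≤_; _<_)

  -- With b₀ * δ ≥ 1 also a * δ ≥ 1, so k ^ (1 - δ) ≤ 2 ^ (a′ * n) = 2 * m.
  -- Taking a and n = 2 ^ e to be powers of two makes every logarithm of the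
  -- theorem an integer.
  b a a′ : ℕ
  b  = suc b₀
  a  = 2 ^ b
  a′ = pred a

  module _ (ℓ : ℕ) where

    g n e m k : ℕ
    g = 2 ^ ℓ
    n = 128 * g
    e = 7 + ℓ
    m = 2 ^ pred (a′ * n)
    k = 2 ^ (a * n)

  suc-pred-pos : ∀ {n} → 0 < n → suc (pred n) ≡ n
  suc-pred-pos {suc n} _ = ≡.refl

  n<2^n : ∀ n → n < 2 ^ n
  n<2^n zero    = s≤s z≤n
  n<2^n (suc n) = ℕₚ.≤-trans (s≤s (n<2^n n))
    (ℕₚ.≤-trans (ℕₚ.+-monoˡ-≤ (2 ^ n) (ℕₚ.m^n>0 2 n)) (ℕₚ.≤-reflexive (≡.cong (2 ^ n +_) (≡.sym (ℕₚ.+-identityʳ _)))))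

  a≡ : a ≡ suc a′
  a≡ = ≡.sym (suc-pred-pos (ℕₚ.m^n>0 2 b))

  b≤a′ : b ≤ a′
  b≤a′ = ℕₚ.≤-pred (≡.subst (suc b ≤_) a≡ (n<2^n b))

  module _ (ℓ : ℕ) where

    0<g : 0 < g ℓ
    0<g = ℕₚ.m^n>0 2 ℓ

    128≤n : 128 ≤ n ℓ
    128≤n = ℕₚ.m≤m*n 128 (g ℓ) ⦃ ℕ.>-nonZero 0<g ⦄

    0<n : 0 < n ℓ
    0<n = ℕₚ.≤-trans (s≤s z≤n) 128≤n

    0<a′n : 0 < a′ * n ℓ
    0<a′n = ℕₚ.*-mono-< (ℕₚ.≤-trans (s≤s z≤n) b≤a′) 0<n

    n≡2^e : n ℓ ≡ 2 ^ e ℓ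
    n≡2^e = ≡.sym (ℕₚ.^-distribˡ-+-* 2 7 ℓ)

    a*n≡ : a * n ℓ ≡ 2 ^ (b + e ℓ)
    a*n≡ = ≡.trans (≡.cong (a *_) n≡2^e) (≡.sym (ℕₚ.^-distribˡ-+-* 2 b (e ℓ)))

    n^m≡ : n ℓ ^ m ℓ ≡ 2 ^ (e ℓ * m ℓ)
    n^m≡ = ≡.trans (≡.cong (_^ m ℓ) n≡2^e) (ℕₚ.^-*-assoc 2 (e ℓ) (m ℓ))

    2m≡ : 2 * m ℓ ≡ 2 ^ (a′ * n ℓ)
    2m≡ = ≡.cong (2 ^_) (suc-pred-pos 0<a′n)

    k≡ : k ℓ ≡ 2 * (m ℓ * 2 ^ n ℓ)
    k≡ = begin
      2 ^ (a * n ℓ)                ≡⟨ ≡.cong (λ a → 2 ^ (a * n ℓ)) a≡ ⟩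
      2 ^ (n ℓ + a′ * n ℓ)         ≡⟨ ℕₚ.^-distribˡ-+-* 2 (n ℓ) (a′ * n ℓ) ⟩
      2 ^ n ℓ * 2 ^ (a′ * n ℓ)     ≡⟨ ≡.cong (2 ^ n ℓ *_) 2m≡ ⟨
      2 ^ n ℓ * (2 * m ℓ)          ≡⟨ rotate (2 ^ n ℓ) (m ℓ) ⟩
      2 * (m ℓ * 2 ^ n ℓ) ∎
      where
      open ≡-Reasoning
      rotate : ∀ x y → x * (2 * y) ≡ 2 * (y * x)
      rotate = solve-∀

    2≤m2^n : 2 ≤ m ℓ * 2 ^ n ℓ
    2≤m2^n = ℕₚ.*-mono-≤ {1} {m ℓ} {2} (ℕₚ.m^n>0 2 (pred (a′ * n ℓ))) (ℕₚ.^-monoʳ-≤ 2 0<n)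

    -- The halving in the definition of `m` makes k = 2 * (m * 2 ^ n): one half pays for the `m`
    -- scales, the other leaves room for the initial pair.
    budget : 2 + m ℓ * 2 ^ n ℓ ≤ k ℓ
    budget = ≡.subst (2 + m ℓ * 2 ^ n ℓ ≤_) (≡.sym k≡) (ℕₚ.≤-trans
      (ℕₚ.+-monoˡ-≤ (m ℓ * 2 ^ n ℓ) 2≤m2^n)
      (ℕₚ.≤-reflexive (≡.cong (m ℓ * 2 ^ n ℓ +_) (≡.sym (ℕₚ.+-identityʳ _)))))

    3≤k : 3 ≤ k ℓ
    3≤k = ℕₚ.≤-trans (ℕₚ.n≤1+n 3) (ℕₚ.≤-trans (ℕₚ.+-monoʳ-≤ 2 2≤m2^n) budget)

    k-mono : k ℓ < k (suc ℓ)
    k-mono = ℕₚ.^-monoʳ-< 2 (s≤s (s≤s z≤n)) (ℕₚ.*-monoʳ-< a ⦃ ℕ.>-nonZero (ℕₚ.m^n>0 2 b) ⦄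
      (ℕₚ.*-monoʳ-< 128 (ℕₚ.^-monoʳ-< 2 (s≤s (s≤s z≤n)) (ℕₚ.n<1+n ℓ))))

    1+b≤m : 1 + b ≤ m ℓ
    1+b≤m = begin
      1 + b                       ≤⟨ ℕₚ.+-monoˡ-≤ b (s≤s (z≤n {b₀})) ⟩
      b + b                       ≡⟨ ≡.cong (b +_) (ℕₚ.+-identityʳ b) ⟨
      2 * b                       ≡⟨ ℕₚ.*-comm 2 b ⟩
      b * 2                       ≤⟨ ℕₚ.*-mono-≤ b≤a′ (ℕₚ.≤-trans (s≤s (s≤s z≤n)) 128≤n) ⟩
      a′ * n ℓ                    ≡⟨ suc-pred-pos 0<a′n ⟨
      suc (pred (a′ * n ℓ))       ≤⟨ n<2^n _ ⟩
      m ℓ ∎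
      where open ℕₚ.≤-Reasoning

    -- The cube must contain enough points for padding. Taking logarithms twice leaves b + e ≤ e *
    -- m, which follows from 1 + b ≤ m.
    k≤2^n^m : k ℓ ≤ 2 ^ (n ℓ ^ m ℓ)
    k≤2^n^m = ℕₚ.^-monoʳ-≤ 2 (≡.subst₂ _≤_ (≡.sym a*n≡) (≡.sym n^m≡) (ℕₚ.^-monoʳ-≤ 2 (begin
      b + e ℓ            ≤⟨ ℕₚ.+-monoˡ-≤ (e ℓ) (ℕₚ.m≤n*m b (e ℓ)) ⟩
      e ℓ * b + e ℓ      ≡⟨ ≡.trans (ℕₚ.+-comm (e ℓ * b) (e ℓ)) (≡.sym (ℕₚ.*-suc (e ℓ) b)) ⟩
      e ℓ * (1 + b)      ≤⟨ ℕₚ.*-monoʳ-≤ (e ℓ) 1+b≤m ⟩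
      e ℓ * m ℓ ∎)))
      where open ℕₚ.≤-Reasoning

    2^2m≤n^m : 2 ^ (2 * m ℓ) ≤ n ℓ ^ m ℓ
    2^2m≤n^m = ≡.subst (2 ^ (2 * m ℓ) ≤_) (≡.sym n^m≡)
      (ℕₚ.^-monoʳ-≤ 2 (ℕₚ.*-monoˡ-≤ (m ℓ) {2} {e ℓ} (s≤s (s≤s z≤n))))

-- Size of the aspect ratio and the constant of the bound.

module Assembly (em : ExcludedMiddle (lsuc 0ℓ)) (ℝ : CompleteOrderedField) where
  open OrderedField em ℝ
  open Adversary em ℝ using (hammingSpace)
  open Analysis em ℝ

  module _ {δ : Carrier} (0<δ : 0# < δ) (δ<1 : δ < 1#) where

    private
      b₀ : ℕ
      b₀ = proj₁ (archimedean 0<δ)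

    open Parameters b₀

    1≤aδ : 1# ≤ ι a * δ
    1≤aδ = ≤-trans (proj₂ (archimedean 0<δ)) (*-monoʳ-≤ (proj₁ 0<δ)
      (ι-mono (ℕₚ.≤-trans (ℕₚ.n≤1+n b₀) (ℕₚ.<⇒≤ (n<2^n b)))))

    -- From a * δ ≥ 1 one gets a * p ≤ a * q * (1 - δ) ≤ (a - 1) * q; adding `q` to both sides
    -- avoids subtraction in the naturals.
    exponent-bound : ∀ p q → ι p ≤ ι q * (1# - δ) → a ℕ.* p ℕ.≤ a′ ℕ.* q
    exponent-bound p q le = ℕₚ.+-cancelˡ-≤ q _ _ (≡.subst (q ℕ.+ a ℕ.* p ℕ.≤_) (≡.cong (ℕ._* q) a≡) (ι-cancel-≤ (begin
      ι (q ℕ.+ a ℕ.* p)                           ≈⟨ trans (ι-+ q (a ℕ.* p)) (+-congˡ (ι-* a p)) ⟩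
      ι q + ι a * ι p                             ≈⟨ +-congʳ (*-identityʳ (ι q)) ⟨
      ι q * 1# + ι a * ι p                        ≤⟨ +-mono-≤ (*-monoˡ-≤ (0≤ι q) 1≤aδ) (*-monoˡ-≤ (0≤ι a) le) ⟩
      ι q * (ι a * δ) + ι a * (ι q * (1# - δ))    ≈⟨ solve 4 (λ q a d c → q :* (a :* d) :+ a :* (q :* c) := a :* q :* (c :+ d))
                                                       refl (ι q) (ι a) δ (1# - δ) ⟩
      ι a * ι q * (1# - δ + δ)                    ≈⟨ trans (*-congˡ (y-x+x≈y 1# δ)) (*-identityʳ _) ⟩
      ι a * ι q                                   ≈⟨ ι-* a q ⟨
      ι (a ℕ.* q) ∎)))
      where open ≤-Reasoning

    module _ (ℓ : ℕ) where

      K Φ : Carrier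
      K = ι (k ℓ)
      Φ = FiniteMetricSpace.aspectRatio (hammingSpace (n ℓ) (m ℓ))

      Φ≈ : Φ ≈ ι (n ℓ ℕ.^ m ℓ)
      Φ≈ = aspectRatio≈ (n ℓ) (m ℓ) (Fin.fromℕ< (0<n ℓ))

      K-power : 0# ≤ K ^ʳ (1# - δ) × K ^ʳ (1# - δ) ≤ ι (2 ℕ.* m ℓ)
      K-power = ^ʳ-bounds (x≤y⇒0≤y-x (proj₁ δ<1)) (0≤ι (2 ℕ.* m ℓ)) λ p q _ le → begin
        K ^ p                                    ≈⟨ ι-^ (k ℓ) p ⟨
        ι (k ℓ ℕ.^ p)                            ≈⟨ ×-congˡ (ℕₚ.^-*-assoc 2 (a ℕ.* n ℓ) p) ⟩
        ι (2 ℕ.^ (a ℕ.* n ℓ ℕ.* p))              ≤⟨ ι-mono (ℕₚ.^-monoʳ-≤ 2 (exponents p q le)) ⟩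
        ι (2 ℕ.^ (a′ ℕ.* n ℓ ℕ.* q))             ≈⟨ ×-congˡ (ℕₚ.^-*-assoc 2 (a′ ℕ.* n ℓ) q) ⟨
        ι ((2 ℕ.^ (a′ ℕ.* n ℓ)) ℕ.^ q)           ≈⟨ ×-congˡ (≡.cong (ℕ._^ q) (2m≡ ℓ)) ⟨
        ι ((2 ℕ.* m ℓ) ℕ.^ q)                    ≈⟨ ι-^ (2 ℕ.* m ℓ) q ⟩
        ι (2 ℕ.* m ℓ) ^ q ∎
        where
        open ≤-Reasoning
        swap : ∀ a n p → a ℕ.* n ℕ.* p ≡ a ℕ.* p ℕ.* n
        swap = solve-∀
        exponents : ∀ p q → ι p ≤ ι q * (1# - δ) → a ℕ.* n ℓ ℕ.* p ℕ.≤ a′ ℕ.* n ℓ ℕ.* q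
        exponents p q le = ≡.subst₂ ℕ._≤_ (≡.sym (swap a (n ℓ) p)) (≡.sym (swap a′ (n ℓ) q))
          (ℕₚ.*-monoˡ-≤ (n ℓ) (exponent-bound p q le))

      -- The inner power is at most 2 * m by `K-power`, and 2 ^ (2 * m) ≤ n ^ m because n = 2 ^ e
      -- with e ≥ 2.
      Φ-large : ι 2 ^ʳ (K ^ʳ (1# - δ)) ≤ Φ
      Φ-large = ≤-trans (proj₂ (^ʳ-bounds (proj₁ K-power) (0≤ι (2 ℕ.^ (2 ℕ.* m ℓ))) λ p q _ le → begin
        ι 2 ^ p                              ≈⟨ ι-^ 2 p ⟨
        ι (2 ℕ.^ p)                          ≤⟨ ι-mono (ℕₚ.^-monoʳ-≤ 2 (exponents p q le)) ⟩
        ι (2 ℕ.^ (2 ℕ.* m ℓ ℕ.* q))          ≈⟨ ×-congˡ (ℕₚ.^-*-assoc 2 (2 ℕ.* m ℓ) q) ⟨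
        ι ((2 ℕ.^ (2 ℕ.* m ℓ)) ℕ.^ q)        ≈⟨ ι-^ (2 ℕ.^ (2 ℕ.* m ℓ)) q ⟩
        ι (2 ℕ.^ (2 ℕ.* m ℓ)) ^ q ∎))
        (≤-respʳ (sym Φ≈) (ι-mono (2^2m≤n^m ℓ)))
        where
        open ≤-Reasoning
        exponents : ∀ p q → ι p ≤ ι q * K ^ʳ (1# - δ) → p ℕ.≤ 2 ℕ.* m ℓ ℕ.* q
        exponents p q le = ι-cancel-≤ (begin
          ι p                       ≤⟨ le ⟩
          ι q * K ^ʳ (1# - δ)       ≤⟨ *-monoˡ-≤ (0≤ι q) (proj₂ K-power) ⟩
          ι q * ι (2 ℕ.* m ℓ)       ≈⟨ trans (*-comm _ _) (sym (ι-* (2 ℕ.* m ℓ) q)) ⟩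
          ι (2 ℕ.* m ℓ ℕ.* q) ∎)

    c : Carrier
    c = ι (128 ℕ.* a) ⁻¹

    0<ι128a : 0# < ι (128 ℕ.* a)
    0<ι128a = ι-pos (ℕₚ.*-mono-< {0} {128} (s≤s z≤n) (ℕₚ.m^n>0 2 b))

    0<c : 0# < c
    0<c = ⁻¹-pos 0<ι128a

    -- The three logarithms are a * n, e * m and b + e, so the quotient is at most a * n * m = 128 *
    -- a * (m * g). Hence the value of `c`, which depends on `δ` through `a` but not on `ℓ`.
    target-≤ : ∀ ℓ → c * (log₂ (K ℓ) * log₂ (Φ ℓ) / log₂ (log₂ (K ℓ))) ≤ ι (m ℓ ℕ.* g ℓ)
    target-≤ ℓ = begin
      c * (log₂ (K ℓ) * log₂ (Φ ℓ) / log₂ (log₂ (K ℓ)))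
        ≤⟨ *-monoˡ-≤ (proj₁ 0<c) (/-≤ 0<loglog numerator≤) ⟩
      c * ι (a ℕ.* n ℓ ℕ.* m ℓ)
        ≈⟨ *-congˡ (×-congˡ (arrange a (g ℓ) (m ℓ))) ⟩
      c * ι (128 ℕ.* a ℕ.* (m ℓ ℕ.* g ℓ))
        ≈⟨ *-congˡ (ι-* (128 ℕ.* a) (m ℓ ℕ.* g ℓ)) ⟩
      c * (ι (128 ℕ.* a) * ι (m ℓ ℕ.* g ℓ))
        ≈⟨ trans (sym (*-assoc _ _ _)) (trans (*-congʳ (trans (*-comm _ _) (inverseʳ 0<ι128a))) (*-identityˡ _)) ⟩
      ι (m ℓ ℕ.* g ℓ) ∎
      where
      open ≤-Reasoning
      arrange : ∀ a g m → a ℕ.* (128 ℕ.* g) ℕ.* m ≡ 128 ℕ.* a ℕ.* (m ℕ.* g)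
      arrange = solve-∀
      logK : log₂ (K ℓ) ≈ ι (a ℕ.* n ℓ)
      logK = log₂-2^ (a ℕ.* n ℓ) refl
      loglogK : log₂ (log₂ (K ℓ)) ≈ ι (b ℕ.+ e ℓ)
      loglogK = log₂-2^ (b ℕ.+ e ℓ) (trans logK (×-congˡ (a*n≡ ℓ)))
      logΦ : log₂ (Φ ℓ) ≈ ι (e ℓ ℕ.* m ℓ)
      logΦ = log₂-2^ (e ℓ ℕ.* m ℓ) (trans (Φ≈ ℓ) (×-congˡ (n^m≡ ℓ)))
      0<loglog : 0# < log₂ (log₂ (K ℓ))
      0<loglog = ≤-respʳ (sym loglogK) (0≤ι (b ℕ.+ e ℓ)) , λ 0≈ → proj₂ (ι-pos {b ℕ.+ e ℓ} (s≤s z≤n)) (trans 0≈ loglogK)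
      numerator≤ : log₂ (K ℓ) * log₂ (Φ ℓ) ≤ ι (a ℕ.* n ℓ ℕ.* m ℓ) * log₂ (log₂ (K ℓ))
      numerator≤ = begin
        log₂ (K ℓ) * log₂ (Φ ℓ)                      ≈⟨ *-cong logK logΦ ⟩
        ι (a ℕ.* n ℓ) * ι (e ℓ ℕ.* m ℓ)              ≤⟨ *-monoˡ-≤ (0≤ι (a ℕ.* n ℓ)) (ι-mono
                                                          (ℕₚ.*-monoˡ-≤ (m ℓ) (ℕₚ.m≤n+m (e ℓ) b))) ⟩
        ι (a ℕ.* n ℓ) * ι ((b ℕ.+ e ℓ) ℕ.* m ℓ)      ≈⟨ *-congˡ (trans (×-congˡ (ℕₚ.*-comm (b ℕ.+ e ℓ) (m ℓ))) (ι-* (m ℓ) (b ℕ.+ e ℓ))) ⟩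
        ι (a ℕ.* n ℓ) * (ι (m ℓ) * ι (b ℕ.+ e ℓ))    ≈⟨ *-assoc _ _ _ ⟨
        ι (a ℕ.* n ℓ) * ι (m ℓ) * ι (b ℕ.+ e ℓ)      ≈⟨ *-cong (ι-* (a ℕ.* n ℓ) (m ℓ)) loglogK ⟨
        ι (a ℕ.* n ℓ ℕ.* m ℓ) * log₂ (log₂ (K ℓ)) ∎

theorem1p5 : ExcludedMiddle (lsuc 0ℓ) → (ℝ : CompleteOrderedField) →
  let open Theory ℝ in
  ∀ (δ : Carrier) → 0# < δ → δ < 1# →
  Σ[ c ∈ Carrier ] 0# < c ×
  Σ[ V ∈ (ℕ → FiniteMetricSpace) ] Σ[ k ∈ (ℕ → ℕ) ]
    (∀ ℓ → k ℓ ℕ.< k (suc ℓ)) ×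
    (∀ ℓ →
      let Φ = FiniteMetricSpace.aspectRatio (V ℓ)
          K = ι (k ℓ)
      in
      3 ℕ.≤ k ℓ ×
      ι 2 ^ʳ (K ^ʳ (1# - δ)) ≤ Φ ×
      (∀ (𝓔 : ProbabilisticOnlineEmbedding (V ℓ) (k ℓ)) →
        Σ[ σ ∈ List (FiniteMetricSpace.Point (V ℓ)) ]
          length σ ≡ k ℓ × Unique σ ×
          ExpectedDistortionAtLeast (V ℓ) (k ℓ) 𝓔 σ
            (c * (log₂ K * log₂ Φ / log₂ (log₂ K)))))
theorem1p5 em ℝ δ 0<δ δ<1 =
  c 0<δ δ<1 , 0<c 0<δ δ<1 , (λ ℓ → hammingSpace (n ℓ) (m ℓ)) , k , k-mono , λ ℓ →
    3≤k ℓ , Φ-large 0<δ δ<1 ℓ , λ 𝓔 →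
      let σ , length≡ , unique , distorted = lower-bound (g ℓ) (m ℓ) (k ℓ) (0<g ℓ) 𝓔 (budget ℓ)
            (ℕₚ.≤-trans (k≤2^n^m ℓ) (ℕₚ.≤-reflexive (≡.sym (size≡ (n ℓ) (m ℓ)))))
      in σ , length≡ , unique , distorted (target-≤ 0<δ δ<1 ℓ)
  where
  open OrderedField em ℝ using (archimedean)
  open Ambient using (size≡)
  open Adversary em ℝ using (hammingSpace; lower-bound)
  open Assembly em ℝ
  open Parameters (proj₁ (archimedean 0<δ))
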